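{- Consider a (single-processor) cup game on $n$ cups, without resource augmentation. Suppose that the emptier follows a score-based emptying algorithm, and that the filler follows the oblivious fuzzing filling algorithm. Then at the beginning of the $n^{2/3}$-cup phase, the average fill of cups $1,2,\ldots,n^{2/3}$ (in the filler's labeling) is $\Omega(\log n)$ in expectation.
   Context: **Cup game.** There are $n$ initially empty cups. In each step the filler distributes $1$ unit of water among the cups, and then the emptier may remove water from a single cup. The fill of a cup is the (nonnegative) amount of water in it. **Score-based emptier.** A score-based emptier has real-valued score functions $\sigma_1,\ldots,\sigma_n$, each strictly increasing ($\sigma_i(a)<\sigma_i(b)$ whenever $a<b$), such that all the scores in the multiset $\{\sigma_i(j/2)\mid i\in[n],\ j\in\mathbb{Z}^+\}$ are distinct. In each step the emptier selects the cup $j$ whose fill $f_j$ maximizes $\sigma_j(f_j)$. It then either (a) removes $1$ full unit of water from that cup, or (b) skips its turn; this decision is an arbitrary function of the state of the cups. **Oblivious fuzzing filling algorithm.** Let $c\in\mathbb{N}$ be a sufficiently large constant. The filler first relabels the cups by a uniformly random permutation of $1,\ldots,n$ (from the filler's perspective). The strategy consists of $n$ phases of $n^{cn\log n}$ steps each (rounded to an integer). The $i$-th phase is called the $(n-i+1)$-cup phase. In each step of the $i$-th phase, the filler selects $x_1,x_2\in\{1,2,\ldots,n-i+1\}$ independently and uniformly at random and places $\tfrac12$ unit of water into each of cups $x_1,x_2$ (so cup $x_1$ receives a full unit if $x_1=x_2$). The quantity $n^{2/3}$ is understood as rounded to an integer. The constant hidden in $\Omega(\cdot)$ does not depend on $n$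 or on the score-based emptier. -}

module Defs where

open import Data.Bool using (Bool; true; if_then_else_)
open import Data.Fin using (Fin; zero)
open import Data.Fin.Permutation using (Permutation′; _⟨$⟩ʳ_; insert)
  renaming (id to idₚ)
open import Data.Integer as ℤ using (+_)
import Data.Integer.Properties as ℤ
open import Data.List
  using (List; []; _∷_; map; concatMap; length; take; allFin; foldr; cartesianProductWith)
open import Data.Nat as ℕ using (ℕ; zero; suc; _+_; _*_; _∸_; _^_; _≤_; _<_; s≤s; NonZero)
open import Data.Nat.Logarithm using (⌊log₂_⌋; ⌊log₂⌋-mono-≤; ⌊log₂[2^n]⌋≡n; ⌊log₂⌊n/2⌋⌋≡⌊log₂n⌋∸1)
import Data.Nat.Properties as ℕ
open import Data.Product using (∃-syntax; _×_; _,_)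
open import Data.Rational as ℚ using (ℚ; _/_; 0ℚ; 1ℚ; toℚᵘ; fromℚᵘ)
import Data.Rational.Properties as ℚ
open import Data.Rational.Unnormalised as ℚᵘ using (mkℚᵘ; *≤*; *≡*)
import Data.Rational.Unnormalised.Properties as ℚᵘ
open import Data.Sum using (inj₁; inj₂)
open import Data.Vec using (Vec; lookup; updateAt; replicate)
open import Relation.Binary.PropositionalEquality
  using (_≡_; refl; sym; trans; cong; subst; subst₂)
open import Relation.Nullary using (¬_)

-- Regular Cauchy sequences of rationals: seq i is within 1/(i+1) of the
-- limit.  Regularity is stated without absolute values, since i and j
-- may be exchanged.  Equality of reals is _≈ℝ_ below.

record ℝ : Set where
  field
    seq     : ℕ → ℚ
    regular : ∀ i j → seq i ℚ.≤ seq j ℚ.+ (+ 1 / suc i ℚ.+ + 1 / suc j)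

open ℝ public

infix 4 _<ℝ_ _≤ℝ_ _≈ℝ_

_<ℝ_ : ℝ → ℝ → Set
x <ℝ y = ∃[ i ] seq x i ℚ.+ + 2 / suc i ℚ.< seq y i

_≤ℝ_ : ℝ → ℝ → Set
x ≤ℝ y = ¬ (y <ℝ x)

_≈ℝ_ : ℝ → ℝ → Set
x ≈ℝ y = x ≤ℝ y × y ≤ℝ x

private
  +/-mono : ∀ a b c d → a * suc d ≤ c * suc b → + a / suc b ℚ.≤ + c / suc d
  +/-mono a b c d ad≤cb = ℚ.toℚᵘ-cancel-≤ (begin
    toℚᵘ (+ a / suc b)  ≃⟨ ℚ.toℚᵘ-fromℚᵘ (mkℚᵘ (+ a) b) ⟩
    mkℚᵘ (+ a) b        ≤⟨ *≤* (subst₂ ℤ._≤_ (ℤ.pos-* a (suc d)) (ℤ.pos-* c (suc b)) (ℤ.+≤+ ad≤cb)) ⟩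
    mkℚᵘ (+ c) d        ≃⟨ ℚ.toℚᵘ-fromℚᵘ (mkℚᵘ (+ c) d) ⟨
    toℚᵘ (+ c / suc d)  ∎)
    where open ℚᵘ.≤-Reasoning

  0≤1/ : ∀ i → 0ℚ ℚ.≤ + 1 / suc i
  0≤1/ i = +/-mono 0 0 1 i ℕ.z≤n

  p≤p+q : ∀ p q → 0ℚ ℚ.≤ q → p ℚ.≤ p ℚ.+ q
  p≤p+q p q 0≤q = subst (ℚ._≤ p ℚ.+ q) (ℚ.+-identityʳ p) (ℚ.+-monoʳ-≤ p 0≤q)

  q≤p+q : ∀ p q → 0ℚ ℚ.≤ p → q ℚ.≤ p ℚ.+ q
  q≤p+q p q 0≤p = subst (q ℚ.≤_) (ℚ.+-comm q p) (p≤p+q q p 0≤p)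

  suc/ : ∀ a d → + suc a / suc d ≡ + a / suc d ℚ.+ + 1 / suc d
  suc/ a d = ℚ.toℚᵘ-injective (begin-equality
    toℚᵘ (+ suc a / suc d)                      ≃⟨ ℚ.toℚᵘ-fromℚᵘ (mkℚᵘ (+ suc a) d) ⟩
    mkℚᵘ (+ suc a) d                            ≃⟨ *≡* numerators ⟩
    mkℚᵘ (+ a) d ℚᵘ.+ mkℚᵘ (+ 1) d              ≃⟨ ℚᵘ.+-cong (ℚ.toℚᵘ-fromℚᵘ (mkℚᵘ (+ a) d)) (ℚ.toℚᵘ-fromℚᵘ (mkℚᵘ (+ 1) d)) ⟨
    toℚᵘ (+ a / suc d) ℚᵘ.+ toℚᵘ (+ 1 / suc d)  ≃⟨ ℚ.toℚᵘ-homo-+ (+ a / suc d) (+ 1 / suc d) ⟨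
    toℚᵘ (+ a / suc d ℚ.+ + 1 / suc d)          ∎)
    where
    open ℚᵘ.≤-Reasoning
    D = + suc d
    numerators : + suc a ℤ.* (D ℤ.* D) ≡ (+ a ℤ.* D ℤ.+ + 1 ℤ.* D) ℤ.* D
    numerators = trans (sym (ℤ.*-assoc (+ suc a) D D))
      (cong (ℤ._* D) (trans (cong (ℤ._* D) (cong +_ (ℕ.+-comm 1 a))) (ℤ.*-distribʳ-+ D (+ a) (+ 1))))

fromℚ : ℚ → ℝ
fromℚ q .seq _       = q
fromℚ q .regular i j = p≤p+q q (+ 1 / suc i ℚ.+ + 1 / suc j) (ℚ.+-mono-≤ (0≤1/ i) (0≤1/ j))

private
  2*⌊n/2⌋≤n : ∀ n → 2 * ℕ.⌊ n /2⌋ ≤ n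
  2*⌊n/2⌋≤n n = begin
    ℕ.⌊ n /2⌋ + (ℕ.⌊ n /2⌋ + 0)  ≡⟨ cong (ℕ.⌊ n /2⌋ ℕ.+_) (ℕ.+-identityʳ _) ⟩
    ℕ.⌊ n /2⌋ + ℕ.⌊ n /2⌋        ≤⟨ ℕ.+-monoʳ-≤ ℕ.⌊ n /2⌋ (ℕ.⌊n/2⌋≤⌈n/2⌉ n) ⟩
    ℕ.⌊ n /2⌋ + ℕ.⌈ n /2⌉        ≡⟨ ℕ.⌊n/2⌋+⌈n/2⌉≡n n ⟩
    n                            ∎
    where open ℕ.≤-Reasoning

  2^≤ : ∀ e n .{{_ : NonZero n}} → e ≤ ⌊log₂ n ⌋ → 2 ^ e ≤ n
  2^≤ zero    (suc n)         _ = s≤s ℕ.z≤n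
  2^≤ (suc e) (suc (suc n)) e<l = ℕ.≤-trans
    (ℕ.*-monoʳ-≤ 2 (2^≤ e (suc ℕ.⌊ n /2⌋) (ℕ.s≤s⁻¹ (subst (suc e ≤_) half e<l))))
    (2*⌊n/2⌋≤n (suc (suc n)))
    where
    half : ⌊log₂ suc (suc n) ⌋ ≡ suc ⌊log₂ suc ℕ.⌊ n /2⌋ ⌋
    half = cong suc (sym (⌊log₂⌊n/2⌋⌋≡⌊log₂n⌋∸1 (suc (suc n))))

  ≤2^ : ∀ n → n ≤ 2 ^ suc ⌊log₂ n ⌋
  ≤2^ n with ℕ.≤-total n (2 ^ suc ⌊log₂ n ⌋)
  ... | inj₁ n≤2^ = n≤2^
  ... | inj₂ 2^≤n with () ← ℕ.1+n≰n
          (subst (_≤ ⌊log₂ n ⌋) (⌊log₂[2^n]⌋≡n (suc ⌊log₂ n ⌋)) (⌊log₂⌋-mono-≤ 2^≤n))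

  ⌊log₂^⌋-regular : ∀ n i j →
    ⌊log₂ n ^ suc i ⌋ * suc j ≤ suc ⌊log₂ n ^ suc j ⌋ * suc i
  ⌊log₂^⌋-regular zero      i j = ℕ.z≤n
  ⌊log₂^⌋-regular n@(suc _) i j = subst₂ _≤_ (⌊log₂[2^n]⌋≡n _) (⌊log₂[2^n]⌋≡n _)
    (⌊log₂⌋-mono-≤ (begin
      2 ^ (lᵢ * suc j)       ≡⟨ ℕ.^-*-assoc 2 lᵢ (suc j) ⟨
      (2 ^ lᵢ) ^ suc j       ≤⟨ ℕ.^-monoˡ-≤ (suc j) (2^≤ lᵢ (n ^ suc i) {{ℕ.m^n≢0 n (suc i)}} ℕ.≤-refl) ⟩
      (n ^ suc i) ^ suc j    ≡⟨ ℕ.^-*-assoc n (suc i) (suc j) ⟩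
      n ^ (suc i * suc j)    ≡⟨ cong (n ^_) (ℕ.*-comm (suc i) (suc j)) ⟩
      n ^ (suc j * suc i)    ≡⟨ ℕ.^-*-assoc n (suc j) (suc i) ⟨
      (n ^ suc j) ^ suc i    ≤⟨ ℕ.^-monoˡ-≤ (suc i) (≤2^ (n ^ suc j)) ⟩
      (2 ^ suc lⱼ) ^ suc i   ≡⟨ ℕ.^-*-assoc 2 (suc lⱼ) (suc i) ⟩
      2 ^ (suc lⱼ * suc i)   ∎))
    where
    open ℕ.≤-Reasoning
    lᵢ = ⌊log₂ n ^ suc i ⌋
    lⱼ = ⌊log₂ n ^ suc j ⌋

-- The binary logarithm of n ≥ 1, approximated by ⌊log₂ nᵏ⌋ / k with k = i+1,
-- which is within 1/k of it.  (log₂ 0 is 0.)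

log₂ : ℕ → ℝ
log₂ n .seq i       = + ⌊log₂ n ^ suc i ⌋ / suc i
log₂ n .regular i j = ℚ.≤-trans
  (+/-mono ⌊log₂ n ^ suc i ⌋ i (suc ⌊log₂ n ^ suc j ⌋) j (⌊log₂^⌋-regular n i j))
  (subst (ℚ._≤ seqⱼ ℚ.+ (+ 1 / suc i ℚ.+ + 1 / suc j)) (sym (suc/ ⌊log₂ n ^ suc j ⌋ j))
    (ℚ.+-monoʳ-≤ seqⱼ (q≤p+q (+ 1 / suc i) (+ 1 / suc j) (0≤1/ i))))
  where seqⱼ = + ⌊log₂ n ^ suc j ⌋ / suc j

-- For N ≥ 1 and a real y ≥ 0: m < N ^ y and N ^ y < m, by comparing with
-- N ^ (a / b) for a rational a / b on the appropriate side of y.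

_<Power[_,_] : ℕ → ℕ → ℝ → Set
m <Power[ N , y ] =
  ∃[ a ] ∃[ b ] fromℚ (+ a / suc b) ≤ℝ y × m ^ suc b < N ^ a

Power[_,_]<_ : ℕ → ℝ → ℕ → Set
Power[ N , y ]< m =
  ∃[ a ] ∃[ b ] y ≤ℝ fromℚ (+ a / suc b) × N ^ a < m ^ suc b

-- r results from rounding the positive real N ^ y to an integer, up or down:
-- r - 1 < N ^ y < r + 1.  The truncation of ∸ at r = 0 is harmless.

_RoundsPower[_,_] : ℕ → ℕ → ℝ → Set
r RoundsPower[ N , y ] = (r ∸ 1) <Power[ N , y ] × Power[ N , y ]< suc r

Dist : Set → Set
Dist A = List (ℚ × A)

return : ∀ {A} → A → Dist A
return a = (1ℚ , a) ∷ []

infixl 1 _>>=_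

_>>=_ : ∀ {A B} → Dist A → (A → Dist B) → Dist B
d >>= f = concatMap (λ (p , a) → map (λ (q , b) → (p ℚ.* q , b)) (f a)) d

-- Uniform over the entries of a list; every use has a nonempty list
-- without repetitions.

uniform : ∀ {A} → List A → Dist A
uniform []          = []
uniform xs@(_ ∷ ys) = map (λ x → (+ 1 / suc (length ys) , x)) xs

𝔼 : Dist ℚ → ℚ
𝔼 = foldr (λ (p , x) e → p ℚ.* x ℚ.+ e) 0ℚ

average : List ℚ → ℚ
average []          = 0ℚ
average xs@(_ ∷ ys) = foldr ℚ._+_ 0ℚ xs ℚ.* (+ 1 / suc (length ys))

-- Every permutation of Fin n, once each: insert zero j π maps zero to j.

permutations : ∀ n → List (Permutation′ n)
permutations zero    = idₚ ∷ []
permutations (suc n) = cartesianProductWith (insert zero) (allFin (suc n)) (permutations n)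

-- Water moves only in half units, so a state records for each cup the
-- number of half units in it.

State : ℕ → Set
State n = Vec ℕ n

empty : ∀ n → State n
empty n = replicate n 0

half : ℕ → ℚ
half h = + h / 2

fill : ∀ {n} → State n → Fin n → ℚ
fill s i = half (lookup s i)

-- Fills are nonnegative, so σ matters only on nonnegative reals.  The score
-- at fill 0 may tie with another score; select then resolves the tie.

record ScoreBasedEmptier (n : ℕ) : Set where
  field
    σ          : Fin n → ℝ → ℝ
    σ-cong     : ∀ i {x y} → x ≈ℝ y → σ i x ≈ℝ σ i y
    σ-mono     : ∀ i {x y} → fromℚ 0ℚ ≤ℝ x → x <ℝ y → σ i x <ℝ σ i y
    σ-distinct : ∀ i i′ j j′ → 1 ≤ j → 1 ≤ j′ →
                 σ i (fromℚ (half j)) ≈ℝ σ i′ (fromℚ (half j′)) →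
                 i ≡ i′ × j ≡ j′
    select     : State n → Fin n
    select-max : ∀ s i →
                 σ i (fromℚ (fill s i)) ≤ℝ σ (select s) (fromℚ (fill s (select s)))
    removes    : State n → Bool
    removable  : ∀ s → removes s ≡ true → 1ℚ ℚ.≤ fill s (select s)

  emptierMove : State n → State n
  emptierMove s = if removes s then updateAt s (select s) (_∸ 2) else s

open ScoreBasedEmptier public using (emptierMove)

addHalf : ∀ {n} → Fin n → State n → State n
addHalf i s = updateAt s i suc

labels : ∀ n → ℕ → List (Fin n)
labels n k = take k (allFin n)

module _ {n : ℕ} (e : ScoreBasedEmptier n) where

  -- π sends the filler's labels to the actual cups.

  step : Permutation′ n → ℕ → State n → Dist (State n)
  step π k s =
    uniform (labels n k) >>= λ x₁ →
    uniform (labels n k) >>= λ x₂ →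
    return (emptierMove e (addHalf (π ⟨$⟩ʳ x₂) (addHalf (π ⟨$⟩ʳ x₁) s)))

  phase : Permutation′ n → (L k : ℕ) → State n → Dist (State n)
  phase π zero    k s = return s
  phase π (suc L) k s = step π k s >>= phase π L k

  -- The (i+1)-th phase is the (n-i)-cup phase, so the m-cup phase begins
  -- after n-m phases.

  afterPhases : Permutation′ n → (L i : ℕ) → Dist (State n)
  afterPhases π L zero    = return (empty n)
  afterPhases π L (suc i) = afterPhases π L i >>= phase π L (n ∸ i)

  expectedAverageFill : (L m : ℕ) → ℚ
  expectedAverageFill L m = 𝔼 (
    uniform (permutations n)    >>= λ π →
    afterPhases π L (n ∸ m)     >>= λ s →
    return (average (map (λ x → fill s (π ⟨$⟩ʳ x)) (labels n m))))

{-# OPTIONS --safe #-}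
module Submission where

-- Count water in half units.  In the k-cup phase the active cups gain two half
-- units per step and lose two or none, so their total never decreases.  The cup
-- dropped after a phase is uniformly distributed given the past, so dropping it
-- preserves the expected average, and the average α k at the beginning of the
-- k-cup phase grows exactly by what the phases add to the totals.
--
-- Whatever the emptier does, the parities of the fills are nearly uniform at the
-- end of a phase.  So, if the total did not grow, the fills x differ in about k
-- places from the initial segment a of the half units in the order of scores, and
-- a random dropped cup d is expected to exceed a d by a constant.  While it does,
-- the filler may happen to fill the active cups up to a, upon which the emptier
-- must remove from d or skip; in a phase of n ^ (c n log n) steps this happens
-- again and again, and the active total grows by a constant fraction of the excess.
-- Hence α j ≥ α (j + 2) + Ω(1 / j) until the average is Ω(log n), and
-- summing from n down to n ^ (2/3) gives Ω(log n).

open import Algebra.Bundles using (CommutativeRing)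
import Algebra.Properties.Semiring.Sum
open import Data.Bool using (Bool; true; false; if_then_else_)
import Data.Bool.Properties as Bool
open import Data.Fin using (Fin; zero; suc; toℕ; fromℕ<; punchIn)
open import Data.Fin.Permutation as Perm
  using (Permutation′; _⟨$⟩ʳ_; _⟨$⟩ˡ_; _∘ₚ_; _≈_; flip; insert; remove; transpose)
import Data.Fin.Properties as Fin
open import Data.Integer as ℤ using (+_; +[1+_]; -[1+_])
import Data.Integer.Properties as ℤ
open import Data.List
  using (List; []; _∷_; _++_; map; length; take; allFin; tabulate; foldr; cartesianProductWith)
import Data.List.Properties as List
open import Data.Nat as ℕ
  using (ℕ; zero; suc; _+_; _*_; _∸_; _^_; _⊓_; _≤_; _<_; _<ᵇ_; z≤n; s≤s; NonZero)
import Data.Nat.DivMod as ℕ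
open import Data.Nat.Logarithm
  using (⌊log₂_⌋; ⌊log₂⌋-mono-≤; ⌊log₂[2^n]⌋≡n; ⌊log₂⌊n/2⌋⌋≡⌊log₂n⌋∸1)
import Data.Nat.Properties as ℕ
import Data.Nat.Tactic.RingSolver as ℕSolver
open import Data.Product using (∃-syntax; _×_; _,_; proj₁; proj₂)
open import Data.Rational as ℚ using (ℚ; mkℚ; _/_; 0ℚ; 1ℚ; ½; -_; toℚᵘ; fromℚᵘ)
  renaming (_+_ to _+ᵣ_; _*_ to _*ᵣ_; _-_ to _-ᵣ_; _≤_ to _≤ᵣ_; _<_ to _<ᵣ_)
import Data.Rational.Properties as ℚ
open import Data.Rational.Unnormalised as ℚᵘ using (ℚᵘ; mkℚᵘ; *≤*; *≡*)
import Data.Rational.Unnormalised.Properties as ℚᵘ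
open import Data.Sum using (_⊎_; inj₁; inj₂; [_,_]′)
open import Data.Vec using (lookup)
import Data.Vec.Properties as Vec
open import Defs
open import Function using (_∘_; id)
open import Level using (0ℓ)
open import Relation.Binary.Definitions using (tri<; tri≈; tri>)
open import Relation.Binary.PropositionalEquality
open import Relation.Nullary using (¬_; Dec; yes; no; does; contradiction; _×-dec_)
open import Relation.Nullary.Decidable using (True; toWitness; dec⇒maybe; dec-true; dec-false)
open import Relation.Nullary.Negation using (¬¬-map)
open import Tactic.RingSolver using (solve)
open import Tactic.RingSolver.Core.AlmostCommutativeRing
  using (AlmostCommutativeRing; fromCommutativeRing)

-- Expectations are used only as monotone linear functionals, and no event is ever conditioned on.
-- Each case distinction (did the total grow, did the emptier touch an active cup) is turned into a
-- linear inequality valid at every relevant state, whose expectation is then taken; `R` and `Lower`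
-- are designed for this.
--
-- The segment `a` holds one half unit more than the active cups do. So while the dropped cup
-- exceeds its level, both half units of a step can go below `a`. A cup that the emptier then
-- chooses among the active ones is strictly above its level, so at most one of the two half units
-- removed lay below: a lucky step nets at least one.
--
-- The number of lucky steps needed in a row is bounded by the amount of water, so the waiting time
-- is exponential in it, and the phase length suffices only for totals up to a budget `B` of n times
-- the logarithm of n. Beyond the budget the average is already large, hence the two cases at the
-- end.
--
-- Growth may occur either while the parities mix, in the (j + 2)-cup phase, or after the drop, in
-- the (j + 1)-cup phase. This is why α j is compared with α (j + 2).

private variable
  n : ℕ
  Ω Ω′ : Set

module ∑ℕ = Algebra.Properties.Semiring.Sum ℕ.+-*-semiring
module ∑ℚ = Algebra.Properties.Semiring.Sum (CommutativeRing.semiring ℚ.+-*-commutativeRing)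

-- Rational inequalities by certificates

ℚ-ring : AlmostCommutativeRing 0ℓ 0ℓ
ℚ-ring = fromCommutativeRing ℚ.+-*-commutativeRing (λ x → dec⇒maybe (0ℚ ℚ.≟ x))

infixl 6 _⊕_
infixl 7 _⊛_

_⊕_ : ∀ {p q} → 0ℚ ≤ᵣ p → 0ℚ ≤ᵣ q → 0ℚ ≤ᵣ p +ᵣ q
_⊕_ = ℚ.+-mono-≤

_⊛_ : ∀ {p q} → 0ℚ ≤ᵣ p → 0ℚ ≤ᵣ q → 0ℚ ≤ᵣ p *ᵣ q
_⊛_ {p} {q} 0≤p 0≤q = subst (_≤ᵣ p *ᵣ q) (ℚ.*-zeroˡ q)
  (ℚ.*-monoʳ-≤-nonNeg q {{ℚ.nonNegative 0≤q}} 0≤p)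

gap : ∀ {p q} → p ≤ᵣ q → 0ℚ ≤ᵣ q -ᵣ p
gap {p} {q} p≤q = subst (_≤ᵣ q -ᵣ p) (ℚ.+-inverseʳ p) (ℚ.+-monoˡ-≤ (- p) p≤q)

-- The format of nearly all rational estimates below: the certificate `r` is a combination of known
-- nonnegative differences, built with `gap`, `_⊕_`, `_⊛_` and `const`, and the ring solver checks
-- that it is the difference of the two sides.
≤-by : ∀ {p q r} → 0ℚ ≤ᵣ r → q ≡ p +ᵣ r → p ≤ᵣ q
≤-by {p} {q} {r} 0≤r q≡p+r = subst₂ _≤ᵣ_ (ℚ.+-identityʳ p) (sym q≡p+r) (ℚ.+-monoʳ-≤ p 0≤r)

const : ∀ c {_ : True (0ℚ ℚ.≤? c)} → 0ℚ ≤ᵣ c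
const c {w} = toWitness w

opaque
  -- Opaque, so that embedded naturals do not unfold to normalised fractions; `ι-/` exposes the
  -- fraction where a literal is wanted.
  ι : ℕ → ℚ
  ι k = + k / 1

-- The value at zero agrees with `average []` and with expectations over `uniform []`, so the
-- formulas for both hold for all lists.
inv : ℕ → ℚ
inv zero    = 0ℚ
inv (suc k) = + 1 / suc k

fromℚᵘ-+ : ∀ p q → fromℚᵘ p +ᵣ fromℚᵘ q ≡ fromℚᵘ (p ℚᵘ.+ q)
fromℚᵘ-+ p q = ℚ.toℚᵘ-injective (begin-equality
  toℚᵘ (fromℚᵘ p +ᵣ fromℚᵘ q)           ≃⟨ ℚ.toℚᵘ-homo-+ (fromℚᵘ p) (fromℚᵘ q) ⟩
  toℚᵘ (fromℚᵘ p) ℚᵘ.+ toℚᵘ (fromℚᵘ q)  ≃⟨ ℚᵘ.+-cong (ℚ.toℚᵘ-fromℚᵘ p) (ℚ.toℚᵘ-fromℚᵘ q) ⟩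
  p ℚᵘ.+ q                              ≃⟨ ℚ.toℚᵘ-fromℚᵘ (p ℚᵘ.+ q) ⟨
  toℚᵘ (fromℚᵘ (p ℚᵘ.+ q))              ∎)
  where open ℚᵘ.≤-Reasoning

fromℚᵘ-* : ∀ p q → fromℚᵘ p *ᵣ fromℚᵘ q ≡ fromℚᵘ (p ℚᵘ.* q)
fromℚᵘ-* p q = ℚ.toℚᵘ-injective (begin-equality
  toℚᵘ (fromℚᵘ p *ᵣ fromℚᵘ q)           ≃⟨ ℚ.toℚᵘ-homo-* (fromℚᵘ p) (fromℚᵘ q) ⟩
  toℚᵘ (fromℚᵘ p) ℚᵘ.* toℚᵘ (fromℚᵘ q)  ≃⟨ ℚᵘ.*-cong (ℚ.toℚᵘ-fromℚᵘ p) (ℚ.toℚᵘ-fromℚᵘ q) ⟩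
  p ℚᵘ.* q                              ≃⟨ ℚ.toℚᵘ-fromℚᵘ (p ℚᵘ.* q) ⟨
  toℚᵘ (fromℚᵘ (p ℚᵘ.* q))              ∎)
  where open ℚᵘ.≤-Reasoning

opaque
  unfolding ι

  ι-/ : ∀ k → ι k ≡ + k / 1
  ι-/ k = refl

  ι-+ : ∀ a b → ι (a + b) ≡ ι a +ᵣ ι b
  ι-+ a b = sym (trans (fromℚᵘ-+ a′ b′) (ℚ.fromℚᵘ-cong {a′ ℚᵘ.+ b′} {mkℚᵘ (+ (a + b)) 0}
    (*≡* (cong (ℤ._* + 1) (trans
      (cong₂ ℤ._+_ (ℤ.*-identityʳ (+ a)) (ℤ.*-identityʳ (+ b))) (sym (ℤ.pos-+ a b)))))))
    where
    a′ b′ : ℚᵘ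
    a′ = mkℚᵘ (+ a) 0
    b′ = mkℚᵘ (+ b) 0

  ι-* : ∀ a b → ι (a * b) ≡ ι a *ᵣ ι b
  ι-* a b = sym (trans (fromℚᵘ-* a′ b′) (ℚ.fromℚᵘ-cong {a′ ℚᵘ.* b′} {mkℚᵘ (+ (a * b)) 0}
    (*≡* (cong (ℤ._* + 1) (sym (ℤ.pos-* a b))))))
    where
    a′ b′ : ℚᵘ
    a′ = mkℚᵘ (+ a) 0
    b′ = mkℚᵘ (+ b) 0

  /-split : ∀ a d → + a / suc d ≡ ι a *ᵣ inv (suc d)
  /-split a d = sym (trans (fromℚᵘ-* a′ d′) (ℚ.fromℚᵘ-cong {a′ ℚᵘ.* d′} {mkℚᵘ (+ a) d}
    (*≡* (cong₂ ℤ._*_ (ℤ.*-identityʳ (+ a)) (cong (λ x → + suc x) (sym (ℕ.+-identityʳ d)))))))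
    where
    a′ d′ : ℚᵘ
    a′ = mkℚᵘ (+ a) 0
    d′ = mkℚᵘ (+ 1) d

  ι-inv : ∀ k → ι (suc k) *ᵣ inv (suc k) ≡ 1ℚ
  ι-inv k = trans (sym (/-split (suc k) k))
    (ℚ.fromℚᵘ-cong {mkℚᵘ (+ suc k) k} {mkℚᵘ (+ 1) 0} (*≡* (ℤ.*-comm (+ suc k) (+ 1))))

  ι-mono : ∀ {a b} → a ≤ b → ι a ≤ᵣ ι b
  ι-mono {a} {b} a≤b = ℚ.toℚᵘ-cancel-≤ (begin
    toℚᵘ (ι a)  ≃⟨ ℚ.toℚᵘ-fromℚᵘ (mkℚᵘ (+ a) 0) ⟩
    mkℚᵘ (+ a) 0 ≤⟨ *≤* (ℤ.*-monoʳ-≤-nonNeg (+ 1) (ℤ.+≤+ a≤b)) ⟩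
    mkℚᵘ (+ b) 0 ≃⟨ ℚ.toℚᵘ-fromℚᵘ (mkℚᵘ (+ b) 0) ⟨
    toℚᵘ (ι b)  ∎)
    where open ℚᵘ.≤-Reasoning

  ι-cancel : ∀ {a b} → ι a ≤ᵣ ι b → a ≤ b
  ι-cancel {a} {b} ιa≤ιb = ℤ.drop‿+≤+ (subst₂ ℤ._≤_ (ℤ.*-identityʳ (+ a)) (ℤ.*-identityʳ (+ b))
    (ℚᵘ.drop-*≤* (begin
    mkℚᵘ (+ a) 0 ≃⟨ ℚ.toℚᵘ-fromℚᵘ (mkℚᵘ (+ a) 0) ⟨
    toℚᵘ (ι a)  ≤⟨ ℚ.toℚᵘ-mono-≤ ιa≤ιb ⟩
    toℚᵘ (ι b)  ≃⟨ ℚ.toℚᵘ-fromℚᵘ (mkℚᵘ (+ b) 0) ⟩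
    mkℚᵘ (+ b) 0 ∎)))
    where open ℚᵘ.≤-Reasoning

0≤ι : ∀ k → 0ℚ ≤ᵣ ι k
0≤ι k = subst (_≤ᵣ ι k) (ι-/ 0) (ι-mono {0} {k} z≤n)

0≤inv : ∀ k → 0ℚ ≤ᵣ inv k
0≤inv zero    = ℚ.≤-refl
0≤inv (suc k) = ℚ.nonNegative⁻¹ (inv (suc k)) {{ℚ.normalize-nonNeg 1 (suc k)}}

cancel-ι : ∀ k {p q} → ι (suc k) *ᵣ p ≤ᵣ ι (suc k) *ᵣ q → p ≤ᵣ q
cancel-ι k {p} {q} h = subst₂ _≤ᵣ_ (drop p) (drop q)
  (ℚ.*-monoˡ-≤-nonNeg (inv (suc k)) {{ℚ.nonNegative (0≤inv (suc k))}} h)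
  where
  drop : ∀ x → inv (suc k) *ᵣ (ι (suc k) *ᵣ x) ≡ x
  drop x = trans (sym (ℚ.*-assoc (inv (suc k)) (ι (suc k)) x))
    (trans (cong (_*ᵣ x) (trans (ℚ.*-comm (inv (suc k)) (ι (suc k))) (ι-inv k))) (ℚ.*-identityˡ x))

*-monoˡ : ∀ {r p q} → 0ℚ ≤ᵣ r → p ≤ᵣ q → r *ᵣ p ≤ᵣ r *ᵣ q
*-monoˡ {r} 0≤r = ℚ.*-monoˡ-≤-nonNeg r {{ℚ.nonNegative 0≤r}}

-- Sums over the cups of a set given by a Boolean mask

infix 8 ⟦_⟧_ ⟨_⟩_

⟦_⟧_ : Bool → ℕ → ℕ
⟦ b ⟧ x = if b then x else 0

⟨_⟩_ : Bool → ℚ → ℚ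
⟨ b ⟩ x = if b then x else 0ℚ

∑ℕ-mono : {f g : Fin n → ℕ} → (∀ i → f i ≤ g i) → ∑ℕ.sum f ≤ ∑ℕ.sum g
∑ℕ-mono {zero}  h = z≤n
∑ℕ-mono {suc n} h = ℕ.+-mono-≤ (h zero) (∑ℕ-mono (h ∘ suc))

∑ℚ-mono : {f g : Fin n → ℚ} → (∀ i → f i ≤ᵣ g i) → ∑ℚ.sum f ≤ᵣ ∑ℚ.sum g
∑ℚ-mono {zero}  h = ℚ.≤-refl
∑ℚ-mono {suc n} h = ℚ.+-mono-≤ (h zero) (∑ℚ-mono (h ∘ suc))

-- Adding the two entries at `d` crosswise avoids truncated subtraction. The effect on a total of
-- changing or deleting one cup is computed from this.
∑ℕ-exchange-≤ : {f g : Fin n → ℕ} (d : Fin n) → (∀ i → i ≢ d → f i ≤ g i) →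
                ∑ℕ.sum f + g d ≤ ∑ℕ.sum g + f d
∑ℕ-exchange-≤ {suc n} {f} {g} zero    h = begin
  f zero + F + g zero ≡⟨ ℕ.+-comm (f zero + F) (g zero) ⟩
  g zero + (f zero + F) ≡⟨ cong (g zero ℕ.+_) (ℕ.+-comm (f zero) F) ⟩
  g zero + (F + f zero) ≡⟨ ℕ.+-assoc (g zero) F (f zero) ⟨
  g zero + F + f zero ≤⟨ ℕ.+-monoˡ-≤ (f zero) (ℕ.+-monoʳ-≤ (g zero) (∑ℕ-mono (λ i → h (suc i) (λ ())))) ⟩
  g zero + G + f zero ∎
  where
  open ℕ.≤-Reasoning
  F = ∑ℕ.sum (f ∘ suc)
  G = ∑ℕ.sum (g ∘ suc)
∑ℕ-exchange-≤ {suc n} {f} {g} (suc d) h = begin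
  f zero + ∑ℕ.sum (f ∘ suc) + g (suc d) ≡⟨ ℕ.+-assoc (f zero) _ _ ⟩
  f zero + (∑ℕ.sum (f ∘ suc) + g (suc d)) ≤⟨ ℕ.+-mono-≤ (h zero (λ ()))
     (∑ℕ-exchange-≤ {n} {f ∘ suc} {g ∘ suc} d (λ i i≢d → h (suc i) (i≢d ∘ Fin.suc-injective))) ⟩
  g zero + (∑ℕ.sum (g ∘ suc) + f (suc d)) ≡⟨ ℕ.+-assoc (g zero) _ _ ⟨
  g zero + ∑ℕ.sum (g ∘ suc) + f (suc d) ∎
  where open ℕ.≤-Reasoning

∑ℕ-exchange : {f g : Fin n → ℕ} (d : Fin n) → (∀ i → i ≢ d → f i ≡ g i) →
              ∑ℕ.sum f + g d ≡ ∑ℕ.sum g + f d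
∑ℕ-exchange d h = ℕ.≤-antisym (∑ℕ-exchange-≤ d (λ i i≢d → ℕ.≤-reflexive (h i i≢d)))
  (∑ℕ-exchange-≤ d (λ i i≢d → ℕ.≤-reflexive (sym (h i i≢d))))

∑ℚ-exchange : {f g : Fin n → ℚ} (d : Fin n) → (∀ i → i ≢ d → f i ≡ g i) →
              ∑ℚ.sum f +ᵣ g d ≡ ∑ℚ.sum g +ᵣ f d
∑ℚ-exchange {suc n} {f} {g} zero    h = trans
  (cong (λ x → f zero +ᵣ x +ᵣ g zero) (∑ℚ.sum-cong-≗ (λ i → h (suc i) (λ ()))))
  (comm (f zero) (∑ℚ.sum (g ∘ suc)) (g zero))
  where
  comm : ∀ a b c → a +ᵣ b +ᵣ c ≡ c +ᵣ b +ᵣ a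
  comm a b c = solve (a ∷ b ∷ c ∷ []) ℚ-ring
∑ℚ-exchange {suc n} {f} {g} (suc d) h = begin
  f zero +ᵣ ∑ℚ.sum (f ∘ suc) +ᵣ g (suc d) ≡⟨ ℚ.+-assoc (f zero) _ _ ⟩
  f zero +ᵣ (∑ℚ.sum (f ∘ suc) +ᵣ g (suc d)) ≡⟨ cong₂ _+ᵣ_ (h zero (λ ()))
     (∑ℚ-exchange {n} {f ∘ suc} {g ∘ suc} d (λ i i≢d → h (suc i) (i≢d ∘ Fin.suc-injective))) ⟩
  g zero +ᵣ (∑ℚ.sum (g ∘ suc) +ᵣ f (suc d)) ≡⟨ ℚ.+-assoc (g zero) _ _ ⟨
  g zero +ᵣ ∑ℚ.sum (g ∘ suc) +ᵣ f (suc d) ∎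
  where open ≡-Reasoning

ι-∑ : (f : Fin n → ℕ) → ι (∑ℕ.sum f) ≡ ∑ℚ.sum (ι ∘ f)
ι-∑ {zero}  f = ι-/ 0
ι-∑ {suc n} f = trans (ι-+ (f zero) (∑ℕ.sum (f ∘ suc))) (cong (ι (f zero) +ᵣ_) (ι-∑ (f ∘ suc)))

⟨⟩-ι : ∀ b x → ι (⟦ b ⟧ x) ≡ ⟨ b ⟩ ι x
⟨⟩-ι true  x = refl
⟨⟩-ι false x = ι-/ 0

⟨⟩-+ : ∀ b x y → ⟨ b ⟩ (x +ᵣ y) ≡ ⟨ b ⟩ x +ᵣ ⟨ b ⟩ y
⟨⟩-+ true  x y = refl
⟨⟩-+ false x y = refl

⟨⟩-* : ∀ b c x → ⟨ b ⟩ (c *ᵣ x) ≡ c *ᵣ ⟨ b ⟩ x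
⟨⟩-* true  c x = refl
⟨⟩-* false c x = sym (ℚ.*-zeroʳ c)

⟨⟩-mono : ∀ b {x y} → (b ≡ true → x ≤ᵣ y) → ⟨ b ⟩ x ≤ᵣ ⟨ b ⟩ y
⟨⟩-mono true  h = h refl
⟨⟩-mono false h = ℚ.≤-refl

⟦⟧-mono : ∀ b {x y} → (b ≡ true → x ≤ y) → ⟦ b ⟧ x ≤ ⟦ b ⟧ y
⟦⟧-mono true  h = h refl
⟦⟧-mono false h = z≤n

⟦⟧-+ : ∀ b x y → ⟦ b ⟧ (x + y) ≡ ⟦ b ⟧ x + ⟦ b ⟧ y
⟦⟧-+ true  x y = refl
⟦⟧-+ false x y = refl

∑⟨_⟩ : (Fin n → Bool) → (Fin n → ℚ) → ℚ
∑⟨ A ⟩ F = ∑ℚ.sum (λ i → ⟨ A i ⟩ F i)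

∑⟦_⟧ : (Fin n → Bool) → (Fin n → ℕ) → ℕ
∑⟦ A ⟧ f = ∑ℕ.sum (λ i → ⟦ A i ⟧ f i)

module _ (A : Fin n → Bool) where

  ∑⟨⟩-+ : ∀ F G → ∑⟨ A ⟩ (λ i → F i +ᵣ G i) ≡ ∑⟨ A ⟩ F +ᵣ ∑⟨ A ⟩ G
  ∑⟨⟩-+ F G = trans (∑ℚ.sum-cong-≗ (λ i → ⟨⟩-+ (A i) (F i) (G i)))
    (∑ℚ.∑-distrib-+ (λ i → ⟨ A i ⟩ F i) (λ i → ⟨ A i ⟩ G i))

  ∑⟨⟩-* : ∀ c F → ∑⟨ A ⟩ (λ i → c *ᵣ F i) ≡ c *ᵣ ∑⟨ A ⟩ F
  ∑⟨⟩-* c F = trans (∑ℚ.sum-cong-≗ (λ i → ⟨⟩-* (A i) c (F i)))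
    (sym (∑ℚ.*-distribˡ-sum c (λ i → ⟨ A i ⟩ F i)))

  ∑⟨⟩-mono : ∀ {F G} → (∀ i → A i ≡ true → F i ≤ᵣ G i) → ∑⟨ A ⟩ F ≤ᵣ ∑⟨ A ⟩ G
  ∑⟨⟩-mono h = ∑ℚ-mono (λ i → ⟨⟩-mono (A i) (h i))

  ∑⟨⟩-ι : ∀ f → ι (∑⟦ A ⟧ f) ≡ ∑⟨ A ⟩ (ι ∘ f)
  ∑⟨⟩-ι f = trans (ι-∑ (λ i → ⟦ A i ⟧ f i)) (∑ℚ.sum-cong-≗ (λ i → ⟨⟩-ι (A i) (f i)))

  ∑⟦⟧-mono : ∀ {f g} → (∀ i → A i ≡ true → f i ≤ g i) → ∑⟦ A ⟧ f ≤ ∑⟦ A ⟧ g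
  ∑⟦⟧-mono h = ∑ℕ-mono (λ i → ⟦⟧-mono (A i) (h i))

  ∑⟦⟧-+ : ∀ f g → ∑⟦ A ⟧ (λ i → f i + g i) ≡ ∑⟦ A ⟧ f + ∑⟦ A ⟧ g
  ∑⟦⟧-+ f g = trans (∑ℕ.sum-cong-≗ (λ i → ⟦⟧-+ (A i) (f i) (g i)))
    (∑ℕ.∑-distrib-+ (λ i → ⟦ A i ⟧ f i) (λ i → ⟦ A i ⟧ g i))

  ∑⟨⟩-const : ∀ c → ∑⟨ A ⟩ (λ _ → c) ≡ ι (∑⟦ A ⟧ (λ _ → 1)) *ᵣ c
  ∑⟨⟩-const c = begin
    ∑⟨ A ⟩ (λ _ → c)            ≡⟨ ∑ℚ.sum-cong-≗ (λ i → cong (⟨ A i ⟩_) (sym (ℚ.*-identityʳ c))) ⟩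
    ∑⟨ A ⟩ (λ _ → c *ᵣ 1ℚ)      ≡⟨ ∑⟨⟩-* c (λ _ → 1ℚ) ⟩
    c *ᵣ ∑⟨ A ⟩ (λ _ → 1ℚ)      ≡⟨ ℚ.*-comm c _ ⟩
    ∑⟨ A ⟩ (λ _ → 1ℚ) *ᵣ c      ≡⟨ cong (_*ᵣ c) (trans (∑⟨⟩-ι (λ _ → 1)) (∑ℚ.sum-cong-≗ (λ i → cong (⟨ A i ⟩_) (ι-/ 1)))) ⟨
    ι (∑⟦ A ⟧ (λ _ → 1)) *ᵣ c   ∎
    where open ≡-Reasoning

-- Expectations

-- An expectation as a functional on random variables. Monotonicity, linearity and the value on
-- constants are all that is used of probability, and they compose along sequential random choices
-- by `bind-isMean`.
record IsMean {S : Set} (E : (S → ℚ) → ℚ) : Set where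
  field
    mono    : ∀ {F G} → (∀ s → F s ≤ᵣ G s) → E F ≤ᵣ E G
    +-homo  : ∀ F G → E (λ s → F s +ᵣ G s) ≡ E F +ᵣ E G
    *-homo  : ∀ c F → E (λ s → c *ᵣ F s) ≡ c *ᵣ E F
    1-homo  : E (λ _ → 1ℚ) ≡ 1ℚ

  E-cong : ∀ {F G} → (∀ s → F s ≡ G s) → E F ≡ E G
  E-cong h = ℚ.≤-antisym (mono (λ s → ℚ.≤-reflexive (h s))) (mono (λ s → ℚ.≤-reflexive (sym (h s))))

  E-const : ∀ c → E (λ _ → c) ≡ c
  E-const c = begin
    E (λ _ → c)         ≡⟨ E-cong (λ _ → sym (ℚ.*-identityʳ c)) ⟩
    E (λ _ → c *ᵣ 1ℚ)   ≡⟨ *-homo c (λ _ → 1ℚ) ⟩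
    c *ᵣ E (λ _ → 1ℚ)   ≡⟨ cong (c *ᵣ_) 1-homo ⟩
    c *ᵣ 1ℚ             ≡⟨ ℚ.*-identityʳ c ⟩
    c                   ∎
    where open ≡-Reasoning

  E-∑ : ∀ (F : Fin n → S → ℚ) → E (λ s → ∑ℚ.sum (λ i → F i s)) ≡ ∑ℚ.sum (λ i → E (F i))
  E-∑ {zero}  F = E-const 0ℚ
  E-∑ {suc n} F = trans (+-homo (F zero) _) (cong (E (F zero) +ᵣ_) (E-∑ (F ∘ suc)))

  E-⟨⟩ : ∀ b F → E (λ s → ⟨ b ⟩ F s) ≡ ⟨ b ⟩ E F
  E-⟨⟩ true  F = refl
  E-⟨⟩ false F = E-const 0ℚ

  E-∑⟨⟩ : ∀ A (F : Fin n → S → ℚ) → E (λ s → ∑⟨ A ⟩ (λ i → F i s)) ≡ ∑⟨ A ⟩ (λ i → E (F i))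
  E-∑⟨⟩ A F = trans (E-∑ (λ i s → ⟨ A i ⟩ F i s)) (∑ℚ.sum-cong-≗ (λ i → E-⟨⟩ (A i) (F i)))

open IsMean public

point-isMean : ∀ {S : Set} (s : S) → IsMean (λ F → F s)
point-isMean s = record
  { mono = λ h → h s ; +-homo = λ _ _ → refl ; *-homo = λ _ _ → refl ; 1-homo = refl }

bind-isMean : ∀ {S T : Set} {E : (S → ℚ) → ℚ} {E′ : S → (T → ℚ) → ℚ} →
              IsMean E → (∀ s → IsMean (E′ s)) → IsMean (λ F → E (λ s → E′ s F))
bind-isMean m m′ = record
  { mono   = λ h → mono m (λ s → mono (m′ s) h)
  ; +-homo = λ F G → trans (E-cong m (λ s → +-homo (m′ s) F G)) (+-homo m _ _)
  ; *-homo = λ c F → trans (E-cong m (λ s → *-homo (m′ s) c F)) (*-homo m c _)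
  ; 1-homo = trans (E-cong m (λ s → 1-homo (m′ s))) (1-homo m)
  }

∣_∣ᴬ : (Fin n → Bool) → ℕ
∣ A ∣ᴬ = ∑⟦ A ⟧ (λ _ → 1)

inv-cancel : ∀ {k} → 1 ≤ k → inv k *ᵣ ι k ≡ 1ℚ
inv-cancel {suc k} _ = trans (ℚ.*-comm (inv (suc k)) (ι (suc k))) (ι-inv k)

μ : (Fin n → Bool) → (Fin n → ℚ) → ℚ
μ A F = inv ∣ A ∣ᴬ *ᵣ ∑⟨ A ⟩ F

μ-isMean : (A : Fin n → Bool) → 1 ≤ ∣ A ∣ᴬ → IsMean (μ A)
μ-isMean A 1≤∣A∣ = record
  { mono   = λ h → *-monoˡ (0≤inv ∣ A ∣ᴬ) (∑⟨⟩-mono A (λ i _ → h i))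
  ; +-homo = λ F G → trans (cong (inv ∣ A ∣ᴬ *ᵣ_) (∑⟨⟩-+ A F G)) (ℚ.*-distribˡ-+ (inv ∣ A ∣ᴬ) _ _)
  ; *-homo = λ c F → trans (cong (inv ∣ A ∣ᴬ *ᵣ_) (∑⟨⟩-* A c F)) (swap (inv ∣ A ∣ᴬ) c (∑⟨ A ⟩ F))
  ; 1-homo = trans (cong (inv ∣ A ∣ᴬ *ᵣ_) (trans (∑⟨⟩-const A 1ℚ) (ℚ.*-identityʳ _))) (inv-cancel 1≤∣A∣)
  }
  where
  swap : ∀ a b c → a *ᵣ (b *ᵣ c) ≡ b *ᵣ (a *ᵣ c)
  swap a b c = solve (a ∷ b ∷ c ∷ []) ℚ-ring

μ-mono : (A : Fin n → Bool) {F G : Fin n → ℚ} → (∀ i → A i ≡ true → F i ≤ᵣ G i) → μ A F ≤ᵣ μ A G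
μ-mono A h = *-monoˡ (0≤inv ∣ A ∣ᴬ) (∑⟨⟩-mono A h)

μ-cong : ∀ (A : Fin n → Bool) {F G : Fin n → ℚ} → (∀ c → F c ≡ G c) → μ A F ≡ μ A G
μ-cong A h = cong (inv ∣ A ∣ᴬ *ᵣ_) (∑ℚ.sum-cong-≗ (λ c → cong (⟨ A c ⟩_) (h c)))

∑⟨⟩-mask-cong : ∀ {A B : Fin n → Bool} → A ≗ B → ∀ F → ∑⟨ A ⟩ F ≡ ∑⟨ B ⟩ F
∑⟨⟩-mask-cong A≗B F = ∑ℚ.sum-cong-≗ (λ c → cong (λ b → ⟨ b ⟩ F c) (A≗B c))

∑⟦⟧-mask-cong : ∀ {A B : Fin n → Bool} → A ≗ B → ∀ f → ∑⟦ A ⟧ f ≡ ∑⟦ B ⟧ f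
∑⟦⟧-mask-cong A≗B f = ∑ℕ.sum-cong-≗ (λ c → cong (λ b → ⟦ b ⟧ f c) (A≗B c))

μ-mask-cong : ∀ {A B : Fin n → Bool} → A ≗ B → ∀ F → μ A F ≡ μ B F
μ-mask-cong A≗B F = cong₂ (λ k x → inv k *ᵣ x) (∑⟦⟧-mask-cong A≗B (λ _ → 1)) (∑⟨⟩-mask-cong A≗B F)

-- Weighted lists as expectation functionals

expect : Dist Ω → (Ω → ℚ) → ℚ
expect []            F = 0ℚ
expect ((p , x) ∷ d) F = p *ᵣ F x +ᵣ expect d F

𝔼≡expect : ∀ d → 𝔼 d ≡ expect d id
𝔼≡expect []            = refl
𝔼≡expect ((p , x) ∷ d) = cong (p *ᵣ x +ᵣ_) (𝔼≡expect d)

expect-++ : ∀ (d d′ : Dist Ω) F → expect (d ++ d′) F ≡ expect d F +ᵣ expect d′ F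
expect-++ []            d′ F = sym (ℚ.+-identityˡ _)
expect-++ ((p , x) ∷ d) d′ F = trans (cong (p *ᵣ F x +ᵣ_) (expect-++ d d′ F)) (sym (ℚ.+-assoc (p *ᵣ F x) _ _))

expect-scale : ∀ p (d : Dist Ω) F → expect (map (λ (q , x) → (p *ᵣ q , x)) d) F ≡ p *ᵣ expect d F
expect-scale p []            F = sym (ℚ.*-zeroʳ p)
expect-scale p ((q , x) ∷ d) F = trans (cong (p *ᵣ q *ᵣ F x +ᵣ_) (expect-scale p d F))
  (distr p q (F x) (expect d F))
  where
  distr : ∀ p q x y → p *ᵣ q *ᵣ x +ᵣ p *ᵣ y ≡ p *ᵣ (q *ᵣ x +ᵣ y)
  distr p q x y = solve (p ∷ q ∷ x ∷ y ∷ []) ℚ-ring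

expect->>= : ∀ (d : Dist Ω) (f : Ω → Dist Ω′) F → expect (d >>= f) F ≡ expect d (λ x → expect (f x) F)
expect->>= []            f F = refl
expect->>= ((p , x) ∷ d) f F = trans (expect-++ (map _ (f x)) (d >>= f) F)
  (cong₂ _+ᵣ_ (expect-scale p (f x) F) (expect->>= d f F))

expect-cong : ∀ (d : Dist Ω) {F G} → (∀ x → F x ≡ G x) → expect d F ≡ expect d G
expect-cong []            h = refl
expect-cong ((p , x) ∷ d) h = cong₂ (λ a b → p *ᵣ a +ᵣ b) (h x) (expect-cong d h)

expect-return : ∀ (x : Ω) F → expect (return x) F ≡ F x
expect-return x F = trans (ℚ.+-identityʳ _) (ℚ.*-identityˡ (F x))

sumᴸ : List Ω → (Ω → ℚ) → ℚ
sumᴸ []       F = 0ℚ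
sumᴸ (x ∷ xs) F = F x +ᵣ sumᴸ xs F

expect-uniform : ∀ (xs : List Ω) F → expect (uniform xs) F ≡ inv (length xs) *ᵣ sumᴸ xs F
expect-uniform []          F = refl
expect-uniform (x ∷ xs) F = weights (x ∷ xs)
  where
  c = inv (suc (length xs))
  weights : ∀ ys → expect (map (λ y → (c , y)) ys) F ≡ c *ᵣ sumᴸ ys F
  weights []       = sym (ℚ.*-zeroʳ c)
  weights (y ∷ ys) = trans (cong (c *ᵣ F y +ᵣ_) (weights ys)) (sym (ℚ.*-distribˡ-+ c (F y) _))

sumᴸ-++ : ∀ (xs ys : List Ω) F → sumᴸ (xs ++ ys) F ≡ sumᴸ xs F +ᵣ sumᴸ ys F
sumᴸ-++ []       ys F = sym (ℚ.+-identityˡ _)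
sumᴸ-++ (x ∷ xs) ys F = trans (cong (F x +ᵣ_) (sumᴸ-++ xs ys F)) (sym (ℚ.+-assoc (F x) _ _))

sumᴸ-map : ∀ (f : Ω → Ω′) xs F → sumᴸ (map f xs) F ≡ sumᴸ xs (F ∘ f)
sumᴸ-map f []       F = refl
sumᴸ-map f (x ∷ xs) F = cong (F (f x) +ᵣ_) (sumᴸ-map f xs F)

sumᴸ-product : ∀ {Ω″ : Set} (f : Ω → Ω′ → Ω″) xs ys F →
  sumᴸ (cartesianProductWith f xs ys) F ≡ sumᴸ xs (λ x → sumᴸ ys (λ y → F (f x y)))
sumᴸ-product f []       ys F = refl
sumᴸ-product f (x ∷ xs) ys F = trans (sumᴸ-++ (map (f x) ys) (cartesianProductWith f xs ys) F)
  (cong₂ _+ᵣ_ (sumᴸ-map (f x) ys F) (sumᴸ-product f xs ys F))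

sumᴸ-cong : ∀ (xs : List Ω) {F G} → (∀ x → F x ≡ G x) → sumᴸ xs F ≡ sumᴸ xs G
sumᴸ-cong []       h = refl
sumᴸ-cong (x ∷ xs) h = cong₂ _+ᵣ_ (h x) (sumᴸ-cong xs h)

sumᴸ-take : ∀ k (f : Fin n → Ω) F →
  sumᴸ (take k (tabulate f)) F ≡ ∑ℚ.sum (λ x → ⟨ toℕ x <ᵇ k ⟩ F (f x))
sumᴸ-take {n}     zero    f F = sym (∑ℚ.sum-replicate-zero n)
sumᴸ-take {zero}  (suc k) f F = refl
sumᴸ-take {suc n} (suc k) f F = cong (F (f zero) +ᵣ_) (sumᴸ-take k (f ∘ suc) F)

sumᴸ-tabulate : ∀ (f : Fin n → Ω) F → sumᴸ (tabulate f) F ≡ ∑ℚ.sum (F ∘ f)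
sumᴸ-tabulate {zero}  f F = refl
sumᴸ-tabulate {suc n} f F = cong (F (f zero) +ᵣ_) (sumᴸ-tabulate (f ∘ suc) F)

uniform-isMean : ∀ (xs : List Ω) → 1 ≤ length xs → IsMean (expect (uniform xs))
uniform-isMean xs 1≤len = record
  { mono   = λ {F} {G} h → subst₂ _≤ᵣ_ (sym (expect-uniform xs F)) (sym (expect-uniform xs G))
      (*-monoˡ (0≤inv (length xs)) (sum-mono xs h))
  ; +-homo = λ F G → trans (expect-uniform xs _) (trans (cong (c *ᵣ_) (sum-+ xs F G))
      (trans (ℚ.*-distribˡ-+ c _ _) (sym (cong₂ _+ᵣ_ (expect-uniform xs F) (expect-uniform xs G)))))
  ; *-homo = λ p F → trans (expect-uniform xs _) (trans (cong (c *ᵣ_) (sum-* xs p F))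
      (trans (swap c p _) (sym (cong (p *ᵣ_) (expect-uniform xs F)))))
  ; 1-homo = trans (expect-uniform xs _) (trans (cong (c *ᵣ_) (sum-1 xs)) (inv-cancel 1≤len))
  }
  where
  c = inv (length xs)
  swap : ∀ a b c → a *ᵣ (b *ᵣ c) ≡ b *ᵣ (a *ᵣ c)
  swap a b c = solve (a ∷ b ∷ c ∷ []) ℚ-ring
  inter : ∀ a b c d → a +ᵣ b +ᵣ (c +ᵣ d) ≡ a +ᵣ c +ᵣ (b +ᵣ d)
  inter a b c d = solve (a ∷ b ∷ c ∷ d ∷ []) ℚ-ring
  sum-mono : ∀ ys {F G} → (∀ x → F x ≤ᵣ G x) → sumᴸ ys F ≤ᵣ sumᴸ ys G
  sum-mono []       h = ℚ.≤-refl
  sum-mono (y ∷ ys) h = ℚ.+-mono-≤ (h y) (sum-mono ys h)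
  sum-+ : ∀ ys F G → sumᴸ ys (λ x → F x +ᵣ G x) ≡ sumᴸ ys F +ᵣ sumᴸ ys G
  sum-+ []       F G = refl
  sum-+ (y ∷ ys) F G = trans (cong (F y +ᵣ G y +ᵣ_) (sum-+ ys F G)) (inter (F y) (G y) _ _)
  sum-* : ∀ ys p F → sumᴸ ys (λ x → p *ᵣ F x) ≡ p *ᵣ sumᴸ ys F
  sum-* []       p F = sym (ℚ.*-zeroʳ p)
  sum-* (y ∷ ys) p F = trans (cong (p *ᵣ F y +ᵣ_) (sum-* ys p F)) (sym (ℚ.*-distribˡ-+ p _ _))
  sum-1 : ∀ (ys : List _) → sumᴸ ys (λ _ → 1ℚ) ≡ ι (length ys)
  sum-1 []       = sym (ι-/ 0)
  sum-1 (y ∷ ys) = trans (cong₂ _+ᵣ_ (sym (ι-/ 1)) (sum-1 ys)) (sym (ι-+ 1 (length ys)))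

-- Uniformly random permutations

-- Permutations that agree pointwise need not be equal as records, so invariance is claimed for
-- functions that respect pointwise agreement.
Extensional : (Permutation′ n → ℚ) → Set
Extensional G = ∀ π ρ → π ≈ ρ → G π ≡ G ρ

∑Π : ∀ n → (Permutation′ n → ℚ) → ℚ
∑Π zero    G = G Perm.id
∑Π (suc n) G = ∑ℚ.sum (λ j → ∑Π n (λ π → G (insert zero j π)))

sumᴸ-permutations : ∀ n G → sumᴸ (permutations n) G ≡ ∑Π n G
sumᴸ-permutations zero    G = ℚ.+-identityʳ (G Perm.id)
sumᴸ-permutations (suc n) G = trans (sumᴸ-product (insert zero) (allFin (suc n)) (permutations n) G)
  (trans (sumᴸ-cong (allFin (suc n)) (λ j → sumᴸ-permutations n _))
         (sumᴸ-tabulate id (λ j → ∑Π n (λ π → G (insert zero j π)))))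

∑Π-cong : ∀ n {G H} → (∀ π → G π ≡ H π) → ∑Π n G ≡ ∑Π n H
∑Π-cong zero    h = h Perm.id
∑Π-cong (suc n) h = ∑ℚ.sum-cong-≗ (λ j → ∑Π-cong n (λ π → h (insert zero j π)))

∑Π-∑ : ∀ n {m} (F : Fin m → Permutation′ n → ℚ) →
  ∑Π n (λ π → ∑ℚ.sum (λ i → F i π)) ≡ ∑ℚ.sum (λ i → ∑Π n (F i))
∑Π-∑ zero    F = refl
∑Π-∑ (suc n) F = trans (∑ℚ.sum-cong-≗ (λ j → ∑Π-∑ n (λ i π → F i (insert zero j π))))
  (∑ℚ.∑-comm (λ j i → ∑Π n (λ π → F i (insert zero j π))))

∑Π-comm : ∀ m n (H : Permutation′ m → Permutation′ n → ℚ) →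
  ∑Π m (λ π → ∑Π n (H π)) ≡ ∑Π n (λ ρ → ∑Π m (λ π → H π ρ))
∑Π-comm m zero    H = refl
∑Π-comm m (suc n) H = trans (∑Π-∑ m (λ j π → ∑Π n (λ ρ → H π (insert zero j ρ))))
  (∑ℚ.sum-cong-≗ (λ j → ∑Π-comm m n (λ π ρ → H π (insert zero j ρ))))

insert-cong : ∀ j {π ρ : Permutation′ n} → π ≈ ρ → insert zero j π ≈ insert zero j ρ
insert-cong j h zero    = refl
insert-cong j h (suc i) = cong (punchIn j) (h i)

insert-∘ₚ : ∀ j (π : Permutation′ n) (ρ : Permutation′ (suc n)) →
  insert zero j π ∘ₚ ρ ≈ insert zero (ρ ⟨$⟩ʳ j) (π ∘ₚ remove j ρ)
insert-∘ₚ j π ρ zero    = refl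
insert-∘ₚ j π ρ (suc i) = Perm.punchIn-permute ρ j (π ⟨$⟩ʳ i)

-- Induction along `insert zero j`: composing with `ρ` moves the image of `zero` from `j` to its
-- image under `ρ`, which reindexes the outer sum, and what remains is composition with `remove j ρ`
-- in the inner sum.
∑Π-left : ∀ n {G} → Extensional G → ∀ ρ → ∑Π n (λ π → G (π ∘ₚ ρ)) ≡ ∑Π n G
∑Π-left zero    ext ρ = ext (Perm.id ∘ₚ ρ) Perm.id (λ ())
∑Π-left (suc n) {G} ext ρ = begin
  ∑ℚ.sum (λ j → ∑Π n (λ π → G (insert zero j π ∘ₚ ρ)))
    ≡⟨ ∑ℚ.sum-cong-≗ (λ j → ∑Π-cong n (λ π → ext (insert zero j π ∘ₚ ρ) (insert zero (ρ ⟨$⟩ʳ j) (π ∘ₚ remove j ρ)) (insert-∘ₚ j π ρ))) ⟩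
  ∑ℚ.sum (λ j → ∑Π n (λ π → G (insert zero (ρ ⟨$⟩ʳ j) (π ∘ₚ remove j ρ))))
    ≡⟨ ∑ℚ.sum-cong-≗ (λ j → ∑Π-left n (λ π π′ h → ext (insert zero (ρ ⟨$⟩ʳ j) π) (insert zero (ρ ⟨$⟩ʳ j) π′) (insert-cong (ρ ⟨$⟩ʳ j) {π} {π′} h)) (remove j ρ)) ⟩
  ∑ℚ.sum (λ j → ∑Π n (λ π → G (insert zero (ρ ⟨$⟩ʳ j) π)))
    ≡⟨ ∑ℚ.sum-permute (λ j → ∑Π n (λ π → G (insert zero j π))) ρ ⟨
  ∑ℚ.sum (λ j → ∑Π n (λ π → G (insert zero j π))) ∎
  where open ≡-Reasoning

permutations-nonempty : ∀ n → 1 ≤ length (permutations n)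
permutations-nonempty zero = s≤s z≤n
permutations-nonempty (suc n) with permutations n | permutations-nonempty n
... | π ∷ πs | _ = s≤s z≤n

EΠ : ∀ n → (Permutation′ n → ℚ) → ℚ
EΠ n = expect (uniform (permutations n))

EΠ-isMean : ∀ n → IsMean (EΠ n)
EΠ-isMean n = uniform-isMean (permutations n) (permutations-nonempty n)

private
  EΠ-∑Π : ∀ n G → EΠ n G ≡ inv (length (permutations n)) *ᵣ ∑Π n G
  EΠ-∑Π n G = trans (expect-uniform (permutations n) G) (cong (inv (length (permutations n)) *ᵣ_) (sumᴸ-permutations n G))

EΠ-left : ∀ n {G} → Extensional G → ∀ ρ → EΠ n (λ π → G (π ∘ₚ ρ)) ≡ EΠ n G
EΠ-left n {G} ext ρ = trans (EΠ-∑Π n _) (trans (cong (inv (length (permutations n)) *ᵣ_) (∑Π-left n ext ρ)) (sym (EΠ-∑Π n G)))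

EΠ-comm : ∀ n (H : Permutation′ n → Permutation′ n → ℚ) →
  EΠ n (λ π → EΠ n (H π)) ≡ EΠ n (λ ρ → EΠ n (λ π → H π ρ))
EΠ-comm n H = trans (unfold H) (trans (cong (λ x → c *ᵣ (c *ᵣ x)) (∑Π-comm n n H)) (sym (unfold (λ ρ π → H π ρ))))
  where
  c = inv (length (permutations n))
  ∑Π-* : ∀ m (G : Permutation′ m → ℚ) → ∑Π m (λ π → c *ᵣ G π) ≡ c *ᵣ ∑Π m G
  ∑Π-* zero    G = refl
  ∑Π-* (suc m) G = trans (∑ℚ.sum-cong-≗ (λ j → ∑Π-* m (λ π → G (insert zero j π))))
    (sym (∑ℚ.*-distribˡ-sum c (λ j → ∑Π m (λ π → G (insert zero j π)))))
  unfold : ∀ H → EΠ n (λ π → EΠ n (H π)) ≡ c *ᵣ (c *ᵣ ∑Π n (λ π → ∑Π n (H π)))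
  unfold H = trans (EΠ-∑Π n _) (cong (c *ᵣ_) (trans (∑Π-cong n (λ π → EΠ-∑Π n (H π))) (∑Π-* n _)))

flip-cong : ∀ {π ρ : Permutation′ n} → π ≈ ρ → flip π ≈ flip ρ
flip-cong {π = π} {ρ} h i = begin
  π ⟨$⟩ˡ i                      ≡⟨ cong (π ⟨$⟩ˡ_) (Perm.inverseʳ ρ) ⟨
  π ⟨$⟩ˡ (ρ ⟨$⟩ʳ (ρ ⟨$⟩ˡ i))    ≡⟨ cong (π ⟨$⟩ˡ_) (h (ρ ⟨$⟩ˡ i)) ⟨
  π ⟨$⟩ˡ (π ⟨$⟩ʳ (ρ ⟨$⟩ˡ i))    ≡⟨ Perm.inverseˡ π ⟩
  ρ ⟨$⟩ˡ i                      ∎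
  where open ≡-Reasoning

-- By left invariance, averaging G (ρ⁻¹ π) over π first gives the mean of G,
-- and over ρ first the mean of G ∘ flip.
EΠ-flip : ∀ n {G} → Extensional G → EΠ n (λ π → G (flip π)) ≡ EΠ n G
EΠ-flip n {G} ext = begin
  EΠ n (λ ρ → G (flip ρ))
    ≡⟨ E-const (EΠ-isMean n) _ ⟨
  EΠ n (λ π → EΠ n (λ ρ → G (flip ρ)))
    ≡⟨ E-cong (EΠ-isMean n) (λ π → EΠ-left n (λ ρ ρ′ h → ext (flip ρ) (flip ρ′) (flip-cong {π = ρ} {ρ′} h)) (flip π)) ⟨
  EΠ n (λ π → EΠ n (λ ρ → G (π ∘ₚ flip ρ)))
    ≡⟨ EΠ-comm n (λ π ρ → G (π ∘ₚ flip ρ)) ⟩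
  EΠ n (λ ρ → EΠ n (λ π → G (π ∘ₚ flip ρ)))
    ≡⟨ E-cong (EΠ-isMean n) (λ ρ → EΠ-left n ext (flip ρ)) ⟩
  EΠ n (λ ρ → EΠ n G)
    ≡⟨ E-const (EΠ-isMean n) _ ⟩
  EΠ n G ∎
  where open ≡-Reasoning

-- The recursion of `permutations` fixes the image of `zero` and so favours one side of composition.
-- Inversion exchanges the sides and preserves the uniform distribution.
EΠ-right : ∀ n {G} → Extensional G → ∀ τ → EΠ n (λ π → G (τ ∘ₚ π)) ≡ EΠ n G
EΠ-right n {G} ext τ = begin
  EΠ n (λ π → G (τ ∘ₚ π))
    ≡⟨ EΠ-flip n (λ π ρ h → ext (τ ∘ₚ π) (τ ∘ₚ ρ) (λ i → h (τ ⟨$⟩ʳ i))) ⟨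
  EΠ n (λ π → G (flip (π ∘ₚ flip τ)))
    ≡⟨ EΠ-left n (λ π ρ h → ext (flip π) (flip ρ) (flip-cong {π = π} {ρ} h)) (flip τ) ⟩
  EΠ n (λ π → G (flip π))
    ≡⟨ EΠ-flip n ext ⟩
  EΠ n G ∎
  where open ≡-Reasoning

-- Active cups

active : Permutation′ n → ℕ → Fin n → Bool
active π k c = toℕ (π ⟨$⟩ˡ c) <ᵇ k

∑-active : ∀ (π : Permutation′ n) k F →
  ∑ℚ.sum (λ x → ⟨ toℕ x <ᵇ k ⟩ F (π ⟨$⟩ʳ x)) ≡ ∑⟨ active π k ⟩ F
∑-active π k F = sym (trans (∑ℚ.sum-permute (λ c → ⟨ active π k c ⟩ F c) π)
  (∑ℚ.sum-cong-≗ (λ x → cong (λ y → ⟨ toℕ y <ᵇ k ⟩ F (π ⟨$⟩ʳ x)) (Perm.inverseˡ π))))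

∑ℕ-active : ∀ (π : Permutation′ n) k f →
  ∑ℕ.sum (λ x → ⟦ toℕ x <ᵇ k ⟧ f (π ⟨$⟩ʳ x)) ≡ ∑⟦ active π k ⟧ f
∑ℕ-active π k F = sym (trans (∑ℕ.sum-permute (λ c → ⟦ active π k c ⟧ F c) π)
  (∑ℕ.sum-cong-≗ (λ x → cong (λ y → ⟦ toℕ y <ᵇ k ⟧ F (π ⟨$⟩ʳ x)) (Perm.inverseˡ π))))

count-< : ∀ n k → k ≤ n → ∑ℕ.sum (λ (x : Fin n) → ⟦ toℕ x <ᵇ k ⟧ 1) ≡ k
count-< n       zero    _         = ∑ℕ.sum-replicate-zero n
count-< (suc n) (suc k) (s≤s k≤n) = cong suc (count-< n k k≤n)

∣active∣ : ∀ (π : Permutation′ n) {k} → k ≤ n → ∣ active π k ∣ᴬ ≡ k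
∣active∣ {n} π {k} k≤n = trans (sym (∑ℕ-active π k (λ _ → 1))) (count-< n k k≤n)

length-labels : ∀ n {k} → k ≤ n → length (labels n k) ≡ k
length-labels n {k} k≤n = trans (List.length-take k (allFin n))
  (trans (cong (k ℕ.⊓_) (List.length-tabulate {n = n} id)) (ℕ.m≤n⇒m⊓n≡m k≤n))

expect-labels : ∀ (π : Permutation′ n) {k} → k ≤ n → ∀ F →
  expect (uniform (labels n k)) (λ x → F (π ⟨$⟩ʳ x)) ≡ μ (active π k) F
expect-labels {n} π {k} k≤n F = trans (expect-uniform (labels n k) _)
  (cong₂ (λ l s → inv l *ᵣ s) (trans (length-labels n k≤n) (sym (∣active∣ π k≤n)))
    (trans (sumᴸ-take k id (λ x → F (π ⟨$⟩ʳ x))) (∑-active π k F)))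

-- The game

module Game {n : ℕ} (e : ScoreBasedEmptier n) where

  move : Fin n → Fin n → State n → State n
  move c₁ c₂ s = emptierMove e (addHalf c₂ (addHalf c₁ s))

  -- Distributions of states are replaced by the backward operator: from a random variable of the
  -- later state to its expectation as a function of the earlier one. It depends on the labelling
  -- only through the set of active cups, which is what makes the symmetry of the dropped cup
  -- visible.
  stepE : (Fin n → Bool) → (State n → ℚ) → State n → ℚ
  stepE A F s = μ A (λ c₁ → μ A (λ c₂ → F (move c₁ c₂ s)))

  runE : (Fin n → Bool) → ℕ → (State n → ℚ) → State n → ℚ
  runE A zero    F s = F s
  runE A (suc t) F s = stepE A (runE A t F) s

  playE : Permutation′ n → ℕ → ℕ → (State n → ℚ) → ℚ
  playE π L zero    F = F (empty n)
  playE π L (suc i) F = playE π L i (runE (active π (n ∸ i)) L F)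

  expect-step : ∀ π {k} → k ≤ n → ∀ s F → expect (step e π k s) F ≡ stepE (active π k) F s
  expect-step π {k} k≤n s F = begin
    expect (step e π k s) F
      ≡⟨ expect->>= (uniform (labels n k)) _ F ⟩
    expect (uniform (labels n k)) _
      ≡⟨ expect-cong (uniform (labels n k)) (λ x₁ → trans (expect->>= (uniform (labels n k)) (λ x₂ → return (move (π ⟨$⟩ʳ x₁) (π ⟨$⟩ʳ x₂) s)) F)
           (trans (expect-cong (uniform (labels n k)) (λ x₂ → expect-return (move (π ⟨$⟩ʳ x₁) (π ⟨$⟩ʳ x₂) s) F))
                  (expect-labels π k≤n (λ c₂ → F (move (π ⟨$⟩ʳ x₁) c₂ s))))) ⟩
    expect (uniform (labels n k)) (λ x₁ → μ (active π k) (λ c₂ → F (move (π ⟨$⟩ʳ x₁) c₂ s)))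
      ≡⟨ expect-labels π k≤n (λ c₁ → μ (active π k) (λ c₂ → F (move c₁ c₂ s))) ⟩
    stepE (active π k) F s ∎
    where open ≡-Reasoning

  stepE-cong : ∀ A {F G} → (∀ s → F s ≡ G s) → ∀ s → stepE A F s ≡ stepE A G s
  stepE-cong A h s = μ-cong A (λ c₁ → μ-cong A (λ c₂ → h (move c₁ c₂ s)))

  expect-phase : ∀ π {k} → k ≤ n → ∀ t s F → expect (phase e π t k s) F ≡ runE (active π k) t F s
  expect-phase π k≤n zero    s F = expect-return s F
  expect-phase π {k} k≤n (suc t) s F = trans (expect->>= (step e π k s) (phase e π t k) F)
    (trans (expect-step π k≤n s _) (stepE-cong (active π k) (λ s′ → expect-phase π k≤n t s′ F) s))

  runE-cong : ∀ A t {F G} → (∀ s → F s ≡ G s) → ∀ s → runE A t F s ≡ runE A t G s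
  runE-cong A zero    h s = h s
  runE-cong A (suc t) h s = stepE-cong A (runE-cong A t h) s

  playE-cong : ∀ π L i {F G} → (∀ s → F s ≡ G s) → playE π L i F ≡ playE π L i G
  playE-cong π L zero    h = h (empty n)
  playE-cong π L (suc i) h = playE-cong π L i (runE-cong _ L h)

  expect-afterPhases : ∀ π L i F → expect (afterPhases e π L i) F ≡ playE π L i F
  expect-afterPhases π L zero    F = expect-return _ F
  expect-afterPhases π L (suc i) F = trans (expect->>= (afterPhases e π L i) _ F)
    (trans (expect-afterPhases π L i _)
           (playE-cong π L i (λ s → expect-phase π (ℕ.m∸n≤m n i) L s F)))

  runE-mask-cong : ∀ {A B} → A ≗ B → ∀ t F s → runE A t F s ≡ runE B t F s
  runE-mask-cong         A≗B zero    F s = refl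
  runE-mask-cong {A} {B} A≗B (suc t) F s = trans (stepE-cong A (runE-mask-cong A≗B t F) s)
    (trans (μ-cong A (λ c₁ → μ-mask-cong A≗B _)) (μ-mask-cong A≗B _))

  playE-active-cong : ∀ π ρ L i → (∀ j → j < i → active π (n ∸ j) ≗ active ρ (n ∸ j)) →
                      ∀ F → playE π L i F ≡ playE ρ L i F
  playE-active-cong π ρ L zero    h F = refl
  playE-active-cong π ρ L (suc i) h F = trans
    (playE-cong π L i (runE-mask-cong (h i (ℕ.n<1+n i)) L F))
    (playE-active-cong π ρ L i (λ j j<i → h j (ℕ.m<n⇒m<1+n j<i)) _)

  stepE-isMean : ∀ A → 1 ≤ ∣ A ∣ᴬ → ∀ s → IsMean (λ F → stepE A F s)
  stepE-isMean A 1≤∣A∣ s = bind-isMean {E = λ F → μ A (λ c₁ → μ A (λ c₂ → F (c₁ , c₂)))}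
    (bind-isMean {E = μ A} {E′ = λ c₁ F → μ A (λ c₂ → F (c₁ , c₂))} (μ-isMean A 1≤∣A∣) (λ c₁ →
      bind-isMean {E = μ A} {E′ = λ c₂ F → F (c₁ , c₂)} (μ-isMean A 1≤∣A∣) (λ c₂ → point-isMean (c₁ , c₂))))
    (λ (c₁ , c₂) → point-isMean (move c₁ c₂ s))

  runE-isMean : ∀ A → 1 ≤ ∣ A ∣ᴬ → ∀ t s → IsMean (λ F → runE A t F s)
  runE-isMean A 1≤∣A∣ zero    s = point-isMean s
  runE-isMean A 1≤∣A∣ (suc t) s = bind-isMean {E = λ F → stepE A F s} {E′ = λ s′ F → runE A t F s′}
    (stepE-isMean A 1≤∣A∣ s) (runE-isMean A 1≤∣A∣ t)

  playE-isMean : ∀ π L i → i ≤ n → IsMean (playE π L i)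
  playE-isMean π L zero    _   = point-isMean (empty n)
  playE-isMean π L (suc i) i<n = bind-isMean {E = playE π L i} {E′ = λ s F → runE (active π (n ∸ i)) L F s}
    (playE-isMean π L i (ℕ.<⇒≤ i<n))
    (runE-isMean (active π (n ∸ i)) (subst (1 ≤_) (sym (∣active∣ π (ℕ.m∸n≤m n i))) (ℕ.m<n⇒0<n∸m i<n)) L)

-- Dropping a cup, and why it is uniformly distributed

infixl 7 _∖_

_∖_ : (Fin n → Bool) → Fin n → (Fin n → Bool)
(A ∖ d) i = if does (i Fin.≟ d) then false else A i

∖-same : ∀ (A : Fin n → Bool) d → (A ∖ d) d ≡ false
∖-same A d = cong (if_then false else A d) (dec-true (d Fin.≟ d) refl)

∖-other : ∀ (A : Fin n → Bool) {d i} → i ≢ d → (A ∖ d) i ≡ A i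
∖-other A {d} {i} i≢d = cong (if_then false else A i) (dec-false (i Fin.≟ d) i≢d)

∑⟦∖⟧ : ∀ (A : Fin n → Bool) {d} → A d ≡ true → ∀ f → ∑⟦ A ∖ d ⟧ f + f d ≡ ∑⟦ A ⟧ f
∑⟦∖⟧ A {d} Ad f = trans (cong (∑⟦ A ∖ d ⟧ f ℕ.+_) (sym (cong (⟦_⟧ f d) Ad)))
  (trans (∑ℕ-exchange {f = λ i → ⟦ (A ∖ d) i ⟧ f i} {λ i → ⟦ A i ⟧ f i} d
           (λ i i≢d → cong (⟦_⟧ f i) (∖-other A i≢d)))
         (trans (cong (λ b → ∑⟦ A ⟧ f + ⟦ b ⟧ f d) (∖-same A d)) (ℕ.+-identityʳ _)))

<ᵇ-true : ∀ {m n} → m < n → (m <ᵇ n) ≡ true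
<ᵇ-true {m} {n} m<n = dec-true (m ℕ.<? n) m<n

<ᵇ-false : ∀ {m n} → ¬ (m < n) → (m <ᵇ n) ≡ false
<ᵇ-false {m} {n} m≮n = dec-false (m ℕ.<? n) m≮n

module _ {n k : ℕ} (k<n : k < n) (j : Fin n) (j≤k : toℕ j ≤ k) (π : Permutation′ n) where

  private
    ℓ = fromℕ< k<n

  -- Exchanges label `j` with label `k`, the last one active in the (k + 1)-cup phase. Both labels
  -- are active in all phases up to that one, so the game cannot tell the difference until then, but
  -- cup `π ⟨$⟩ʳ j` is now the one dropped.
  swapLast : Permutation′ n
  swapLast = transpose j ℓ

  private
    toℕℓ : toℕ ℓ ≡ k
    toℕℓ = Fin.toℕ-fromℕ< k<n

  active-swapLast-above : ∀ k′ → k < k′ → active (swapLast ∘ₚ π) k′ ≗ active π k′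
  active-swapLast-above k′ k<k′ c with π ⟨$⟩ˡ c
  ... | x with x Fin.≟ ℓ
  ... | yes refl = trans (<ᵇ-true (ℕ.≤-<-trans j≤k k<k′)) (sym (<ᵇ-true (subst (_< k′) (sym toℕℓ) k<k′)))
  ... | no  x≢ℓ with x Fin.≟ j
  ... | yes refl = trans (<ᵇ-true (subst (_< k′) (sym toℕℓ) k<k′)) (sym (<ᵇ-true (ℕ.≤-<-trans j≤k k<k′)))
  ... | no  x≢j  = refl

  private
    below : ∀ x → x ≢ ℓ → (toℕ x <ᵇ k) ≡ (toℕ x <ᵇ suc k)
    below x x≢ℓ with toℕ x ℕ.<? k
    ... | yes x<k = trans (<ᵇ-true x<k) (sym (<ᵇ-true (ℕ.m<n⇒m<1+n x<k)))
    ... | no  x≮k = trans (<ᵇ-false x≮k) (sym (<ᵇ-false (λ x<1+k → x≮k (ℕ.≤∧≢⇒< (ℕ.s≤s⁻¹ x<1+k)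
                      (λ h → x≢ℓ (Fin.toℕ-injective (trans h (sym toℕℓ))))))))

    label-swapLast : ∀ x → (toℕ (swapLast ⟨$⟩ˡ x) <ᵇ k) ≡ (if does (x Fin.≟ j) then false else (toℕ x <ᵇ suc k))
    label-swapLast x with x Fin.≟ ℓ
    label-swapLast x | yes refl with ℓ Fin.≟ j
    ... | yes ℓ≡j = <ᵇ-false (λ h → ℕ.<-irrefl (trans (cong toℕ (sym ℓ≡j)) toℕℓ) h)
    ... | no  ℓ≢j = trans (<ᵇ-true (ℕ.≤∧≢⇒< j≤k (λ h → ℓ≢j (Fin.toℕ-injective (trans toℕℓ (sym h))))))
                          (sym (<ᵇ-true (s≤s (ℕ.≤-reflexive toℕℓ))))
    label-swapLast x | no x≢ℓ with x Fin.≟ j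
    ... | yes _ = <ᵇ-false (λ h → ℕ.<-irrefl toℕℓ h)
    ... | no  _ = below x x≢ℓ

    does-≟ : ∀ c → does (π ⟨$⟩ˡ c Fin.≟ j) ≡ does (c Fin.≟ π ⟨$⟩ʳ j)
    does-≟ c with c Fin.≟ π ⟨$⟩ʳ j
    ... | yes refl = dec-true (_ Fin.≟ j) (Perm.inverseˡ π)
    ... | no  c≢   = dec-false (_ Fin.≟ j) (λ h → c≢ (trans (sym (Perm.inverseʳ π)) (cong (π ⟨$⟩ʳ_) h)))

  active-swapLast : active (swapLast ∘ₚ π) k ≗ active π (suc k) ∖ (π ⟨$⟩ʳ j)
  active-swapLast c = trans (label-swapLast (π ⟨$⟩ˡ c))
    (cong (if_then false else active π (suc k) c) (does-≟ c))

active-cong : ∀ {π ρ : Permutation′ n} → π ≈ ρ → ∀ k → active π k ≗ active ρ k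
active-cong {π = π} {ρ} h k c = cong (λ y → toℕ y <ᵇ k) (flip-cong {π = π} {ρ} h c)

module Drop {n : ℕ} (e : ScoreBasedEmptier n) (L : ℕ) where

  open Game e

  EPlay : ℕ → (Permutation′ n × State n → ℚ) → ℚ
  EPlay i F = EΠ n (λ π → playE π L i (λ s → F (π , s)))

  EPlay-isMean : ∀ {i} → i ≤ n → IsMean (EPlay i)
  EPlay-isMean {i} i≤n = bind-isMean {E = EΠ n} {E′ = λ π F → playE π L i (λ s → F (π , s))}
    (EΠ-isMean n) (λ π → bind-isMean {E = playE π L i} {E′ = λ s F → F (π , s)}
      (playE-isMean π L i i≤n) (λ s → point-isMean (π , s)))

  -- Given the cups active in the phases so far and the current state, the
  -- cup that becomes inactive is uniformly distributed.
  drop-uniform : ∀ {k i} → k < n → i ≤ n ∸ k → (H : (Fin n → Bool) → State n → ℚ) →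
    (∀ {A B} → A ≗ B → ∀ s → H A s ≡ H B s) →
    EPlay i (λ (π , s) → H (active π k) s) ≡
    EPlay i (λ (π , s) → μ (active π (suc k)) (λ d → H (active π (suc k) ∖ d) s))
  drop-uniform {k} {i} k<n i≤n∸k H H-cong = sym (begin
    EPlay i (λ (π , s) → μ (A π) (λ d → H (A π ∖ d) s))
      ≡⟨ E-cong (EΠ-isMean n) (λ π → trans (*-homo (meanπ π) (inv ∣ A π ∣ᴬ) _)
           (cong₂ (λ l x → inv l *ᵣ x) (∣active∣ π k<n)
             (trans (E-∑⟨⟩ (meanπ π) (A π) (λ d s → H (A π ∖ d) s))
                    (sym (∑-active π (suc k) (λ d → playE π L i (H (A π ∖ d)))))))) ⟩
    EΠ n (λ π → inv (suc k) *ᵣ ∑ℚ.sum (λ x → ⟨ toℕ x <ᵇ suc k ⟩ G′ x π))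
      ≡⟨ trans (*-homo (EΠ-isMean n) (inv (suc k)) _) (cong (inv (suc k) *ᵣ_)
           (E-∑⟨⟩ (EΠ-isMean n) B G′)) ⟩
    inv (suc k) *ᵣ ∑⟨ B ⟩ (λ x → EΠ n (G′ x))
      ≡⟨ cong (inv (suc k) *ᵣ_) (∑ℚ.sum-cong-≗ {n} {λ x → ⟨ B x ⟩ EΠ n (G′ x)} {λ x → ⟨ B x ⟩ EΠ n G} swapped) ⟩
    inv (suc k) *ᵣ ∑⟨ B ⟩ (λ x → EΠ n G)
      ≡⟨ cong (inv (suc k) *ᵣ_) (trans (∑⟨⟩-const B (EΠ n G))
           (cong (λ l → ι l *ᵣ EΠ n G) (count-< n (suc k) k<n))) ⟩
    inv (suc k) *ᵣ (ι (suc k) *ᵣ EΠ n G)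
      ≡⟨ trans (sym (ℚ.*-assoc (inv (suc k)) (ι (suc k)) _)) (trans (cong (_*ᵣ EΠ n G) (inv-cancel {suc k} (s≤s z≤n))) (ℚ.*-identityˡ _)) ⟩
    EΠ n G ∎)
    where
    open ≡-Reasoning
    B : Fin n → Bool
    B x = toℕ x <ᵇ suc k
    A : Permutation′ n → Fin n → Bool
    A π = active π (suc k)
    G : Permutation′ n → ℚ
    G π = playE π L i (H (active π k))
    G′ : Fin n → Permutation′ n → ℚ
    G′ x π = playE π L i (H (A π ∖ (π ⟨$⟩ʳ x)))
    meanπ : ∀ π → IsMean (playE π L i)
    meanπ π = playE-isMean π L i (ℕ.≤-trans i≤n∸k (ℕ.m∸n≤m n k))
    k<n∸j : ∀ j → j < i → k < n ∸ j
    k<n∸j j j<i = ℕ.m+n≤o⇒m≤o∸n (suc k) (ℕ.≤-trans (ℕ.≤-reflexive (cong suc (ℕ.+-comm k j)))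
      (ℕ.≤-trans (ℕ.+-monoˡ-≤ k (ℕ.≤-trans j<i i≤n∸k)) (ℕ.≤-reflexive (ℕ.m∸n+n≡m (ℕ.<⇒≤ k<n)))))
    G-ext : Extensional G
    G-ext π ρ h = trans (playE-cong π L i (H-cong (active-cong {π = π} {ρ} h k)))
      (playE-active-cong π ρ L i (λ j _ → active-cong {π = π} {ρ} h (n ∸ j)) _)
    swapped : ∀ x → ⟨ toℕ x <ᵇ suc k ⟩ EΠ n (G′ x) ≡ ⟨ toℕ x <ᵇ suc k ⟩ EΠ n G
    swapped x with toℕ x ℕ.<? suc k
    ... | no  x≮ = trans (cong (⟨_⟩ EΠ n (G′ x)) (<ᵇ-false x≮)) (sym (cong (⟨_⟩ EΠ n G) (<ᵇ-false x≮)))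
    -- Dropping the cup labelled `x` under `π` is dropping the last cup under `π` precomposed with
    -- the transposition, after an identical history; averaging over `π` absorbs the transposition.
    ... | yes (s≤s x≤k) = cong (⟨ toℕ x <ᵇ suc k ⟩_) (trans
          (E-cong (EΠ-isMean n) (λ π → sym (trans
            (playE-active-cong _ π L i (λ j j<i → active-swapLast-above k<n x x≤k π (n ∸ j) (k<n∸j j j<i)) _)
            (playE-cong π L i (H-cong (active-swapLast k<n x x≤k π))))))
          (EΠ-right n G-ext (transpose x (fromℕ< k<n))))

-- Active totals and changes in a single cup

opaque
  total : (Fin n → Bool) → State n → ℕ
  total A s = ∑⟦ A ⟧ (lookup s)

  total-∑ : ∀ (A : Fin n → Bool) s → total A s ≡ ∑⟦ A ⟧ (lookup s)
  total-∑ A s = refl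

∑⟦⟧-update : ∀ (A : Fin n → Bool) {c} {f g : Fin n → ℕ} → A c ≡ true → (∀ i → i ≢ c → f i ≡ g i) →
             ∑⟦ A ⟧ f + g c ≡ ∑⟦ A ⟧ g + f c
∑⟦⟧-update A {c} {f} {g} Ac h = subst (λ b → ∑⟦ A ⟧ f + ⟦ b ⟧ g c ≡ ∑⟦ A ⟧ g + ⟦ b ⟧ f c) Ac
  (∑ℕ-exchange {f = λ i → ⟦ A i ⟧ f i} {λ i → ⟦ A i ⟧ g i} c (λ i i≢c → cong (⟦ A i ⟧_) (h i i≢c)))

∑⟦⟧-cong : ∀ (A : Fin n → Bool) {f g : Fin n → ℕ} → (∀ i → A i ≡ true → f i ≡ g i) → ∑⟦ A ⟧ f ≡ ∑⟦ A ⟧ g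
∑⟦⟧-cong A {f} {g} h = ∑ℕ.sum-cong-≗ (λ i → gated i (A i) refl)
  where
  gated : ∀ i b → A i ≡ b → ⟦ b ⟧ f i ≡ ⟦ b ⟧ g i
  gated i true  Ai = h i Ai
  gated i false _  = refl

true≢ : ∀ (A : Fin n → Bool) {i c} → A i ≡ true → A c ≡ false → i ≢ c
true≢ A Ai Ac refl = contradiction (trans (sym Ai) Ac) λ ()

nonempty : ∀ (A : Fin n → Bool) {c} → A c ≡ true → 1 ≤ ∣ A ∣ᴬ
nonempty A {c} Ac = subst (1 ≤_) (∑⟦∖⟧ A Ac (λ _ → 1)) (ℕ.m≤n+m 1 _)

∑⟦⟧-deficient : ∀ (A : Fin n → Bool) (f g : Fin n → ℕ) → ∑⟦ A ⟧ f < ∑⟦ A ⟧ g →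
                ∃[ c ] (A c ≡ true × f c < g c)
∑⟦⟧-deficient A f g f<g with Fin.any? (λ c → (A c Bool.≟ true) ×-dec (f c ℕ.<? g c))
... | yes found = found
... | no  none  = contradiction
  (∑⟦⟧-mono A (λ i Ai → ℕ.≮⇒≥ (λ fi<gi → none (i , Ai , fi<gi)))) (ℕ.<⇒≱ f<g)

total-update : ∀ (A : Fin n → Bool) {c s s′} → A c ≡ true → (∀ i → i ≢ c → lookup s′ i ≡ lookup s i) →
               total A s′ + lookup s c ≡ total A s + lookup s′ c
total-update A {s = s} {s′} Ac h = trans (cong (_+ _) (total-∑ A s′))
  (trans (∑⟦⟧-update A Ac h) (cong (_+ _) (sym (total-∑ A s))))

total-cong : ∀ (A : Fin n → Bool) {s s′} → (∀ i → A i ≡ true → lookup s′ i ≡ lookup s i) → total A s′ ≡ total A s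
total-cong A {s} {s′} h = trans (total-∑ A s′) (trans (∑⟦⟧-cong A h) (sym (total-∑ A s)))

deficient : ∀ (A : Fin n → Bool) s (a : Fin n → ℕ) → total A s < ∑⟦ A ⟧ a → ∃[ c ] (A c ≡ true × lookup s c < a c)
deficient A s a T<S = ∑⟦⟧-deficient A (lookup s) a (subst (_< ∑⟦ A ⟧ a) (total-∑ A s) T<S)

-- Of a random choice only a guarantee `b` for every cup and an extra `β` for one lucky cup are
-- known. Used twice, it gives the lucky pair of a step its weight, the inverse square of the number
-- of active cups.
μ-bonus : ∀ (A : Fin n → Bool) {F b β c} → A c ≡ true →
          (∀ i → A i ≡ true → b ≤ᵣ F i) → b +ᵣ β ≤ᵣ F c → b +ᵣ inv ∣ A ∣ᴬ *ᵣ β ≤ᵣ μ A F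
μ-bonus {n} A {F} {b} {β} {c} Ac h hc = ℚ.≤-trans (ℚ.≤-reflexive eq) (μ-mono A G≤F)
  where
  G : Fin n → ℚ
  G i = if does (i Fin.≟ c) then b +ᵣ β else b
  G≤F : ∀ i → A i ≡ true → G i ≤ᵣ F i
  G≤F i Ai with i Fin.≟ c
  ... | yes refl = hc
  ... | no  _    = h i Ai
  k = ∣ A ∣ᴬ
  Gc : G c ≡ b +ᵣ β
  Gc with c Fin.≟ c
  ... | yes _   = refl
  ... | no  c≢c = contradiction refl c≢c
  Gi : ∀ i → i ≢ c → G i ≡ b
  Gi i i≢c with i Fin.≟ c
  ... | yes i≡c = contradiction i≡c i≢c
  ... | no  _   = refl
  sums : ∑⟨ A ⟩ G +ᵣ b ≡ ι k *ᵣ b +ᵣ (b +ᵣ β)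
  sums = begin
    ∑⟨ A ⟩ G +ᵣ b                            ≡⟨ cong (λ t → ∑⟨ A ⟩ G +ᵣ ⟨ t ⟩ b) Ac ⟨
    ∑⟨ A ⟩ G +ᵣ ⟨ A c ⟩ b                    ≡⟨ ∑ℚ-exchange {f = λ i → ⟨ A i ⟩ G i} {λ i → ⟨ A i ⟩ b} c (λ i i≢c → cong (⟨ A i ⟩_) (Gi i i≢c)) ⟩
    ∑⟨ A ⟩ (λ _ → b) +ᵣ ⟨ A c ⟩ G c          ≡⟨ cong₂ (λ x y → x +ᵣ y) (∑⟨⟩-const A b) (cong₂ (λ t y → ⟨ t ⟩ y) Ac Gc) ⟩
    ι k *ᵣ b +ᵣ (b +ᵣ β)                     ∎
    where open ≡-Reasoning
  regroup : ∀ v k b β x → x +ᵣ b ≡ k *ᵣ b +ᵣ (b +ᵣ β) → v *ᵣ k ≡ 1ℚ → b +ᵣ v *ᵣ β ≡ v *ᵣ x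
  regroup v k b β x hx hv = begin
    b +ᵣ v *ᵣ β                                          ≡⟨ cong (_+ᵣ v *ᵣ β) (ℚ.*-identityˡ b) ⟨
    1ℚ *ᵣ b +ᵣ v *ᵣ β                                    ≡⟨ cong (λ o → o *ᵣ b +ᵣ v *ᵣ β) hv ⟨
    v *ᵣ k *ᵣ b +ᵣ v *ᵣ β                                ≡⟨ solve (v ∷ k ∷ b ∷ β ∷ []) ℚ-ring ⟩
    v *ᵣ (k *ᵣ b +ᵣ (b +ᵣ β) -ᵣ b)                       ≡⟨ cong (λ y → v *ᵣ (y -ᵣ b)) hx ⟨
    v *ᵣ (x +ᵣ b -ᵣ b)                                   ≡⟨ solve (v ∷ x ∷ b ∷ []) ℚ-ring ⟩
    v *ᵣ x                                               ∎
    where open ≡-Reasoning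
  eq : b +ᵣ inv k *ᵣ β ≡ μ A G
  eq = regroup (inv k) (ι k) b β (∑⟨ A ⟩ G) sums (inv-cancel (nonempty A Ac))

μ-lower : ∀ (A : Fin n → Bool) {F b} → 1 ≤ ∣ A ∣ᴬ → (∀ i → A i ≡ true → b ≤ᵣ F i) → b ≤ᵣ μ A F
μ-lower A {F} {b} 1≤∣A∣ h = subst (_≤ᵣ μ A F) (E-const (μ-isMean A 1≤∣A∣) b) (μ-mono A h)

-- Growth of the active total

-- The account for a step that takes nothing from the active cups. The total rises by 2, so the
-- weight `2 * V` earns 4 V. This pays for two units of excess over the `t` remaining steps, at most
-- 2 V, and for the credit `w`, at most V.
waste-pays : ∀ g′ t V T T′ w w′ → t ≤ V → T′ ≡ 2 + T → w ≤ V →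
             t * suc g′ + 2 * V * T + w ≤ t * (suc g′ ∸ 2) + (2 * V * T′ + w′)
waste-pays g′ t V T T′ w w′ t≤V refl w≤V = begin
  t * suc g′ + 2 * V * T + w
    ≤⟨ ℕ.+-mono-≤ (ℕ.+-monoˡ-≤ (2 * V * T) (ℕ.*-monoʳ-≤ t g≤)) w≤V ⟩
  t * (g″ + 2) + 2 * V * T + V
    ≡⟨ reorder₁ t g″ V T ⟩
  t * g″ + 2 * V * T + (2 * t + V)
    ≤⟨ ℕ.+-monoʳ-≤ (t * g″ + 2 * V * T) (ℕ.+-monoˡ-≤ V (ℕ.*-monoʳ-≤ 2 t≤V)) ⟩
  t * g″ + 2 * V * T + (2 * V + V)
    ≤⟨ ℕ.m≤m+n _ V ⟩
  t * g″ + 2 * V * T + (2 * V + V) + V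
    ≡⟨ reorder₂ (t * g″) V T ⟩
  t * g″ + 2 * V * (2 + T)
    ≤⟨ ℕ.+-monoʳ-≤ (t * g″) (ℕ.m≤m+n (2 * V * (2 + T)) w′) ⟩
  t * g″ + (2 * V * (2 + T) + w′) ∎
  where
  open ℕ.≤-Reasoning
  g″ = suc g′ ∸ 2
  g≤ : suc g′ ≤ g″ + 2
  g≤ = ℕ.≤-trans (ℕ.m≤n+m∸n (suc g′) 2) (ℕ.≤-reflexive (ℕ.+-comm 2 g″))
  reorder₁ : ∀ t h V T → t * (h + 2) + 2 * V * T + V ≡ t * h + 2 * V * T + (2 * t + V)
  reorder₁ t h V T = ℕSolver.solve (t ∷ h ∷ V ∷ T ∷ [])
  reorder₂ : ∀ th V T → th + 2 * V * T + (2 * V + V) + V ≡ th + 2 * V * (2 + T)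
  reorder₂ th V T = ℕSolver.solve (th ∷ V ∷ T ∷ [])

module Moves {n : ℕ} (e : ScoreBasedEmptier n) where

  open Game e
  open ScoreBasedEmptier e using (σ; select; select-max; removes; removable)

  half-≥1 : ∀ h → 1ℚ ≤ᵣ half h → 2 ≤ h
  half-≥1 h 1≤ = ι-cancel (subst₂ _≤ᵣ_ (trans (ℚ.*-identityʳ (+ 2 / 1)) (sym (ι-/ 2))) double (*-monoˡ (const (+ 2 / 1)) 1≤))
    where
    double : + 2 / 1 *ᵣ half h ≡ ι h
    double = trans (cong (+ 2 / 1 *ᵣ_) (/-split h 1)) (shuffle (ι h))
      where
      shuffle : ∀ x → + 2 / 1 *ᵣ (x *ᵣ ½) ≡ x
      shuffle x = solve (x ∷ []) ℚ-ring

  -- Removal is recorded as an addition read backwards, so the truncated subtraction of the game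
  -- disappears from the case analysis.
  data Outcome (s : State n) : State n → Set where
    skips   : Outcome s s
    removed : ∀ {s′} → lookup s (select s) ≡ 2 + lookup s′ (select s) →
              (∀ i → i ≢ select s → lookup s′ i ≡ lookup s i) → Outcome s s′

  outcome : ∀ s → Outcome s (emptierMove e s)
  outcome s with removes s in eq
  ... | false = skips
  ... | true  = removed
    (trans (sym (ℕ.m+[n∸m]≡n (half-≥1 _ (removable s eq))))
           (cong (2 ℕ.+_) (sym (Vec.lookup∘updateAt (select s) s))))
    (λ i i≢ → Vec.lookup∘updateAt′ i (select s) i≢ s)

  total-addHalf : ∀ (A : Fin n → Bool) {c} (s : State n) → A c ≡ true → total A (addHalf c s) ≡ suc (total A s)
  total-addHalf A {c} s Ac = ℕ.+-cancelʳ-≡ (lookup s c) _ _ (begin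
    total A (addHalf c s) + lookup s c  ≡⟨ total-update A Ac (λ i i≢c → Vec.lookup∘updateAt′ i c i≢c s) ⟩
    total A s + lookup (addHalf c s) c  ≡⟨ cong (total A s ℕ.+_) (Vec.lookup∘updateAt c s) ⟩
    total A s + suc (lookup s c)        ≡⟨ ℕ.+-suc (total A s) (lookup s c) ⟩
    suc (total A s) + lookup s c        ∎)
    where open ≡-Reasoning

  module _ (A : Fin n → Bool) (c₁ c₂ : Fin n) (A₁ : A c₁ ≡ true) (A₂ : A c₂ ≡ true) (s : State n) where

    filled : State n
    filled = addHalf c₂ (addHalf c₁ s)

    total-filled : total A filled ≡ 2 + total A s
    total-filled = begin
      total A (addHalf c₂ (addHalf c₁ s))  ≡⟨ total-addHalf A (addHalf c₁ s) A₂ ⟩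
      suc (total A (addHalf c₁ s))         ≡⟨ cong suc (total-addHalf A s A₁) ⟩
      2 + total A s                        ∎
      where open ≡-Reasoning

    lookup-filled : ∀ i → A i ≡ false → lookup filled i ≡ lookup s i
    lookup-filled i Ai = trans (Vec.lookup∘updateAt′ i c₂ (λ i≡ → true≢ A A₂ Ai (sym i≡)) (addHalf c₁ s))
      (Vec.lookup∘updateAt′ i c₁ (λ i≡ → true≢ A A₁ Ai (sym i≡)) s)

    total-removed : ∀ {s′} → A (select filled) ≡ true → lookup filled (select filled) ≡ 2 + lookup s′ (select filled) →
      (∀ i → i ≢ select filled → lookup s′ i ≡ lookup filled i) → total A s′ ≡ total A s
    total-removed {s′} Ai eq other = ℕ.+-cancelʳ-≡ (2 + lookup s′ i) _ _ (begin
      total A s′ + (2 + lookup s′ i)      ≡⟨ cong (total A s′ ℕ.+_) eq ⟨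
      total A s′ + lookup filled i        ≡⟨ total-update A Ai other ⟩
      total A filled + lookup s′ i        ≡⟨ cong (_+ lookup s′ i) total-filled ⟩
      2 + total A s + lookup s′ i         ≡⟨ swap (total A s) (lookup s′ i) ⟩
      total A s + (2 + lookup s′ i)       ∎)
      where
      open ≡-Reasoning
      i = select filled
      swap : ∀ x y → 2 + x + y ≡ x + (2 + y)
      swap x y = ℕSolver.solve (x ∷ y ∷ [])

    total-inactive : ∀ {s′} → A (select filled) ≡ false →
      (∀ i → i ≢ select filled → lookup s′ i ≡ lookup filled i) → total A s′ ≡ 2 + total A s
    total-inactive Ai other = trans (total-cong A (λ j Aj → other j (true≢ A Aj Ai))) total-filled

    total-move : total A (move c₁ c₂ s) ≡ total A s ⊎ total A (move c₁ c₂ s) ≡ 2 + total A s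
    total-move with emptierMove e filled | outcome filled
    ... | _ | skips = inj₂ total-filled
    ... | s′ | removed eq other with A (select filled) in Ai
    ... | true  = inj₁ (total-removed {s′} Ai eq other)
    ... | false = inj₂ (total-inactive {s′} Ai other)

    total-move-≥ : total A s ≤ total A (move c₁ c₂ s)
    total-move-≥ with total-move
    ... | inj₁ eq = ℕ.≤-reflexive (sym eq)
    ... | inj₂ eq = subst (total A s ≤_) (sym eq) (ℕ.m≤n+m (total A s) 2)

  stepE-bonus : ∀ A {F b β c₁ c₂} s → A c₁ ≡ true → A c₂ ≡ true →
    (∀ {c₁ c₂} → A c₁ ≡ true → A c₂ ≡ true → b ≤ᵣ F (move c₁ c₂ s)) →
    b +ᵣ β ≤ᵣ F (move c₁ c₂ s) → b +ᵣ inv ∣ A ∣ᴬ *ᵣ (inv ∣ A ∣ᴬ *ᵣ β) ≤ᵣ stepE A F s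
  stepE-bonus A s A₁ A₂ h h₁₂ = μ-bonus A A₁ (λ c₁ A₁ → μ-lower A (nonempty A A₁) (λ c₂ A₂ → h A₁ A₂))
    (μ-bonus A A₂ (λ c₂ A₂ → h A₁ A₂) h₁₂)

  -- Since the active total never falls, only states whose total is at least the initial one are
  -- reachable, and the comparison is needed only there.
  runE-mono-above : ∀ A → 1 ≤ ∣ A ∣ᴬ → ∀ t {F G T₀} → (∀ s → T₀ ≤ total A s → F s ≤ᵣ G s) →
    ∀ s → T₀ ≤ total A s → runE A t F s ≤ᵣ runE A t G s
  runE-mono-above A 1≤ zero    h s T₀≤ = h s T₀≤
  runE-mono-above A 1≤ (suc t) h s T₀≤ = μ-mono A (λ c₁ A₁ → μ-mono A (λ c₂ A₂ →
    runE-mono-above A 1≤ t h (move c₁ c₂ s) (ℕ.≤-trans T₀≤ (total-move-≥ A c₁ c₂ A₁ A₂ s))))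

  runE-total-≥ : ∀ A → 1 ≤ ∣ A ∣ᴬ → ∀ t s → ι (total A s) ≤ᵣ runE A t (ι ∘ total A) s
  runE-total-≥ A 1≤ t s = subst (_≤ᵣ runE A t (ι ∘ total A) s) (E-const (runE-isMean A 1≤ t s) _)
    (runE-mono-above A 1≤ t (λ s′ → ι-mono) s ℕ.≤-refl)

  -- An inactive cup d above the level a forces the active water to grow, as long
  -- as it could all fit below a: filling cups below a, the emptier must remove
  -- water above a, so it runs out of active cups to choose.
  module Growth (A : Fin n → Bool) (d : Fin n) (Ad : A d ≡ false) (a : Fin n → ℕ)
    (ahead : ∀ s → a d < lookup s d → A (select s) ≡ true → 1 ≤ lookup s (select s) →
             a (select s) < lookup s (select s))
    where

    S : ℕ
    S = ∑⟦ A ⟧ a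

    -- The water lying below the level `a`. It measures the progress of the filler towards a state
    -- from which the emptier can no longer take from an active cup.
    settled : State n → ℕ
    settled s = ∑⟦ A ⟧ (λ i → lookup s i ⊓ a i)

    settled-addHalf : ∀ {c} s → A c ≡ true → lookup s c < a c → settled (addHalf c s) ≡ suc (settled s)
    settled-addHalf {c} s Ac sc<ac = ℕ.+-cancelʳ-≡ (lookup s c ⊓ a c) _ _ (begin
      settled (addHalf c s) + lookup s c ⊓ a c
        ≡⟨ ∑⟦⟧-update A Ac (λ i i≢c → cong (_⊓ a i) (Vec.lookup∘updateAt′ i c i≢c s)) ⟩
      settled s + lookup (addHalf c s) c ⊓ a c
        ≡⟨ cong (λ x → settled s + x ⊓ a c) (Vec.lookup∘updateAt c s) ⟩
      settled s + suc (lookup s c) ⊓ a c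
        ≡⟨ cong (settled s ℕ.+_) (trans (ℕ.m≤n⇒m⊓n≡m sc<ac) (cong suc (sym (ℕ.m≤n⇒m⊓n≡m (ℕ.<⇒≤ sc<ac))))) ⟩
      settled s + suc (lookup s c ⊓ a c)
        ≡⟨ ℕ.+-suc (settled s) _ ⟩
      suc (settled s) + lookup s c ⊓ a c ∎)
      where open ≡-Reasoning

    Step : State n → State n → State n → Set
    Step s f s′ = (total A s′ ≡ 2 + total A s × lookup s d ≤ 2 + lookup s′ d)
                ⊎ (total A s′ ≡ total A s × lookup s′ d ≡ lookup s d × settled f ≤ suc (settled s′))

    -- If the emptier takes from an active cup, `ahead` puts that cup strictly above its level, so
    -- at most one of the two half units removed was settled. Otherwise the active cups keep both
    -- new half units and `d` loses at most two.
    step-outcome : ∀ {c₁ c₂} (A₁ : A c₁ ≡ true) (A₂ : A c₂ ≡ true) s → a d < lookup s d →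
                   Step s (filled A c₁ c₂ A₁ A₂ s) (move c₁ c₂ s)
    step-outcome {c₁} {c₂} A₁ A₂ s ad<sd with emptierMove e f | outcome f
      where f = filled A c₁ c₂ A₁ A₂ s
    ... | _  | skips = inj₁ (total-filled A c₁ c₂ A₁ A₂ s ,
          ℕ.≤-trans (ℕ.≤-reflexive (sym (lookup-filled A c₁ c₂ A₁ A₂ s d Ad))) (ℕ.m≤n+m _ 2))
    ... | s′ | removed eq other with A (select (filled A c₁ c₂ A₁ A₂ s)) in Ai
    ... | false = inj₁ (total-inactive A c₁ c₂ A₁ A₂ s {s′} Ai other , lower)
      where
      lower : lookup s d ≤ 2 + lookup s′ d
      lower with d Fin.≟ select (filled A c₁ c₂ A₁ A₂ s)
      ... | yes d≡ = ℕ.≤-reflexive (trans (sym (lookup-filled A c₁ c₂ A₁ A₂ s d Ad))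
                       (subst (λ x → lookup (filled A c₁ c₂ A₁ A₂ s) x ≡ 2 + lookup s′ x) (sym d≡) eq))
      ... | no  d≢ = ℕ.≤-trans (ℕ.≤-reflexive (trans (sym (lookup-filled A c₁ c₂ A₁ A₂ s d Ad)) (sym (other d d≢)))) (ℕ.m≤n+m _ 2)
    ... | true = inj₂ (total-removed A c₁ c₂ A₁ A₂ s {s′} Ai eq other ,
          trans (other d (λ d≡i → true≢ A Ai Ad (sym d≡i))) (lookup-filled A c₁ c₂ A₁ A₂ s d Ad) , progress)
      where
      f = filled A c₁ c₂ A₁ A₂ s
      i = select f
      overfull : a i < lookup f i
      overfull = ahead f (subst (a d <_) (sym (lookup-filled A c₁ c₂ A₁ A₂ s d Ad)) ad<sd) Ai
        (ℕ.≤-trans (s≤s z≤n) (ℕ.≤-reflexive (sym eq)))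
      keeps : a i ≤ suc (lookup s′ i ⊓ a i)
      keeps = ℕ.⊓-glb (ℕ.s≤s⁻¹ (ℕ.≤-trans overfull (ℕ.≤-reflexive eq))) (ℕ.n≤1+n (a i))
      progress : settled f ≤ suc (settled s′)
      progress = ℕ.+-cancelʳ-≤ (lookup s′ i ⊓ a i) _ _ (begin
        settled f + lookup s′ i ⊓ a i          ≡⟨ ∑⟦⟧-update A Ai (λ j j≢i → cong (_⊓ a j) (other j j≢i)) ⟨
        settled s′ + lookup f i ⊓ a i          ≡⟨ cong (settled s′ ℕ.+_) (ℕ.m≥n⇒m⊓n≡n (ℕ.<⇒≤ overfull)) ⟩
        settled s′ + a i                       ≤⟨ ℕ.+-monoʳ-≤ (settled s′) keeps ⟩
        settled s′ + suc (lookup s′ i ⊓ a i)   ≡⟨ ℕ.+-suc (settled s′) _ ⟩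
        suc (settled s′) + lookup s′ i ⊓ a i   ∎)
        where open ℕ.≤-Reasoning

    -- Pigeonhole, used twice: while the active water is less than `S`, some active cup is below its
    -- level, and after one half unit there is still such a cup.
    good-pair : ∀ s → 2 + total A s ≤ S → ∃[ c₁ ] ∃[ c₂ ] ∃[ A₁ ] ∃[ A₂ ]
                settled (filled A c₁ c₂ A₁ A₂ s) ≡ 2 + settled s
    good-pair s 2+T≤S with deficient A s a (ℕ.≤-trans (ℕ.n≤1+n _) 2+T≤S)
    ... | c₁ , A₁ , <₁ with deficient A (addHalf c₁ s) a
                              (subst (_< S) (sym (total-addHalf A s A₁)) 2+T≤S)
    ... | c₂ , A₂ , <₂ = c₁ , c₂ , A₁ , A₂ ,
      trans (settled-addHalf (addHalf c₁ s) A₂ <₂) (cong suc (settled-addHalf s A₁ <₁))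

    k : ℕ
    k = ∣ A ∣ᴬ

    -- u is chosen so that gaining one level with probability k⁻² outweighs losing all of them.
    u : ℕ → ℕ
    u zero    = 0
    u (suc j) = k * k * suc (u j)

    u-mono : 1 ≤ k → ∀ {i j} → i ≤ j → u i ≤ u j
    u-mono 1≤k {zero}  {j}     _         = z≤n
    u-mono 1≤k {suc i} {suc j} (s≤s i≤j) = ℕ.*-monoʳ-≤ (k * k) (s≤s (u-mono 1≤k i≤j))

    -- The second bound leaves room for two half units below `a` whenever `g` is positive. Both
    -- conditions survive a wasted step if `g` drops by 2, as the total then rises by 2. The
    -- alternative `g ≡ 0` catches the truncated cases.
    Excess : ℕ → State n → Set
    Excess g s = g ≡ 0 ⊎ (a d + g ≤ lookup s d × total A s + suc g ≤ S)

    settled≤total : ∀ s → settled s ≤ total A s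
    settled≤total s = subst (settled s ≤_) (sym (total-∑ A s)) (∑⟦⟧-mono A (λ i _ → ℕ.m⊓n≤m (lookup s i) (a i)))

    settled≤S : ∀ s → settled s ≤ S
    settled≤S s = ∑⟦⟧-mono A (λ i _ → ℕ.m⊓n≤n (lookup s i) (a i))

    excess-∸2 : ∀ g′ {s s′} → a d + suc g′ ≤ lookup s d → total A s + suc (suc g′) ≤ S →
                total A s′ ≡ 2 + total A s → lookup s d ≤ 2 + lookup s′ d → Excess (suc g′ ∸ 2) s′
    excess-∸2 zero          _ _ _ _ = inj₁ refl
    excess-∸2 (suc zero)    _ _ _ _ = inj₁ refl
    excess-∸2 (suc (suc h)) {s} {s′} h₁ h₂ T′ sd≤ = inj₂
      ( ℕ.+-cancelˡ-≤ 2 _ _ (ℕ.≤-trans (ℕ.≤-trans (ℕ.≤-reflexive (reorder (a d) h)) h₁) sd≤)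
      , ℕ.≤-trans (ℕ.≤-reflexive (trans (cong (_+ (2 + h)) T′) (reorder′ (total A s) h))) h₂ )
      where
      reorder : ∀ x h → 2 + (x + (1 + h)) ≡ x + (3 + h)
      reorder x h = ℕSolver.solve (x ∷ h ∷ [])
      reorder′ : ∀ T h → 2 + T + (2 + h) ≡ T + (4 + h)
      reorder′ T h = ℕSolver.solve (T ∷ h ∷ [])

    module _ (1≤k : 1 ≤ k) (V M : ℕ) (MU≤V : 2 * (M * u S) ≤ V) where

      private
        U = u S

        E : ℕ → State n → ℚ
        E t = runE A t (ι ∘ total A)

        Φ : ℕ → State n → ℚ
        Φ t s = ι (2 * V) *ᵣ E t s +ᵣ ι (M * U)

        Φ-step : ∀ t s → stepE A (Φ t) s ≡ Φ (suc t) s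
        Φ-step t s = trans (+-homo m (λ s → ι (2 * V) *ᵣ E t s) (λ _ → ι (M * U))) (cong₂ _+ᵣ_ (*-homo m (ι (2 * V)) (E t)) (E-const m _))
          where m = stepE-isMean A 1≤k s

        base : ∀ t s → ι (2 * V * total A s + M * u (settled s)) ≤ᵣ Φ t s
        base t s = subst (_≤ᵣ Φ t s) (sym (ι-+ (2 * V * total A s) _))
          (ℚ.+-mono-≤ (subst (_≤ᵣ ι (2 * V) *ᵣ E t s) (sym (ι-* (2 * V) (total A s)))
                         (*-monoˡ (0≤ι (2 * V)) (runE-total-≥ A 1≤k t s)))
                      (ι-mono (ℕ.*-monoʳ-≤ M (u-mono 1≤k (settled≤S s)))))

      -- The potential argument, by induction on the number `t` of remaining steps: up to an error
      -- of at most `M * U`, each remaining step contributes `g` to 2 V times the expected growth.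
      -- The term in `u` is credit for settled water, so that a step that does not raise the total
      -- may draw on the chance of a later one that does.
      Lower : ℕ → Set
      Lower t = ∀ g → g ≤ M → ∀ s → Excess g s → ι (t * g + (2 * V * total A s + M * u (settled s))) ≤ᵣ Φ t s

      module _ (t : ℕ) (t<V : t < V) (ih : Lower t) (g′ : ℕ) (g≤M : suc g′ ≤ M) (s : State n)
               (ad+g≤sd : a d + suc g′ ≤ lookup s d) (T+1+g≤S : total A s + suc (suc g′) ≤ S) where

        private
          g = suc g′
          T = total A s
          P = settled s
          b = t * g + 2 * V * T

        ad<sd : a d < lookup s d
        ad<sd = ℕ.≤-trans (ℕ.≤-trans (s≤s (ℕ.m≤m+n (a d) g′)) (ℕ.≤-reflexive (sym (ℕ.+-suc (a d) g′)))) ad+g≤sd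

        P<S : suc P ≤ S
        P<S = ℕ.≤-trans (s≤s (settled≤total s)) (ℕ.≤-trans
          (ℕ.≤-trans (ℕ.≤-reflexive (ℕ.+-comm 1 T)) (ℕ.+-monoʳ-≤ T (s≤s z≤n))) T+1+g≤S)

        wasted-excess : ∀ s′ → total A s′ ≡ 2 + T → lookup s d ≤ 2 + lookup s′ d → Excess (g ∸ 2) s′
        wasted-excess s′ T′ sd≤ = excess-∸2 g′ ad+g≤sd T+1+g≤S T′ sd≤

        wasted : ∀ s′ → total A s′ ≡ 2 + T → lookup s d ≤ 2 + lookup s′ d →
                 ι (b + M * u (suc P)) ≤ᵣ Φ t s′
        wasted s′ T′ sd≤ = ℚ.≤-trans (ι-mono (waste-pays g′ t V (total A s) (total A s′) (M * u (suc P)) (M * u (settled s′))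
            (ℕ.<⇒≤ t<V) T′ (ℕ.≤-trans (ℕ.*-monoʳ-≤ M (u-mono 1≤k P<S)) (ℕ.≤-trans (ℕ.m≤m+n (M * U) _) MU≤V))))
          (ih (g ∸ 2) (ℕ.≤-trans (ℕ.m∸n≤m g 2) g≤M) s′ (wasted-excess s′ T′ sd≤))

        kept : ∀ s′ → total A s′ ≡ T → lookup s′ d ≡ lookup s d → ∀ {p} → p ≤ settled s′ →
               ι (b + M * u p) ≤ᵣ Φ t s′
        kept s′ T′ sd′ p≤ = ℚ.≤-trans (ι-mono (ℕ.≤-trans
            (ℕ.+-monoʳ-≤ b (ℕ.*-monoʳ-≤ M (u-mono 1≤k p≤)))
            (ℕ.≤-reflexive (trans (ℕ.+-assoc (t * g) _ _) (cong (λ x → t * g + (2 * V * x + M * u (settled s′))) (sym T′))))))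
          (ih g g≤M s′ (inj₂ (subst (a d + g ≤_) (sym sd′) ad+g≤sd , subst (λ x → x + suc g ≤ S) (sym T′) T+1+g≤S)))

        any-pair : ∀ {c₁ c₂} → A c₁ ≡ true → A c₂ ≡ true → ι b ≤ᵣ Φ t (move c₁ c₂ s)
        any-pair {c₁} {c₂} A₁ A₂ with step-outcome A₁ A₂ s ad<sd
        ... | inj₁ (T′ , sd≤)     = ℚ.≤-trans (ι-mono (ℕ.m≤m+n b _)) (wasted (move c₁ c₂ s) T′ sd≤)
        -- An unlucky choice may forfeit the whole credit, which is the case p = 0, where `u`
        -- vanishes.
        ... | inj₂ (T′ , sd′ , _) = ℚ.≤-trans (ι-mono (ℕ.m≤m+n b _)) (kept (move c₁ c₂ s) T′ sd′ z≤n)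

        best-pair : ∀ {c₁ c₂} (A₁ : A c₁ ≡ true) (A₂ : A c₂ ≡ true) →
                    settled (filled A c₁ c₂ A₁ A₂ s) ≡ 2 + P → ι (b + M * u (suc P)) ≤ᵣ Φ t (move c₁ c₂ s)
        best-pair {c₁} {c₂} A₁ A₂ eq with step-outcome A₁ A₂ s ad<sd
        ... | inj₁ (T′ , sd≤)      = wasted (move c₁ c₂ s) T′ sd≤
        ... | inj₂ (T′ , sd′ , P≤) = kept (move c₁ c₂ s) T′ sd′ (ℕ.s≤s⁻¹ (ℕ.≤-trans (ℕ.≤-reflexive (sym eq)) P≤))

        scale : inv k *ᵣ (inv k *ᵣ ι (M * u (suc P))) ≡ ι (M * suc (u P))
        scale = trans (cong (λ x → inv k *ᵣ (inv k *ᵣ x)) (trans (cong ι (reorder M k (suc (u P))))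
            (trans (ι-* k _) (cong (ι k *ᵣ_) (ι-* k _)))))
          (collapse (inv k) (ι k) (ι (M * suc (u P))) (inv-cancel 1≤k))
          where
          reorder : ∀ M k y → M * (k * k * y) ≡ k * (k * (M * y))
          reorder M k y = ℕSolver.solve (M ∷ k ∷ y ∷ [])
          collapse : ∀ v k x → v *ᵣ k ≡ 1ℚ → v *ᵣ (v *ᵣ (k *ᵣ (k *ᵣ x))) ≡ x
          collapse v k x hv = trans (cong (v *ᵣ_) (undo (k *ᵣ x))) (undo x)
            where
            undo : ∀ y → v *ᵣ (k *ᵣ y) ≡ y
            undo y = trans (sym (ℚ.*-assoc v k y)) (trans (cong (_*ᵣ y) hv) (ℚ.*-identityˡ y))

        -- By `scale`, the lucky pair is worth `M * suc (u P)` on average. Of this, `M * u P`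
        -- restores the present credit, and the remaining `M` is at least the contribution `g` of
        -- this step.
        gain : suc t * g + (2 * V * T + M * u P) ≤ b + M * suc (u P)
        gain = ℕ.≤-trans (ℕ.≤-reflexive (reorder g (t * g) (2 * V * T) (M * u P)))
          (ℕ.≤-trans (ℕ.+-monoʳ-≤ b (ℕ.+-monoˡ-≤ (M * u P) g≤M)) (ℕ.≤-reflexive (cong (b ℕ.+_) (sym (ℕ.*-suc M (u P))))))
          where
          reorder : ∀ g x y z → g + x + (y + z) ≡ x + y + (g + z)
          reorder g x y z = ℕSolver.solve (g ∷ x ∷ y ∷ z ∷ [])

        bonus : ι (b + M * suc (u P)) ≤ᵣ stepE A (Φ t) s
        bonus = let (c₁ , c₂ , A₁ , A₂ , settled₂) = good-pair s room in begin
          ι (b + M * suc (u P))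
            ≡⟨ trans (ι-+ b _) (cong (ι b +ᵣ_) (sym scale)) ⟩
          ι b +ᵣ inv k *ᵣ (inv k *ᵣ ι (M * u (suc P)))
            ≤⟨ stepE-bonus A {Φ t} {ι b} {ι (M * u (suc P))} {c₁} {c₂} s A₁ A₂ any-pair
                 (subst (_≤ᵣ Φ t (move c₁ c₂ s)) (ι-+ b _) (best-pair A₁ A₂ settled₂)) ⟩
          stepE A (Φ t) s ∎
          where
          open ℚ.≤-Reasoning
          room : 2 + T ≤ S
          room = ℕ.≤-trans (ℕ.≤-reflexive (ℕ.+-comm 2 T)) (ℕ.≤-trans (ℕ.+-monoʳ-≤ T (s≤s (s≤s z≤n))) T+1+g≤S)

        potential-step : ι (suc t * g + (2 * V * T + M * u P)) ≤ᵣ Φ (suc t) s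
        potential-step = ℚ.≤-trans (ι-mono gain) (ℚ.≤-trans bonus (ℚ.≤-reflexive (Φ-step t s)))

      potential : ∀ t → t ≤ V → Lower t
      potential zero    _   g g≤M s _ = base zero s
      potential (suc t) t<V zero    g≤M s _ =
        subst (λ x → ι (x + (2 * V * total A s + M * u (settled s))) ≤ᵣ Φ (suc t) s) (sym (ℕ.*-zeroʳ t)) (base (suc t) s)
      potential (suc t) t<V (suc g′) g≤M s (inj₂ (h₁ , h₂)) =
        potential-step t t<V (potential t (ℕ.<⇒≤ t<V)) g′ g≤M s h₁ h₂

      -- `Lower` with all V steps remaining gives 2 V times the growth at least V g minus the error
      -- `M * U`, which is at most half of V and so of V g. Hence the growth is at least a quarter
      -- of the excess.
      growth : 1 ≤ V → ∀ g → g ≤ M → ∀ s → Excess g s →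
               ι (g + 4 * total A s) ≤ᵣ ι 4 *ᵣ runE A V (ι ∘ total A) s
      growth 1≤V zero _ s _ = subst (_≤ᵣ ι 4 *ᵣ E V s) (sym (ι-* 4 (total A s))) (*-monoˡ (0≤ι 4) (runE-total-≥ A 1≤k V s))
      growth 1≤V@(s≤s {n = V′} _) g@(suc g′) g≤M s exc = cancel-ι V′ (subst₂ _≤ᵣ_ (ι-* V _) refl
        (conclude (ι V) (E V s) (ι (M * U)) (ι (V * (g + 4 * T))) (ι (V * g + (2 * V * T + M * u (settled s))))
          (subst (λ x → ι (V * g + (2 * V * T + M * u (settled s))) ≤ᵣ x *ᵣ E V s +ᵣ ι (M * U)) (ι-* 2 V)
            (potential V ℕ.≤-refl g g≤M s exc))
          (subst₂ _≤ᵣ_ (trans (ι-+ _ _) (cong (ι (V * (g + 4 * T)) +ᵣ_) (ι-* 2 (M * U)))) (ι-* 2 _) (ι-mono bound))))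
        where
        T = total A s
        bound : V * (g + 4 * T) + 2 * (M * U) ≤ 2 * (V * g + (2 * V * T + M * u (settled s)))
        bound = ℕ.≤-trans (ℕ.+-monoʳ-≤ (V * (g + 4 * T)) (ℕ.≤-trans MU≤V (ℕ.m≤m*n V g)))
          (ℕ.≤-trans (ℕ.m≤m+n _ (2 * (M * u (settled s)))) (ℕ.≤-reflexive (reorder V g T (M * u (settled s)))))
          where
          reorder : ∀ V g T w → V * (g + 4 * T) + V * g + 2 * w ≡ 2 * (V * g + (2 * V * T + w))
          reorder V g T w = ℕSolver.solve (V ∷ g ∷ T ∷ w ∷ [])
        conclude : ∀ v E w x y → y ≤ᵣ ι 2 *ᵣ v *ᵣ E +ᵣ w → x +ᵣ ι 2 *ᵣ w ≤ᵣ ι 2 *ᵣ y →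
                   x ≤ᵣ v *ᵣ (ι 4 *ᵣ E)
        conclude v E w x y h₁ h₂ rewrite ι-/ 2 | ι-/ 4 =
          ≤-by (gap h₂ ⊕ const (+ 2 / 1) ⊛ gap h₁) (solve (v ∷ E ∷ w ∷ x ∷ y ∷ []) ℚ-ring)

-- Parities

sign : ℕ → ℚ
sign zero    = 1ℚ
sign (suc m) = - sign m

sign-2+ : ∀ m → sign (2 + m) ≡ sign m
sign-2+ m = double-neg (sign m)
  where
  double-neg : ∀ x → - (- x) ≡ x
  double-neg x = solve (x ∷ []) ℚ-ring

sign-bounds : ∀ m → (- 1ℚ ≤ᵣ sign m) × (sign m ≤ᵣ 1ℚ)
sign-bounds zero    = ℚ.≤-trans (ℚ.neg-antimono-≤ (const 1ℚ)) (const 1ℚ) , ℚ.≤-refl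
sign-bounds (suc m) = ℚ.neg-antimono-≤ (proj₂ (sign-bounds m)) , ℚ.neg-antimono-≤ (proj₁ (sign-bounds m))

sign-double : ∀ m → sign (m + m) ≡ 1ℚ
sign-double zero    = refl
sign-double (suc m) = trans (cong (λ x → - sign x) (ℕ.+-suc m m)) (trans (sign-2+ (m + m)) (sign-double m))

-- Equal numbers have an even sum and so sign 1; distinct ones are at distance at least 1, and twice
-- that outweighs sign -1. Summed over cups, it forces fills with nearly uniform parities away from
-- any fixed levels.
parity-distance : ∀ x a → 1ℚ ≤ᵣ ι (2 * ((x ∸ a) + (a ∸ x))) +ᵣ sign (x + a)
parity-distance x a with x ℕ.≟ a
... | yes refl = ≤-by (0≤ι (2 * ((x ∸ x) + (x ∸ x)))) (trans (cong (ι (2 * ((x ∸ x) + (x ∸ x))) +ᵣ_) (sign-double x))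
  (ℚ.+-comm (ι (2 * ((x ∸ x) + (x ∸ x)))) 1ℚ))
... | no  x≢a  = ℚ.≤-trans (≤-by (gap (proj₁ (sign-bounds (x + a)))) (shift (sign (x + a))))
  (ℚ.+-monoˡ-≤ (sign (x + a)) (subst (_≤ᵣ ι (2 * ((x ∸ a) + (a ∸ x)))) (ι-/ 2) (ι-mono (ℕ.*-monoʳ-≤ 2 apart))))
  where
  shift : ∀ y → + 2 / 1 +ᵣ y ≡ 1ℚ +ᵣ (y -ᵣ - 1ℚ)
  shift y = solve (y ∷ []) ℚ-ring
  apart : 1 ≤ (x ∸ a) + (a ∸ x)
  apart with ℕ.<-cmp x a
  ... | tri< x<a _ _ = ℕ.≤-trans (ℕ.m<n⇒0<n∸m x<a) (ℕ.m≤n+m (a ∸ x) (x ∸ a))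
  ... | tri≈ _ x≡a _ = contradiction x≡a x≢a
  ... | tri> _ _ a<x = ℕ.≤-trans (ℕ.m<n⇒0<n∸m a<x) (ℕ.m≤m+n (x ∸ a) (a ∸ x))

module Parity {n : ℕ} (e : ScoreBasedEmptier n) (A : Fin n → Bool) (2≤∣A∣ : 2 ≤ ∣ A ∣ᴬ) where

  open Game e
  open Moves e

  private
    k = ∣ A ∣ᴬ
    v = inv k
    1≤k : 1 ≤ k
    1≤k = ℕ.≤-trans (ℕ.n≤1+n 1) 2≤∣A∣

  -- The factor by which one random half unit contracts the expected sign of a cup: the sign flips
  -- with probability 1 / k. A step places two half units, hence the square in `ρ`.
  r : ℚ
  r = 1ℚ -ᵣ + 2 / 1 *ᵣ v

  ρ : ℕ → ℚ
  ρ zero    = 1ℚ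
  ρ (suc t) = r *ᵣ r *ᵣ ρ t

  private
    vk : v *ᵣ ι k ≡ 1ℚ
    vk = inv-cancel 1≤k

    0≤r : 0ℚ ≤ᵣ r
    0≤r = go v (ι k) vk (subst (_≤ᵣ ι k) (ι-/ 2) (ι-mono 2≤∣A∣)) (0≤inv k)
      where
      go : ∀ v k → v *ᵣ k ≡ 1ℚ → + 2 / 1 ≤ᵣ k → 0ℚ ≤ᵣ v → 0ℚ ≤ᵣ 1ℚ -ᵣ + 2 / 1 *ᵣ v
      go v k vk 2≤k 0≤v = subst (λ o → 0ℚ ≤ᵣ o -ᵣ + 2 / 1 *ᵣ v) vk (≤-by (0≤v ⊛ gap 2≤k) (solve (v ∷ k ∷ []) ℚ-ring))

    0≤ρ : ∀ t → 0ℚ ≤ᵣ ρ t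
    0≤ρ zero    = const 1ℚ
    0≤ρ (suc t) = 0≤r ⊛ 0≤r ⊛ 0≤ρ t

    -- A Bernoulli-type bound of order k / (k + t) in place of the exponential decay. It makes `ρ t`
    -- at most one half after k steps, which is all that is needed.
    ρ-decay : ∀ t → (ι k +ᵣ ι t) *ᵣ ρ t ≤ᵣ ι k
    ρ-decay zero    = ℚ.≤-reflexive (trans (ℚ.*-identityʳ _) (trans (cong (ι k +ᵣ_) (ι-/ 0)) (ℚ.+-identityʳ (ι k))))
    ρ-decay (suc t) = ℚ.≤-trans (subst (λ i → (ι k +ᵣ i) *ᵣ ρ (suc t) ≤ᵣ (ι k +ᵣ ι t) *ᵣ ρ t)
        (trans (cong (_+ᵣ ι t) (sym (ι-/ 1))) (sym (ι-+ 1 t)))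
        (go v (ι k) (ι t) (ρ t) r refl vk (0≤inv k) (0≤ι t) 0≤r (0≤ρ t))) (ρ-decay t)
      where
      go : ∀ v k t p r → r ≡ 1ℚ -ᵣ + 2 / 1 *ᵣ v → v *ᵣ k ≡ 1ℚ → 0ℚ ≤ᵣ v → 0ℚ ≤ᵣ t → 0ℚ ≤ᵣ r → 0ℚ ≤ᵣ p →
           (k +ᵣ (1ℚ +ᵣ t)) *ᵣ (r *ᵣ r *ᵣ p) ≤ᵣ (k +ᵣ t) *ᵣ p
      go v k t p r refl vk 0≤v 0≤t 0≤r 0≤p = ℚ.≤-trans shrink (≤-by
          ((const (+ 2 / 1) ⊛ 0≤v ⊛ 0≤t ⊕ const (+ 2 / 1) ⊛ 0≤v ⊕ const 1ℚ) ⊛ 0≤p) (identity vk))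
        where
        -- y r ≤ y - 1 for y = k + t + 1, and r ≤ 1
        identity : v *ᵣ k ≡ 1ℚ → (k +ᵣ t) *ᵣ p ≡ (k +ᵣ (1ℚ +ᵣ t)) *ᵣ (1ℚ -ᵣ + 2 / 1 *ᵣ v) *ᵣ p
          +ᵣ (+ 2 / 1 *ᵣ v *ᵣ t +ᵣ + 2 / 1 *ᵣ v +ᵣ 1ℚ) *ᵣ p
        identity vk = trans {j = (k +ᵣ (1ℚ +ᵣ t)) *ᵣ (1ℚ -ᵣ + 2 / 1 *ᵣ v) *ᵣ p +ᵣ (+ 2 / 1 *ᵣ v *ᵣ t +ᵣ + 2 / 1 *ᵣ v +ᵣ (+ 2 / 1 *ᵣ (v *ᵣ k) -ᵣ 1ℚ)) *ᵣ p}
          (solve (v ∷ k ∷ t ∷ p ∷ []) ℚ-ring)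
          (cong (λ o → (k +ᵣ (1ℚ +ᵣ t)) *ᵣ (1ℚ -ᵣ + 2 / 1 *ᵣ v) *ᵣ p +ᵣ (+ 2 / 1 *ᵣ v *ᵣ t +ᵣ + 2 / 1 *ᵣ v +ᵣ (+ 2 / 1 *ᵣ o -ᵣ 1ℚ)) *ᵣ p) vk)
        0≤k : 0ℚ ≤ᵣ k
        0≤k = subst (0ℚ ≤ᵣ_) (trans (cong (k *ᵣ_) vk) (ℚ.*-identityʳ k)) (subst (0ℚ ≤ᵣ_) (square v k) (0≤v ⊛ sq k))
          where
          square : ∀ v k → v *ᵣ (k *ᵣ k) ≡ k *ᵣ (v *ᵣ k)
          square v k = solve (v ∷ k ∷ []) ℚ-ring
          sq : ∀ x → 0ℚ ≤ᵣ x *ᵣ x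
          sq x with ℚ.≤-total 0ℚ x
          ... | inj₁ 0≤x = 0≤x ⊛ 0≤x
          ... | inj₂ x≤0 = subst (0ℚ ≤ᵣ_) (neg² x) (ℚ.neg-antimono-≤ x≤0 ⊛ ℚ.neg-antimono-≤ x≤0)
            where
            neg² : ∀ x → - x *ᵣ - x ≡ x *ᵣ x
            neg² x = solve (x ∷ []) ℚ-ring
        shrink : (k +ᵣ (1ℚ +ᵣ t)) *ᵣ ((1ℚ -ᵣ + 2 / 1 *ᵣ v) *ᵣ (1ℚ -ᵣ + 2 / 1 *ᵣ v) *ᵣ p) ≤ᵣ (k +ᵣ (1ℚ +ᵣ t)) *ᵣ (1ℚ -ᵣ + 2 / 1 *ᵣ v) *ᵣ p
        shrink = ≤-by ((0≤k ⊕ (const 1ℚ ⊕ 0≤t)) ⊛ (0≤r ⊛ 0≤p ⊛ (const (+ 2 / 1) ⊛ 0≤v))) (solve (v ∷ k ∷ t ∷ p ∷ []) ℚ-ring)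

  ρ-half : ∀ t → k ≤ t → ρ t ≤ᵣ ½
  ρ-half t k≤t = go v (ι k) (ι t) (ρ t) vk (0≤inv k) (0≤ρ t) (ι-mono k≤t) (ρ-decay t)
    where
    go : ∀ v k t p → v *ᵣ k ≡ 1ℚ → 0ℚ ≤ᵣ v → 0ℚ ≤ᵣ p → k ≤ᵣ t → (k +ᵣ t) *ᵣ p ≤ᵣ k → p ≤ᵣ ½
    go v k t p vk 0≤v 0≤p k≤t h = subst₂ _≤ᵣ_
      (trans (cong (_*ᵣ p) vk) (ℚ.*-identityˡ p)) (trans (cong (½ *ᵣ_) vk) (ℚ.*-identityʳ ½)) scaled
      where
      scaled : v *ᵣ k *ᵣ p ≤ᵣ ½ *ᵣ (v *ᵣ k)
      scaled = ≤-by (const ½ ⊛ 0≤v ⊛ gap h ⊕ const ½ ⊛ 0≤v ⊛ (gap k≤t ⊛ 0≤p)) (solve (v ∷ k ∷ t ∷ p ∷ []) ℚ-ring)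

  module _ (a : ℕ) (i : Fin n) (Ai : A i ≡ true) where

    parity : State n → ℚ
    parity s = sign (lookup s i + a)

    parity-emptierMove : ∀ s → parity (emptierMove e s) ≡ parity s
    parity-emptierMove s with emptierMove e s | outcome s
    ... | _  | skips = refl
    ... | s′ | removed eq other = helper (i Fin.≟ _)
      where
      open ScoreBasedEmptier e using (select)
      helper : Dec (i ≡ select s) → parity s′ ≡ parity s
      helper (yes refl) = sym (trans (cong (λ x → sign (x + a)) eq) (sign-2+ (lookup s′ i + a)))
      helper (no i≢)    = cong (λ x → sign (x + a)) (other i i≢)

    μ-parity : ∀ s → μ A (λ c → parity (addHalf c s)) ≡ r *ᵣ parity s
    μ-parity s = trans (cong (v *ᵣ_) sums) (go v (ι k) (parity s) vk)
      where
      F : Fin n → ℚ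
      F c = parity (addHalf c s)
      go : ∀ v k p → v *ᵣ k ≡ 1ℚ → v *ᵣ (k *ᵣ p -ᵣ + 2 / 1 *ᵣ p) ≡ (1ℚ -ᵣ + 2 / 1 *ᵣ v) *ᵣ p
      go v k p vk = trans {j = (v *ᵣ k -ᵣ + 2 / 1 *ᵣ v) *ᵣ p} (solve (v ∷ k ∷ p ∷ []) ℚ-ring)
        (cong (λ o → (o -ᵣ + 2 / 1 *ᵣ v) *ᵣ p) vk)
      exchanged : ∑⟨ A ⟩ F +ᵣ parity s ≡ ι k *ᵣ parity s +ᵣ - parity s
      exchanged = begin
        ∑⟨ A ⟩ F +ᵣ parity s
          ≡⟨ cong (λ b → ∑⟨ A ⟩ F +ᵣ ⟨ b ⟩ parity s) Ai ⟨
        ∑⟨ A ⟩ F +ᵣ ⟨ A i ⟩ parity s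
          ≡⟨ ∑ℚ-exchange {f = λ c → ⟨ A c ⟩ F c} {λ c → ⟨ A c ⟩ parity s} i
               (λ c c≢i → cong (λ x → ⟨ A c ⟩ sign (x + a)) (Vec.lookup∘updateAt′ i c (c≢i ∘ sym) s)) ⟩
        ∑⟨ A ⟩ (λ _ → parity s) +ᵣ ⟨ A i ⟩ F i
          ≡⟨ cong₂ _+ᵣ_ (∑⟨⟩-const A (parity s)) (cong₂ (λ b x → ⟨ b ⟩ sign (x + a)) Ai (Vec.lookup∘updateAt i s)) ⟩
        ι k *ᵣ parity s +ᵣ - parity s ∎
        where open ≡-Reasoning
      move-over : ∀ x y p → x +ᵣ p ≡ y +ᵣ - p → x ≡ y -ᵣ + 2 / 1 *ᵣ p
      move-over x y p h = trans {j = (x +ᵣ p) -ᵣ p} (solve (x ∷ p ∷ []) ℚ-ring)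
        (trans (cong (_-ᵣ p) h) (solve (y ∷ p ∷ []) ℚ-ring))
      sums : ∑⟨ A ⟩ F ≡ ι k *ᵣ parity s -ᵣ + 2 / 1 *ᵣ parity s
      sums = move-over (∑⟨ A ⟩ F) (ι k *ᵣ parity s) (parity s) exchanged

    stepE-parity : ∀ s → stepE A parity s ≡ r *ᵣ (r *ᵣ parity s)
    stepE-parity s = begin
      μ A (λ c₁ → μ A (λ c₂ → parity (move c₁ c₂ s)))
        ≡⟨ μ-cong A (λ c₁ → μ-cong A (λ c₂ → parity-emptierMove (addHalf c₂ (addHalf c₁ s)))) ⟩
      μ A (λ c₁ → μ A (λ c₂ → parity (addHalf c₂ (addHalf c₁ s))))
        ≡⟨ μ-cong A (λ c₁ → μ-parity (addHalf c₁ s)) ⟩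
      μ A (λ c₁ → r *ᵣ parity (addHalf c₁ s))
        ≡⟨ *-homo (μ-isMean A 1≤k) r _ ⟩
      r *ᵣ μ A (λ c₁ → parity (addHalf c₁ s))
        ≡⟨ cong (r *ᵣ_) (μ-parity s) ⟩
      r *ᵣ (r *ᵣ parity s) ∎
      where open ≡-Reasoning

    runE-parity : ∀ t s → runE A t parity s ≡ ρ t *ᵣ parity s
    runE-parity zero    s = sym (ℚ.*-identityˡ _)
    runE-parity (suc t) s = begin
      stepE A (runE A t parity) s           ≡⟨ stepE-cong A (runE-parity t) s ⟩
      stepE A (λ s′ → ρ t *ᵣ parity s′) s   ≡⟨ *-homo (stepE-isMean A 1≤k s) (ρ t) parity ⟩
      ρ t *ᵣ stepE A parity s               ≡⟨ cong (ρ t *ᵣ_) (stepE-parity s) ⟩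
      ρ t *ᵣ (r *ᵣ (r *ᵣ parity s))         ≡⟨ reorder (ρ t) r (parity s) ⟩
      r *ᵣ r *ᵣ ρ t *ᵣ parity s             ∎
      where
      open ≡-Reasoning
      reorder : ∀ x r p → x *ᵣ (r *ᵣ (r *ᵣ p)) ≡ r *ᵣ r *ᵣ x *ᵣ p
      reorder x r p = solve (x ∷ r ∷ p ∷ []) ℚ-ring

    runE-parity-half : ∀ t → k ≤ t → ∀ s → runE A t parity s ≤ᵣ ½
    runE-parity-half t k≤t s = subst (_≤ᵣ ½) (sym (runE-parity t s))
      (ℚ.≤-trans (ℚ.≤-trans (*-monoˡ (0≤ρ t) (proj₂ (sign-bounds (lookup s i + a)))) (ℚ.≤-reflexive (ℚ.*-identityʳ (ρ t)))) (ρ-half t k≤t))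

-- One phase together with the phase after the next drop

∣∣≤n : ∀ (A : Fin n → Bool) → ∣ A ∣ᴬ ≤ n
∣∣≤n {zero}  A = z≤n
∣∣≤n {suc n} A = ℕ.+-mono-≤ (one (A zero)) (∣∣≤n (A ∘ suc))
  where
  one : ∀ b → ⟦ b ⟧ 1 ≤ 1
  one true  = ℕ.≤-refl
  one false = z≤n

total-∖ : ∀ (A : Fin n → Bool) {d} s → A d ≡ true → total (A ∖ d) s + lookup s d ≡ total A s
total-∖ A {d} s Ad = trans (cong (_+ lookup s d) (total-∑ (A ∖ d) s))
  (trans (∑⟦∖⟧ A Ad (lookup s)) (sym (total-∑ A s)))

total-mask-cong : ∀ {A B : Fin n → Bool} → A ≗ B → ∀ s → total A s ≡ total B s
total-mask-cong {A = A} {B} A≗B s = trans (total-∑ A s)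
  (trans (∑ℕ.sum-cong-≗ (λ c → cong (λ b → ⟦ b ⟧ lookup s c) (A≗B c))) (sym (total-∑ B s)))

balance : ∀ x a → x + (a ∸ x) ≡ a + (x ∸ a)
balance zero    zero    = refl
balance zero    (suc a) = sym (ℕ.+-identityʳ (suc a))
balance (suc x) zero    = ℕ.+-identityʳ (suc x)
balance (suc x) (suc a) = cong suc (balance x a)

module Phase {n : ℕ} (e : ScoreBasedEmptier n) where

  open Game e
  open Moves e
  open ScoreBasedEmptier e using (select)

  -- What `Growth` requires of the levels, for every possible dropped cup `d` at once. The selected
  -- cup is assumed nonempty because scores at fill 0 may tie with others.
  Level : (Fin n → Bool) → (Fin n → ℕ) → Set
  Level A a = ∀ d s → A d ≡ true → a d < lookup s d → (A ∖ d) (select s) ≡ true →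
              1 ≤ lookup s (select s) → a (select s) < lookup s (select s)

  dropGrowth : ℕ → (Fin n → Bool) → State n → ℚ
  dropGrowth L A s = runE A L (ι ∘ total A) s -ᵣ ι (total A s)

  dropGrowth-cong : ∀ L {A B} → A ≗ B → ∀ s → dropGrowth L A s ≡ dropGrowth L B s
  dropGrowth-cong L {A} {B} A≗B s = cong₂ _-ᵣ_
    (trans (runE-cong A L (λ s′ → cong ι (total-mask-cong A≗B s′)) s) (runE-mask-cong A≗B L _ s))
    (cong ι (total-mask-cong A≗B s))

  -- The number of cups is at most `n`, and the third factor of `n`, at least 2, absorbs the added 1
  -- in each step of the recursion.
  u-bound : ∀ (A : Fin n → Bool) d Ad a ahead → 2 ≤ n → ∀ j →
            suc (Growth.u A d Ad a ahead j) ≤ (n * n * n) ^ j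
  u-bound A d Ad a ahead 2≤n zero    = ℕ.≤-refl
  u-bound A d Ad a ahead 2≤n (suc j) = begin
    suc (k * k * suc (u j))          ≤⟨ s≤s (ℕ.*-mono-≤ (ℕ.*-mono-≤ (∣∣≤n A) (∣∣≤n A)) (u-bound A d Ad a ahead 2≤n j)) ⟩
    1 + n * n * w                    ≤⟨ ℕ.+-monoˡ-≤ (n * n * w) 1≤ ⟩
    n * n * w + n * n * w            ≡⟨ cong (n * n * w ℕ.+_) (sym (ℕ.+-identityʳ _)) ⟩
    2 * (n * n * w)                  ≤⟨ ℕ.*-monoˡ-≤ (n * n * w) 2≤n ⟩
    n * (n * n * w)                  ≡⟨ reorder n w ⟩
    n * n * n * w                    ∎
    where
    open ℕ.≤-Reasoning
    open Growth A d Ad a ahead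
    w = (n * n * n) ^ j
    1≤n : 1 ≤ n
    1≤n = ℕ.≤-trans (s≤s z≤n) 2≤n
    1≤ : 1 ≤ n * n * w
    1≤ = ℕ.*-mono-≤ (ℕ.*-mono-≤ 1≤n 1≤n) (ℕ.≤-trans (s≤s z≤n) (u-bound A d Ad a ahead 2≤n j))
    reorder : ∀ n w → n * (n * n * w) ≡ n * n * n * w
    reorder n w = ℕSolver.solve (n ∷ w ∷ [])

  module _ (L B : ℕ) (2≤n : 2 ≤ n) (1≤B : 1 ≤ B) (long : 2 * (B * (n * n * n) ^ suc B) ≤ L)
           (levels : ∀ A t → 1 ≤ ∣ A ∣ᴬ → t ≤ suc B → ∃[ a ] (∑⟦ A ⟧ a ≡ t × Level A a))
           (A : Fin n → Bool) (8≤∣A∣ : 8 ≤ ∣ A ∣ᴬ) where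

    private
      k = ∣ A ∣ᴬ
      v = inv k
      1≤k : 1 ≤ k
      1≤k = ℕ.≤-trans (s≤s z≤n) 8≤∣A∣
      vk : v *ᵣ ι k ≡ 1ℚ
      vk = inv-cancel 1≤k

      1≤n : 1 ≤ n
      1≤n = ℕ.≤-trans (s≤s z≤n) 2≤n

      n³≢0 : ℕ.NonZero (n * n * n)
      n³≢0 = ℕ.>-nonZero (ℕ.*-mono-≤ (ℕ.*-mono-≤ 1≤n 1≤n) 1≤n)

      n≤L : n ≤ L
      n≤L = ℕ.≤-trans (ℕ.≤-trans (ℕ.≤-trans n≤n³ n³≤w) (ℕ.≤-trans (ℕ.m≤n*m w B {{ℕ.>-nonZero 1≤B}}) (ℕ.m≤m+n _ _))) long
        where
        w = (n * n * n) ^ suc B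
        n≤n³ : n ≤ n * n * n
        n≤n³ = ℕ.m≤n*m n (n * n) {{ℕ.>-nonZero (ℕ.*-mono-≤ 1≤n 1≤n)}}
        n³≤w : n * n * n ≤ w
        n³≤w = ℕ.m≤m*n (n * n * n) ((n * n * n) ^ B) {{ℕ.m^n≢0 (n * n * n) B {{n³≢0}}}}

      1≤L : 1 ≤ L
      1≤L = ℕ.≤-trans 1≤n n≤L

    -- The growth expected in the next phase, when the cup dropped before it is chosen uniformly.
    D : State n → ℚ
    D x = μ A (λ d → dropGrowth L (A ∖ d) x)

    1≤∣A∖d∣ : ∀ {d} → A d ≡ true → 1 ≤ ∣ A ∖ d ∣ᴬ
    1≤∣A∖d∣ {d} Ad = ℕ.+-cancelʳ-≤ 1 1 _ (ℕ.≤-trans (ℕ.≤-trans (s≤s (s≤s z≤n)) 8≤∣A∣) (ℕ.≤-reflexive (sym (∑⟦∖⟧ A Ad (λ _ → 1)))))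

    dropGrowth≥0 : ∀ x d → A d ≡ true → 0ℚ ≤ᵣ dropGrowth L (A ∖ d) x
    dropGrowth≥0 x d Ad = gap (runE-total-≥ (A ∖ d) (1≤∣A∖d∣ Ad) L x)

    D≥0 : ∀ x → 0ℚ ≤ᵣ D x
    D≥0 x = μ-lower A 1≤k (dropGrowth≥0 x)

    module _ (T₀ : ℕ) (T₀≤B : T₀ ≤ B) (a : Fin n → ℕ) (∑a : ∑⟦ A ⟧ a ≡ suc T₀) (level : Level A a) where

      -- Because `a` sums to one more than the fills, deleting cup `d` with surplus g leaves the
      -- other cups exactly g + 1 below their part of `a`, as `Excess` demands. A cup without
      -- surplus falls under its first alternative.
      dropped-growth : ∀ x → total A x ≡ T₀ → ∀ d → A d ≡ true →
                       ι (lookup x d ∸ a d) ≤ᵣ + 4 / 1 *ᵣ dropGrowth L (A ∖ d) x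
      dropped-growth x Tx d Ad = conclude (ι g) (ι (total (A ∖ d) x)) (runE (A ∖ d) L (ι ∘ total (A ∖ d)) x)
        (subst₂ _≤ᵣ_ (trans (ι-+ g _) (cong (ι g +ᵣ_) (trans (ι-* 4 _) (cong (_*ᵣ ι (total (A ∖ d) x)) (ι-/ 4)))))
          (cong (_*ᵣ runE (A ∖ d) L (ι ∘ total (A ∖ d)) x) (ι-/ 4)) grown)
        where
        g = lookup x d ∸ a d
        ahead = λ s → level d s Ad
        open Growth (A ∖ d) d (∖-same A d) a ahead using (S; u; Excess)
        conclude : ∀ g t E → g +ᵣ + 4 / 1 *ᵣ t ≤ᵣ + 4 / 1 *ᵣ E → g ≤ᵣ + 4 / 1 *ᵣ (E -ᵣ t)
        conclude g t E h = ≤-by (gap h) (solve (g ∷ t ∷ E ∷ []) ℚ-ring)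
        S+ad : S + a d ≡ suc T₀
        S+ad = trans (∑⟦∖⟧ A Ad a) ∑a
        xd≤T₀ : lookup x d ≤ T₀
        xd≤T₀ = ℕ.≤-trans (ℕ.m≤n+m _ (total (A ∖ d) x)) (ℕ.≤-reflexive (trans (total-∖ A x Ad) Tx))
        excess : ∀ h → g ≡ h → Excess g x
        excess zero    g≡0 = inj₁ g≡0
        excess (suc h) g≡h = inj₂ (ℕ.≤-reflexive ad+g , ℕ.≤-reflexive (ℕ.+-cancelʳ-≡ (a d) _ _ (begin
          total (A ∖ d) x + suc g + a d       ≡⟨ reorder (total (A ∖ d) x) g (a d) ⟩
          suc (total (A ∖ d) x + (a d + g))   ≡⟨ cong (λ y → suc (total (A ∖ d) x + y)) ad+g ⟩
          suc (total (A ∖ d) x + lookup x d)  ≡⟨ cong suc (trans (total-∖ A x Ad) Tx) ⟩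
          suc T₀                              ≡⟨ S+ad ⟨
          S + a d                             ∎)))
          where
          open ≡-Reasoning
          ad+g : a d + g ≡ lookup x d
          ad+g = ℕ.m+[n∸m]≡n {a d} {lookup x d} (ℕ.<⇒≤ (ℕ.m∸n≢0⇒n<m (λ g≡0 → ℕ.0≢1+n (trans (sym g≡0) g≡h))))
          reorder : ∀ t g a → t + suc g + a ≡ suc (t + (a + g))
          reorder t g a = ℕSolver.solve (t ∷ g ∷ a ∷ [])
        S≤ : S ≤ suc B
        S≤ = ℕ.≤-trans (ℕ.m≤m+n S (a d)) (ℕ.≤-trans (ℕ.≤-reflexive S+ad) (s≤s T₀≤B))
        MU≤L : 2 * (B * u S) ≤ L
        MU≤L = ℕ.≤-trans (ℕ.*-monoʳ-≤ 2 (ℕ.*-monoʳ-≤ B (ℕ.≤-trans (ℕ.n≤1+n _)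
          (ℕ.≤-trans (u-bound (A ∖ d) d (∖-same A d) a ahead 2≤n S) (ℕ.^-monoʳ-≤ (n * n * n) {{n³≢0}} S≤))))) long
        grown : ι (g + 4 * total (A ∖ d) x) ≤ᵣ ι 4 *ᵣ runE (A ∖ d) L (ι ∘ total (A ∖ d)) x
        grown = Growth.growth (A ∖ d) d (∖-same A d) a ahead (1≤∣A∖d∣ Ad) L B MU≤L 1≤L g
          (ℕ.≤-trans (ℕ.m∸n≤m _ (a d)) (ℕ.≤-trans xd≤T₀ T₀≤B)) x (excess g refl)

      private
        parities : State n → ℚ
        parities x = ∑⟨ A ⟩ (λ i → sign (lookup x i + a i))

        surplus : State n → ℕ
        surplus x = ∑⟦ A ⟧ (λ i → lookup x i ∸ a i)

      -- Surplus and deficit differ by exactly the one half unit by which `a` is larger, so half of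
      -- the distance between fills and levels lies in surplus, up to that unit.
      distance : ∀ x → total A x ≡ T₀ →
                 ∑⟦ A ⟧ (λ i → (lookup x i ∸ a i) + (a i ∸ lookup x i)) ≡ surplus x + suc (surplus x)
      distance x Tx = trans (∑⟦⟧-+ A _ _) (cong (surplus x ℕ.+_) (ℕ.+-cancelˡ-≡ T₀ _ _ (begin
        T₀ + deficit                                    ≡⟨ cong (_+ deficit) (trans (sym Tx) (total-∑ A x)) ⟩
        ∑⟦ A ⟧ (lookup x) + deficit                     ≡⟨ ∑⟦⟧-+ A (lookup x) _ ⟨
        ∑⟦ A ⟧ (λ i → lookup x i + (a i ∸ lookup x i))  ≡⟨ ∑⟦⟧-cong A (λ i _ → balance (lookup x i) (a i)) ⟩
        ∑⟦ A ⟧ (λ i → a i + (lookup x i ∸ a i))         ≡⟨ ∑⟦⟧-+ A a _ ⟩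
        ∑⟦ A ⟧ a + surplus x                            ≡⟨ cong (_+ surplus x) ∑a ⟩
        suc T₀ + surplus x                              ≡⟨ ℕ.+-suc T₀ (surplus x) ⟨
        T₀ + suc (surplus x)                            ∎)))
        where
        open ≡-Reasoning
        deficit = ∑⟦ A ⟧ (λ i → a i ∸ lookup x i)

      surplus≥ : ∀ x → total A x ≡ T₀ → ι k ≤ᵣ + 4 / 1 *ᵣ ι (surplus x) +ᵣ + 2 / 1 +ᵣ parities x
      surplus≥ x Tx = begin
        ι k                                                        ≡⟨ ℚ.*-identityʳ (ι k) ⟨
        ι k *ᵣ 1ℚ                                                  ≡⟨ ∑⟨⟩-const A 1ℚ ⟨
        ∑⟨ A ⟩ (λ _ → 1ℚ)                                          ≤⟨ ∑⟨⟩-mono A (λ i _ → parity-distance (lookup x i) (a i)) ⟩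
        ∑⟨ A ⟩ (λ i → ι (2 * δ i) +ᵣ sign (lookup x i + a i))      ≡⟨ ∑⟨⟩-+ A (λ i → ι (2 * δ i)) _ ⟩
        ∑⟨ A ⟩ (λ i → ι (2 * δ i)) +ᵣ parities x                   ≡⟨ cong (_+ᵣ parities x) twice ⟩
        + 2 / 1 *ᵣ ι (surplus x + suc (surplus x)) +ᵣ parities x   ≡⟨ cong (λ y → + 2 / 1 *ᵣ y +ᵣ parities x) split ⟩
        + 2 / 1 *ᵣ (ι (surplus x) +ᵣ (1ℚ +ᵣ ι (surplus x))) +ᵣ parities x ≡⟨ cong (_+ᵣ parities x) (expand (ι (surplus x))) ⟩
        + 4 / 1 *ᵣ ι (surplus x) +ᵣ + 2 / 1 +ᵣ parities x          ∎
        where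
        open ℚ.≤-Reasoning
        δ : Fin n → ℕ
        δ i = (lookup x i ∸ a i) + (a i ∸ lookup x i)
        twice : ∑⟨ A ⟩ (λ i → ι (2 * δ i)) ≡ + 2 / 1 *ᵣ ι (surplus x + suc (surplus x))
        twice = trans (∑ℚ.sum-cong-≗ (λ i → cong (⟨ A i ⟩_) (trans (ι-* 2 (δ i)) (cong (_*ᵣ ι (δ i)) (ι-/ 2)))))
          (trans (∑⟨⟩-* A (+ 2 / 1) (ι ∘ δ)) (cong (+ 2 / 1 *ᵣ_) (trans (sym (∑⟨⟩-ι A δ)) (cong ι (distance x Tx)))))
        split : ι (surplus x + suc (surplus x)) ≡ ι (surplus x) +ᵣ (1ℚ +ᵣ ι (surplus x))
        split = trans (ι-+ (surplus x) _) (cong (ι (surplus x) +ᵣ_) (trans (ι-+ 1 (surplus x)) (cong (_+ᵣ ι (surplus x)) (ι-/ 1))))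
        expand : ∀ y → + 2 / 1 *ᵣ (y +ᵣ (1ℚ +ᵣ y)) ≡ + 4 / 1 *ᵣ y +ᵣ + 2 / 1
        expand y = solve (y ∷ []) ℚ-ring

      surplus≤D : ∀ x → total A x ≡ T₀ → ι (surplus x) ≤ᵣ + 4 / 1 *ᵣ (ι k *ᵣ D x)
      surplus≤D x Tx = begin
        ι (surplus x)                                              ≡⟨ ∑⟨⟩-ι A _ ⟩
        ∑⟨ A ⟩ (λ d → ι (lookup x d ∸ a d))                        ≤⟨ ∑⟨⟩-mono A (dropped-growth x Tx) ⟩
        ∑⟨ A ⟩ (λ d → + 4 / 1 *ᵣ dropGrowth L (A ∖ d) x)           ≡⟨ ∑⟨⟩-* A (+ 4 / 1) _ ⟩
        + 4 / 1 *ᵣ G                                               ≡⟨ cong (+ 4 / 1 *ᵣ_) (undo v (ι k) G vk) ⟨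
        + 4 / 1 *ᵣ (ι k *ᵣ D x)                                    ∎
        where
        open ℚ.≤-Reasoning
        G = ∑⟨ A ⟩ (λ d → dropGrowth L (A ∖ d) x)
        undo : ∀ v k y → v *ᵣ k ≡ 1ℚ → k *ᵣ (v *ᵣ y) ≡ y
        undo v k y vk = trans {j = v *ᵣ k *ᵣ y} (solve (v ∷ k ∷ y ∷ []) ℚ-ring)
          (trans (cong (_*ᵣ y) vk) (ℚ.*-identityˡ y))

      -- A combination with a lower bound in every state whose total is at least `T₀`. If the total
      -- has not grown, the surplus and thus `D` make up for the parities; if it has, the last term
      -- does. Its expectation needs no conditioning on which case occurs.
      R : State n → ℚ
      R x = + 16 / 1 *ᵣ (ι k *ᵣ D x) +ᵣ (parities x +ᵣ + 2 / 1 *ᵣ ι k *ᵣ ι (total A x))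

      parities≥ : ∀ x → - ι k ≤ᵣ parities x
      parities≥ x = subst (_≤ᵣ parities x) (trans (∑⟨⟩-const A (- 1ℚ)) (negate (ι k)))
        (∑⟨⟩-mono A (λ i _ → proj₁ (sign-bounds (lookup x i + a i))))
        where
        negate : ∀ y → y *ᵣ - 1ℚ ≡ - y
        negate y = solve (y ∷ []) ℚ-ring

      R-lower : ∀ x → T₀ ≤ total A x → ι k +ᵣ + 2 / 1 *ᵣ ι k *ᵣ ι T₀ -ᵣ + 2 / 1 ≤ᵣ R x
      R-lower x T₀≤ with total A x ℕ.≟ T₀
      ... | yes Tx = subst (λ t → ι k +ᵣ + 2 / 1 *ᵣ ι k *ᵣ ι T₀ -ᵣ + 2 / 1 ≤ᵣ + 16 / 1 *ᵣ (ι k *ᵣ D x) +ᵣ (parities x +ᵣ + 2 / 1 *ᵣ ι k *ᵣ ι t)) (sym Tx)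
          (go (ι k) (D x) (parities x) (ι T₀) (ι (surplus x)) (surplus≥ x Tx) (surplus≤D x Tx))
        where
        go : ∀ k D p t s → k ≤ᵣ + 4 / 1 *ᵣ s +ᵣ + 2 / 1 +ᵣ p → s ≤ᵣ + 4 / 1 *ᵣ (k *ᵣ D) →
             k +ᵣ + 2 / 1 *ᵣ k *ᵣ t -ᵣ + 2 / 1 ≤ᵣ + 16 / 1 *ᵣ (k *ᵣ D) +ᵣ (p +ᵣ + 2 / 1 *ᵣ k *ᵣ t)
        go k D p t s h₁ h₂ = ≤-by (gap h₁ ⊕ const (+ 4 / 1) ⊛ gap h₂) (solve (k ∷ D ∷ p ∷ t ∷ s ∷ []) ℚ-ring)
      -- A total larger by at least 1 adds 2 k, which covers even the worst value -k of the parities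
      -- and still leaves k.
      ... | no  T≢ = go (ι k) (D x) (parities x) (ι T₀) (ι (total A x)) (0≤ι k) (D≥0 x) (parities≥ x)
          (subst (_≤ᵣ ι (total A x)) (trans (ι-+ 1 T₀) (cong (_+ᵣ ι T₀) (ι-/ 1))) (ι-mono (ℕ.≤∧≢⇒< T₀≤ (T≢ ∘ sym))))
        where
        go : ∀ k D p t T → 0ℚ ≤ᵣ k → 0ℚ ≤ᵣ D → - k ≤ᵣ p → 1ℚ +ᵣ t ≤ᵣ T →
             k +ᵣ + 2 / 1 *ᵣ k *ᵣ t -ᵣ + 2 / 1 ≤ᵣ + 16 / 1 *ᵣ (k *ᵣ D) +ᵣ (p +ᵣ + 2 / 1 *ᵣ k *ᵣ T)
        go k D p t T 0≤k 0≤D h₁ h₂ = ≤-by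
          (const (+ 16 / 1) ⊛ (0≤k ⊛ 0≤D) ⊕ gap h₁ ⊕ const (+ 2 / 1) ⊛ 0≤k ⊛ gap h₂ ⊕ const (+ 2 / 1))
          (solve (k ∷ D ∷ p ∷ t ∷ T ∷ []) ℚ-ring)

      runE-R : ∀ s → runE A L R s ≡ + 16 / 1 *ᵣ (ι k *ᵣ runE A L D s) +ᵣ
        (∑⟨ A ⟩ (λ i → runE A L (λ x → sign (lookup x i + a i)) s) +ᵣ + 2 / 1 *ᵣ ι k *ᵣ runE A L (ι ∘ total A) s)
      runE-R s = trans (+-homo m _ _) (cong₂ _+ᵣ_
        (trans (*-homo m (+ 16 / 1) (λ x → ι k *ᵣ D x)) (cong (+ 16 / 1 *ᵣ_) (*-homo m (ι k) D)))
        (trans (+-homo m _ _) (cong₂ _+ᵣ_ (E-∑⟨⟩ m A (λ i x → sign (lookup x i + a i)))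
          (*-homo m (+ 2 / 1 *ᵣ ι k) (ι ∘ total A)))))
        where m = runE-isMean A 1≤k L s

      -- With parities worth at most k / 2 at the end of the phase, the bound on `R` leaves 16 D
      -- plus twice the growth at least 1/2 - 2/k. For k at least 8 this is at least 1/4;
      -- multiplying by 4 gives the constants 64 and 8.
      small-start : ∀ s → total A s ≡ T₀ →
        1ℚ ≤ᵣ + 64 / 1 *ᵣ runE A L D s +ᵣ + 8 / 1 *ᵣ (runE A L (ι ∘ total A) s -ᵣ ι T₀)
      small-start s Ts = go v (ι k) (ι T₀) (runE A L D s)
          (∑⟨ A ⟩ (λ i → runE A L (λ x → sign (lookup x i + a i)) s)) (runE A L (ι ∘ total A) s)
          vk (0≤inv k) (subst (_≤ᵣ ι k) (ι-/ 8) (ι-mono 8≤∣A∣))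
          (subst₂ _≤ᵣ_ (E-const (runE-isMean A 1≤k L s) _) (runE-R s)
            (runE-mono-above A 1≤k L R-lower s (ℕ.≤-reflexive (sym Ts))))
          (subst (∑⟨ A ⟩ (λ i → runE A L (λ x → sign (lookup x i + a i)) s) ≤ᵣ_) (∑⟨⟩-const A ½)
            (∑⟨⟩-mono A (λ i Ai → Parity.runE-parity-half e A 2≤k (a i) i Ai L k≤L s)))
        where
        2≤k : 2 ≤ k
        2≤k = ℕ.≤-trans (s≤s (s≤s z≤n)) 8≤∣A∣
        k≤L : k ≤ L
        k≤L = ℕ.≤-trans (∣∣≤n A) n≤L
        go : ∀ v k t D p T → v *ᵣ k ≡ 1ℚ → 0ℚ ≤ᵣ v → + 8 / 1 ≤ᵣ k →
             k +ᵣ + 2 / 1 *ᵣ k *ᵣ t -ᵣ + 2 / 1 ≤ᵣ + 16 / 1 *ᵣ (k *ᵣ D) +ᵣ (p +ᵣ + 2 / 1 *ᵣ k *ᵣ T) →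
             p ≤ᵣ k *ᵣ ½ → 1ℚ ≤ᵣ + 64 / 1 *ᵣ D +ᵣ + 8 / 1 *ᵣ (T -ᵣ t)
        go v k t D p T vk 0≤v 8≤k h₁ h₂ = subst₂ _≤ᵣ_ vk
          (trans (cong (_*ᵣ (+ 64 / 1 *ᵣ D +ᵣ + 8 / 1 *ᵣ (T -ᵣ t))) vk) (ℚ.*-identityˡ _)) scaled
          where
          scaled : v *ᵣ k ≤ᵣ v *ᵣ k *ᵣ (+ 64 / 1 *ᵣ D +ᵣ + 8 / 1 *ᵣ (T -ᵣ t))
          scaled = ≤-by (const (+ 4 / 1) ⊛ 0≤v ⊛ (gap h₁ ⊕ gap h₂) ⊕ 0≤v ⊛ gap 8≤k)
            (solve (v ∷ k ∷ t ∷ D ∷ p ∷ T ∷ []) ℚ-ring)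

    -- The last term makes the estimate unconditional: for totals beyond the budget `B`, where the
    -- phase may be too short for `Growth`, it alone exceeds 1.
    phase-gain : ∀ s → 1ℚ ≤ᵣ + 64 / 1 *ᵣ runE A L D s +ᵣ + 8 / 1 *ᵣ (runE A L (ι ∘ total A) s -ᵣ ι (total A s))
                             +ᵣ + 8 / 1 *ᵣ (ι (total A s) *ᵣ inv B)
    phase-gain s with total A s ℕ.≤? B
    ... | yes T≤B = let (a , ∑a , level) = levels A (suc (total A s)) 1≤k (s≤s T≤B) in
      ℚ.≤-trans (small-start (total A s) T≤B a ∑a level s refl)
        (≤-by (const (+ 8 / 1) ⊛ (0≤ι (total A s) ⊛ 0≤inv B)) refl)
    ... | no  T≰B = go (runE A L D s) (runE A L (ι ∘ total A) s) (ι (total A s)) (inv B) (ι B)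
      (subst (_≤ᵣ runE A L D s) (E-const (runE-isMean A 1≤k L s) 0ℚ) (mono (runE-isMean A 1≤k L s) D≥0))
      (runE-total-≥ A 1≤k L s) (ι-mono (ℕ.<⇒≤ (ℕ.≰⇒> T≰B))) (0≤inv B) (inv-cancel 1≤B)
      where
      go : ∀ D T t v b → 0ℚ ≤ᵣ D → t ≤ᵣ T → b ≤ᵣ t → 0ℚ ≤ᵣ v → v *ᵣ b ≡ 1ℚ →
           1ℚ ≤ᵣ + 64 / 1 *ᵣ D +ᵣ + 8 / 1 *ᵣ (T -ᵣ t) +ᵣ + 8 / 1 *ᵣ (t *ᵣ v)
      go D T t v b 0≤D t≤T b≤t 0≤v vb = subst (_≤ᵣ + 64 / 1 *ᵣ D +ᵣ + 8 / 1 *ᵣ (T -ᵣ t) +ᵣ + 8 / 1 *ᵣ (t *ᵣ v)) vb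
        (≤-by (const (+ 64 / 1) ⊛ 0≤D ⊕ const (+ 8 / 1) ⊛ gap t≤T ⊕ (const (+ 8 / 1) ⊛ (0≤v ⊛ gap b≤t) ⊕ const (+ 7 / 1) ⊛ nn))
          (solve (D ∷ T ∷ t ∷ v ∷ b ∷ []) ℚ-ring))
        where
        nn : 0ℚ ≤ᵣ v *ᵣ b
        nn = subst (0ℚ ≤ᵣ_) (sym vb) (const 1ℚ)

-- The order of scores

inv-* : ∀ a b → ι (suc a) *ᵣ inv (suc a * suc b) ≡ inv (suc b)
inv-* a b = begin
  ι (suc a) *ᵣ w                          ≡⟨ ℚ.*-identityˡ _ ⟨
  1ℚ *ᵣ (ι (suc a) *ᵣ w)                  ≡⟨ cong (_*ᵣ (ι (suc a) *ᵣ w)) (inv-cancel {suc b} (s≤s z≤n)) ⟨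
  inv (suc b) *ᵣ ι (suc b) *ᵣ (ι (suc a) *ᵣ w) ≡⟨ reorder (inv (suc b)) (ι (suc b)) (ι (suc a)) w ⟩
  inv (suc b) *ᵣ (w *ᵣ (ι (suc a) *ᵣ ι (suc b))) ≡⟨ cong (λ x → inv (suc b) *ᵣ (w *ᵣ x)) (ι-* (suc a) (suc b)) ⟨
  inv (suc b) *ᵣ (w *ᵣ ι (suc a * suc b)) ≡⟨ cong (inv (suc b) *ᵣ_) (inv-cancel {suc a * suc b} (s≤s z≤n)) ⟩
  inv (suc b) *ᵣ 1ℚ                       ≡⟨ ℚ.*-identityʳ _ ⟩
  inv (suc b)                             ∎
  where
  open ≡-Reasoning
  w = inv (suc a * suc b)
  reorder : ∀ v k l w → v *ᵣ k *ᵣ (l *ᵣ w) ≡ v *ᵣ (w *ᵣ (l *ᵣ k))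
  reorder v k l w = solve (v ∷ k ∷ l ∷ w ∷ []) ℚ-ring

0<inv : ∀ k → ¬ (inv (suc k) ≤ᵣ 0ℚ)
0<inv k h = contradiction (subst₂ _≤ᵣ_ (ι-inv k) (ℚ.*-zeroʳ (ι (suc k))) (*-monoˡ (0≤ι (suc k)) h))
  (λ 1≤0 → contradiction (ι-cancel {1} {0} (subst₂ _≤ᵣ_ (sym (ι-/ 1)) (sym (ι-/ 0)) 1≤0)) λ ())

positive-≥inv : ∀ δ → 0ℚ <ᵣ δ → ∃[ b ] inv (suc b) ≤ᵣ δ
positive-≥inv δ@(mkℚ (+ zero)    b _) 0<δ = contradiction (ℚ.positive 0<δ) λ ()
positive-≥inv δ@(mkℚ +[1+ a ]    b _) 0<δ = b , subst (inv (suc b) ≤ᵣ_) (trans (sym (/-split (suc a) b)) (ℚ.↥p/↧p≡p δ))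
  (subst (_≤ᵣ ι (suc a) *ᵣ inv (suc b)) (trans (cong (_*ᵣ inv (suc b)) (ι-/ 1)) (ℚ.*-identityˡ _))
    (ℚ.*-monoʳ-≤-nonNeg (inv (suc b)) {{ℚ.nonNegative (0≤inv (suc b))}} (ι-mono (s≤s z≤n))))
positive-≥inv δ@(mkℚ (-[1+ a ])  b _) 0<δ = contradiction (ℚ.positive 0<δ) λ ()

archimedean : ∀ {p q} → (∀ k → p ≤ᵣ q +ᵣ + 6 / 1 *ᵣ inv (suc k)) → p ≤ᵣ q
archimedean {p} {q} h = ℚ.≮⇒≥ λ q<p →
  let (b , b≤) = positive-≥inv (p -ᵣ q) (subst (_<ᵣ p -ᵣ q) (ℚ.+-inverseʳ q) (ℚ.+-monoˡ-< (- q) q<p)) in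
  -- The index makes the tolerance w a seventh of the reciprocal b bounding p - q from below: then 7
  -- w ≤ 6 w, which is absurd.
  0<inv (b + 6 * suc b) (go p q (inv (suc b)) (inv (7 * suc b)) (trans (cong (_*ᵣ inv (7 * suc b)) (sym (ι-/ 7))) (inv-* 6 b)) b≤ (h (b + 6 * suc b)))
  where
  go : ∀ p q b w → + 7 / 1 *ᵣ w ≡ b → b ≤ᵣ p -ᵣ q → p ≤ᵣ q +ᵣ + 6 / 1 *ᵣ w → w ≤ᵣ 0ℚ
  go p q b w refl h₁ h₂ = ≤-by (gap h₁ ⊕ gap h₂) (solve (p ∷ q ∷ w ∷ []) ℚ-ring)

private
  2/ : ∀ i → + 2 / suc i ≡ + 2 / 1 *ᵣ inv (suc i)
  2/ i = trans (/-split 2 i) (cong (_*ᵣ inv (suc i)) (ι-/ 2))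

≤ℝ⇒seq : ∀ {x y} → x ≤ℝ y → ∀ k → seq x k ≤ᵣ seq y k +ᵣ + 2 / 1 *ᵣ inv (suc k)
≤ℝ⇒seq {x} {y} x≤y k = subst (λ z → seq x k ≤ᵣ seq y k +ᵣ z) (2/ k) (ℚ.≮⇒≥ (λ lt → x≤y (k , lt)))

≤ℝ-trans : ∀ {x y z} → x ≤ℝ y → y ≤ℝ z → x ≤ℝ z
≤ℝ-trans {x} {y} {z} x≤y y≤z (i , z<x) = ℚ.<-irrefl refl (ℚ.<-≤-trans z<x
  (subst (λ t → seq x i ≤ᵣ seq z i +ᵣ t) (sym (2/ i)) (archimedean λ k →
    go (seq x i) (seq x k) (seq y k) (seq z k) (seq z i) (inv (suc i)) (inv (suc k))
      (regular x i k) (≤ℝ⇒seq {x} {y} x≤y k) (≤ℝ⇒seq {y} {z} y≤z k) (regular z k i))))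
  where
  go : ∀ xi xk yk zk zi i k → xi ≤ᵣ xk +ᵣ (i +ᵣ k) → xk ≤ᵣ yk +ᵣ + 2 / 1 *ᵣ k → yk ≤ᵣ zk +ᵣ + 2 / 1 *ᵣ k →
       zk ≤ᵣ zi +ᵣ (k +ᵣ i) → xi ≤ᵣ zi +ᵣ + 2 / 1 *ᵣ i +ᵣ + 6 / 1 *ᵣ k
  go xi xk yk zk zi i k h₁ h₂ h₃ h₄ = ≤-by (gap h₁ ⊕ gap h₂ ⊕ gap h₃ ⊕ gap h₄)
    (solve (xi ∷ xk ∷ yk ∷ zk ∷ zi ∷ i ∷ k ∷ []) ℚ-ring)

<ℝ⇒≤ℝ : ∀ {x y} → x <ℝ y → x ≤ℝ y
<ℝ⇒≤ℝ {x} {y} (i , x<y) (j , y<x) = ℚ.<-irrefl refl (ℚ.<-≤-trans (ℚ.+-mono-< x<y y<x)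
  (ℚ.≤-trans (ℚ.+-mono-≤ (regular y i j) (regular x j i)) (ℚ.≤-reflexive
    (trans (reorder (seq y j) (seq x i) (inv (suc i)) (inv (suc j)))
      (sym (cong₂ (λ a b → seq x i +ᵣ a +ᵣ (seq y j +ᵣ b)) (2/ i) (2/ j)))))))
  where
  reorder : ∀ y x i j → y +ᵣ (i +ᵣ j) +ᵣ (x +ᵣ (j +ᵣ i)) ≡ x +ᵣ + 2 / 1 *ᵣ i +ᵣ (y +ᵣ + 2 / 1 *ᵣ j)
  reorder y x i j = solve (y ∷ x ∷ i ∷ j ∷ []) ℚ-ring

≤ℝ-refl : ∀ x → x ≤ℝ x
≤ℝ-refl x (i , x<x) = ℚ.<-irrefl refl (ℚ.<-≤-trans x<x
  (≤-by (const (+ 2 / 1) ⊛ 0≤inv (suc i)) (cong (seq x i +ᵣ_) (2/ i))))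

half-≥0 : ∀ j → fromℚ 0ℚ ≤ℝ fromℚ (half j)
half-≥0 j (i , h) = ℚ.<-irrefl refl (ℚ.<-≤-trans h (subst₂ (λ a b → 0ℚ ≤ᵣ a +ᵣ b) (sym (/-split j 1)) (sym (2/ i))
  (0≤ι j ⊛ 0≤inv 2 ⊕ const (+ 2 / 1) ⊛ 0≤inv (suc i))))

half-mono-< : ∀ {j j′} → j < j′ → fromℚ (half j) <ℝ fromℚ (half j′)
-- At index 4 the required margin is 2/5, less than the 1/2 between consecutive fills.
half-mono-< {j} {j′} j<j′ = 4 , subst₂ _<ᵣ_ (cong (_+ᵣ + 2 / 5) (sym (/-split j 1))) (sym (/-split j′ 1))
  (ℚ.<-≤-trans (ℚ.+-monoʳ-< (ι j *ᵣ ½) (toWitness′ {p = + 2 / 5} {½}))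
    (go (ι j) (ι j′) (subst (_≤ᵣ ι j′) (trans (ι-+ 1 j) (cong (_+ᵣ ι j) (ι-/ 1))) (ι-mono j<j′))))
  where
  toWitness′ : ∀ {p q} {_ : True (p ℚ.<? q)} → p <ᵣ q
  toWitness′ {_} {_} {w} = toWitness w
  go : ∀ x y → 1ℚ +ᵣ x ≤ᵣ y → x *ᵣ ½ +ᵣ ½ ≤ᵣ y *ᵣ ½
  go x y h = ≤-by (const ½ ⊛ gap h) (solve (x ∷ y ∷ []) ℚ-ring)

minimum : ∀ (R : Fin n → Fin n → Set) → (∀ i j → R i j ⊎ R j i) → (∀ {i j k} → R i j → R j k → R i k) →
  ∀ (A : Fin n → Bool) → (∃[ m ] (A m ≡ true × (∀ i → A i ≡ true → R m i))) ⊎ (∀ i → A i ≡ false)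
minimum {zero}  R tot tr A = inj₂ λ ()
minimum {suc n} R tot tr A with minimum (λ i j → R (suc i) (suc j)) (λ i j → tot (suc i) (suc j)) tr (A ∘ suc) | A zero in A₀
... | inj₂ none          | false = inj₂ λ { zero → A₀ ; (suc i) → none i }
... | inj₂ none          | true  = inj₁ (zero , A₀ , λ { zero _ → reflexive ; (suc i) Ai → contradiction (trans (sym Ai) (none i)) λ () })
  where
  reflexive : R zero zero
  reflexive with tot zero zero
  ... | inj₁ r = r
  ... | inj₂ r = r
... | inj₁ (m , Am , ≤)  | false = inj₁ (suc m , Am , λ { zero A₀′ → contradiction (trans (sym A₀′) A₀) λ () ; (suc i) Ai → ≤ i Ai })
... | inj₁ (m , Am , ≤)  | true with tot zero (suc m)
... | inj₁ 0≤m = inj₁ (zero , A₀ , λ { zero _ → reflexive ; (suc i) Ai → tr 0≤m (≤ i Ai) })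
  where
  reflexive : R zero zero
  reflexive with tot zero zero
  ... | inj₁ r = r
  ... | inj₂ r = r
... | inj₂ m≤0 = inj₁ (suc m , Am , λ { zero _ → m≤0 ; (suc i) Ai → ≤ i Ai })

¬¬-∀ : ∀ {P : Fin n → Set} → (∀ i → ¬ ¬ P i) → ¬ ¬ (∀ i → P i)
¬¬-∀ {zero}  h k = k λ ()
¬¬-∀ {suc n} h k = h zero λ p₀ → ¬¬-∀ (h ∘ suc) λ ps → k λ { zero → p₀ ; (suc i) → ps i }

module Scores {n : ℕ} (e : ScoreBasedEmptier n) where

  open ScoreBasedEmptier e
  open Phase e using (Level)

  infix 4 _≼_

  opaque

    -- (i , j) is the j-th half unit of cup i.
    _≼_ : Fin n × ℕ → Fin n × ℕ → Set
    (i , j) ≼ (i′ , j′) = σ i (fromℚ (half j)) ≤ℝ σ i′ (fromℚ (half j′))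

    ≼-trans : ∀ {p q r : Fin n × ℕ} → p ≼ q → q ≼ r → p ≼ r
    ≼-trans {i , j} {i′ , j′} {i″ , j″} = ≤ℝ-trans {σ i (fromℚ (half j))} {σ i′ (fromℚ (half j′))} {σ i″ (fromℚ (half j″))}

    ≼-refl : ∀ (p : Fin n × ℕ) → p ≼ p
    ≼-refl (i , j) = ≤ℝ-refl (σ i (fromℚ (half j)))

    ≼-mono-< : ∀ (i : Fin n) {j j′ : ℕ} → j < j′ → (i , j) ≼ (i , j′)
    ≼-mono-< i {j} {j′} j<j′ = <ℝ⇒≤ℝ {σ i (fromℚ (half j))} {σ i (fromℚ (half j′))} (σ-mono i (half-≥0 j) (half-mono-< j<j′))

    ≼-total : ∀ (p q : Fin n × ℕ) → ¬ ¬ (p ≼ q ⊎ q ≼ p)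
    ≼-total (i , j) (i′ , j′) k = k (inj₁ λ lt → k (inj₂ (<ℝ⇒≤ℝ {σ i′ (fromℚ (half j′))} {σ i (fromℚ (half j))} lt)))

    ≼-antisym : ∀ {i i′ : Fin n} {j j′ : ℕ} → 1 ≤ j → 1 ≤ j′ → (i , j) ≼ (i′ , j′) → (i′ , j′) ≼ (i , j) → i ≡ i′
    ≼-antisym {i} {i′} {j} {j′} 1≤j 1≤j′ h h′ = proj₁ (σ-distinct i i′ j j′ 1≤j 1≤j′ (h , h′))

    ≼-select : ∀ (s : State n) (i : Fin n) → (i , lookup s i) ≼ (select s , lookup s (select s))
    ≼-select = select-max

  ≼-mono : ∀ i {j j′} → j ≤ j′ → (i , j) ≼ (i , j′)
  ≼-mono i {j} {j′} j≤j′ with j ℕ.≟ j′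
  ... | yes refl = ≼-refl (i , j)
  ... | no  j≢j′ = ≼-mono-< i (ℕ.≤∧≢⇒< j≤j′ j≢j′)

  -- The order of the real scores is not decidable. The construction compares only finitely many
  -- half units, and finitely many comparisons are jointly available under double negation.
  Comparable : ℕ → Set
  Comparable N = ∀ i i′ j j′ → j ≤ N → j′ ≤ N → (i , j) ≼ (i′ , j′) ⊎ (i′ , j′) ≼ (i , j)

  ¬¬-Comparable : ∀ N → ¬ ¬ Comparable N
  ¬¬-Comparable N = ¬¬-map extend
    (¬¬-∀ λ i → ¬¬-∀ λ i′ → ¬¬-∀ λ (j : Fin (suc N)) → ¬¬-∀ λ (j′ : Fin (suc N)) → ≼-total (i , toℕ j) (i′ , toℕ j′))
    where
    extend : (∀ i i′ (j j′ : Fin (suc N)) → (i , toℕ j) ≼ (i′ , toℕ j′) ⊎ (i′ , toℕ j′) ≼ (i , toℕ j)) → Comparable N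
    extend cmp i i′ j j′ j≤N j′≤N = subst₂ (λ x y → (i , x) ≼ (i′ , y) ⊎ (i′ , y) ≼ (i , x))
      (Fin.toℕ-fromℕ< (s≤s j≤N)) (Fin.toℕ-fromℕ< (s≤s j′≤N)) (cmp i i′ (fromℕ< (s≤s j≤N)) (fromℕ< (s≤s j′≤N)))

  -- `a` describes an initial segment of the half units ordered by score: the last one taken from
  -- any cup precedes the first one not taken from any cup.
  Initial : (Fin n → Bool) → (Fin n → ℕ) → Set
  Initial A a = ∀ i i′ → A i ≡ true → A i′ ≡ true → 1 ≤ a i → (i , a i) ≼ (i′ , suc (a i′))

  -- A selected cup at or below its level would score no more than its last half unit in the
  -- segment, hence no more than the next half unit of `d`, hence no more than `d`. As it also has
  -- the maximal score, distinctness of scores would identify the two cups.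
  initial⇒level : ∀ A a → Initial A a → Level A a
  initial⇒level A a init d s Ad ad<sd A∖d-sel 1≤sel = ℕ.≰⇒> λ sel≤a →
    let i = select s
        i≢d : i ≢ d
        i≢d i≡d = contradiction (trans (sym A∖d-sel) (trans (cong (A ∖ d) i≡d) (∖-same A d))) λ ()
        Ai = trans (sym (∖-other A i≢d)) A∖d-sel
        sel≼d : (i , lookup s i) ≼ (d , lookup s d)
        sel≼d = ≼-trans {i , lookup s i} {i , a i} {d , lookup s d} (≼-mono i sel≤a)
          (≼-trans {i , a i} {d , suc (a d)} {d , lookup s d} (init i d Ai Ad (ℕ.≤-trans 1≤sel sel≤a)) (≼-mono d ad<sd))
    in i≢d (sym (≼-antisym (ℕ.≤-trans (s≤s z≤n) ad<sd) 1≤sel (≼-select s d) sel≼d))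

  -- Greedy construction: the segment is extended by the half unit of least score among the next
  -- ones of the cups in `A`. The bound on each `a i` keeps all comparisons within the range of
  -- `cmp`.
  initial-exists : ∀ N → Comparable N → ∀ A → 1 ≤ ∣ A ∣ᴬ → ∀ t → t ≤ N →
                   ∃[ a ] (∑⟦ A ⟧ a ≡ t × (∀ i → a i ≤ t) × Initial A a)
  initial-exists N cmp A 1≤∣A∣ zero    _   = (λ _ → 0) , zeros , (λ i → z≤n) , (λ i i′ _ _ ())
    where
    zeros : ∑⟦ A ⟧ (λ _ → 0) ≡ 0
    zeros = trans (∑ℕ.sum-cong-≗ (λ i → gate0 (A i))) (∑ℕ.sum-replicate-zero n)
      where
      gate0 : ∀ b → ⟦ b ⟧ 0 ≡ 0
      gate0 true  = refl
      gate0 false = refl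
  initial-exists N cmp A 1≤∣A∣ (suc t) t<N with initial-exists N cmp A 1≤∣A∣ t (ℕ.<⇒≤ t<N)
  ... | a , ∑a , a≤t , init with minimum (λ i i′ → (i , suc (a i)) ≼ (i′ , suc (a i′)))
          (λ i i′ → cmp i i′ (suc (a i)) (suc (a i′)) (ℕ.≤-trans (s≤s (a≤t i)) t<N) (ℕ.≤-trans (s≤s (a≤t i′)) t<N))
          (λ {i} {j} {k} → ≼-trans {i , suc (a i)} {j , suc (a j)} {k , suc (a k)}) A
  ... | inj₂ none = contradiction 1≤∣A∣ (ℕ.<⇒≱ (ℕ.≤-reflexive (cong suc empty-sum)))
    where
    empty-sum : ∣ A ∣ᴬ ≡ 0
    empty-sum = trans (∑ℕ.sum-cong-≗ (λ i → cong (⟦_⟧ 1) (none i))) (∑ℕ.sum-replicate-zero n)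
  ... | inj₁ (m , Am , min) = a⁺ , ∑a⁺ , a⁺≤ , init⁺
    where
    a⁺ : Fin n → ℕ
    a⁺ i = if does (i Fin.≟ m) then suc (a m) else a i
    a⁺m : a⁺ m ≡ suc (a m)
    a⁺m with m Fin.≟ m
    ... | yes _  = refl
    ... | no m≢m = contradiction refl m≢m
    a⁺-other : ∀ i → i ≢ m → a⁺ i ≡ a i
    a⁺-other i i≢m with i Fin.≟ m
    ... | yes i≡m = contradiction i≡m i≢m
    ... | no  _   = refl
    ∑a⁺ : ∑⟦ A ⟧ a⁺ ≡ suc t
    ∑a⁺ = ℕ.+-cancelʳ-≡ (a m) _ _ (begin
      ∑⟦ A ⟧ a⁺ + a m       ≡⟨ ∑⟦⟧-update A Am a⁺-other ⟩
      ∑⟦ A ⟧ a + a⁺ m       ≡⟨ cong₂ _+_ ∑a a⁺m ⟩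
      t + suc (a m)         ≡⟨ ℕ.+-suc t (a m) ⟩
      suc t + a m           ∎)
      where open ≡-Reasoning
    a⁺≤ : ∀ i → a⁺ i ≤ suc t
    a⁺≤ i with i Fin.≟ m
    ... | yes _ = s≤s (a≤t m)
    ... | no  _ = ℕ.m≤n⇒m≤1+n (a≤t i)
    a≤a⁺ : ∀ i → a i ≤ a⁺ i
    a≤a⁺ i with i Fin.≟ m
    ... | yes refl = ℕ.n≤1+n (a m)
    ... | no  _    = ℕ.≤-refl
    next : ∀ i i′ → A i ≡ true → A i′ ≡ true → 1 ≤ a⁺ i → (i , a⁺ i) ≼ (i′ , suc (a i′))
    next i i′ Ai Ai′ 1≤ with i Fin.≟ m
    ... | yes refl = min i′ Ai′
    ... | no  _    = init i i′ Ai Ai′ 1≤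
    init⁺ : Initial A a⁺
    init⁺ i i′ Ai Ai′ 1≤ = ≼-trans {i , a⁺ i} {i′ , suc (a i′)} {i′ , suc (a⁺ i′)}
      (next i i′ Ai Ai′ 1≤) (≼-mono i′ (s≤s (a≤a⁺ i′)))

  levels : ∀ {B} → Comparable (suc B) → ∀ A t → 1 ≤ ∣ A ∣ᴬ → t ≤ suc B → ∃[ a ] (∑⟦ A ⟧ a ≡ t × Level A a)
  levels {B} cmp A t 1≤∣A∣ t≤ = let (a , ∑a , _ , init) = initial-exists (suc B) cmp A 1≤∣A∣ t t≤ in
    a , ∑a , initial⇒level A a init

-- Expected averages over the whole game

μ-total-∖ : ∀ (A : Fin n → Bool) {k} → ∣ A ∣ᴬ ≡ suc k → ∀ s →
            μ A (λ d → ι (total (A ∖ d) s)) ≡ inv (suc k) *ᵣ ι k *ᵣ ι (total A s)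
μ-total-∖ {n} A {k} ∣A∣ s = trans (cong₂ (λ l x → inv l *ᵣ x) ∣A∣ sums) (sym (ℚ.*-assoc (inv (suc k)) (ι k) (ι T)))
  where
  T = total A s
  rest : Fin n → ℚ
  rest d = ι (total (A ∖ d) s)
  split : ∀ d → A d ≡ true → rest d +ᵣ ι (lookup s d) ≡ ι T
  split d Ad = trans (sym (ι-+ _ _)) (cong ι (total-∖ A s Ad))
  both : ∑⟨ A ⟩ rest +ᵣ ι T ≡ (1ℚ +ᵣ ι k) *ᵣ ι T
  both = begin
    ∑⟨ A ⟩ rest +ᵣ ι T
      ≡⟨ cong (∑⟨ A ⟩ rest +ᵣ_) (trans (cong ι (total-∑ A s)) (∑⟨⟩-ι A (lookup s))) ⟩
    ∑⟨ A ⟩ rest +ᵣ ∑⟨ A ⟩ (ι ∘ lookup s)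
      ≡⟨ ∑⟨⟩-+ A rest (ι ∘ lookup s) ⟨
    ∑⟨ A ⟩ (λ d → rest d +ᵣ ι (lookup s d))
      ≡⟨ ℚ.≤-antisym (∑⟨⟩-mono A (λ d Ad → ℚ.≤-reflexive (split d Ad))) (∑⟨⟩-mono A (λ d Ad → ℚ.≤-reflexive (sym (split d Ad)))) ⟩
    ∑⟨ A ⟩ (λ _ → ι T)
      ≡⟨ ∑⟨⟩-const A (ι T) ⟩
    ι ∣ A ∣ᴬ *ᵣ ι T
      ≡⟨ cong (_*ᵣ ι T) (trans (cong ι ∣A∣) (trans (ι-+ 1 k) (cong (_+ᵣ ι k) (ι-/ 1)))) ⟩
    (1ℚ +ᵣ ι k) *ᵣ ι T ∎
    where open ≡-Reasoning
  subtract : ∀ x k t → x +ᵣ t ≡ (1ℚ +ᵣ k) *ᵣ t → x ≡ k *ᵣ t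
  subtract x k t h = trans {j = x +ᵣ t -ᵣ t} (solve (x ∷ t ∷ []) ℚ-ring)
    (trans (cong (_-ᵣ t) h) (solve (k ∷ t ∷ []) ℚ-ring))
  sums : ∑⟨ A ⟩ rest ≡ ι k *ᵣ ι T
  sums = subtract (∑⟨ A ⟩ rest) (ι k) (ι T) both

average≡ : ∀ xs → average xs ≡ inv (length xs) *ᵣ sumᴸ xs id
average≡ []       = refl
average≡ (x ∷ xs) = trans (ℚ.*-comm _ (inv (suc (length xs)))) (cong (λ y → inv (suc (length xs)) *ᵣ (x +ᵣ y)) (foldr≡ xs))
  where
  foldr≡ : ∀ ys → foldr _+ᵣ_ 0ℚ ys ≡ sumᴸ ys id
  foldr≡ []       = refl
  foldr≡ (y ∷ ys) = cong (y +ᵣ_) (foldr≡ ys)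

average-labels : ∀ (π : Permutation′ n) {m} → m ≤ n → ∀ s →
  average (map (λ x → fill s (π ⟨$⟩ʳ x)) (labels n m)) ≡ ½ *ᵣ inv m *ᵣ ι (total (active π m) s)
average-labels {n} π {m} m≤n s = begin
  average (map f (labels n m))
    ≡⟨ average≡ (map f (labels n m)) ⟩
  inv (length (map f (labels n m))) *ᵣ sumᴸ (map f (labels n m)) id
    ≡⟨ cong₂ (λ l x → inv l *ᵣ x) (trans (List.length-map f (labels n m)) (length-labels n m≤n))
         (trans (sumᴸ-map f (labels n m) id) (trans (sumᴸ-take m id f) (∑-active π m (fill s)))) ⟩
  inv m *ᵣ ∑⟨ active π m ⟩ (fill s)
    ≡⟨ cong (inv m *ᵣ_) (trans (∑ℚ.sum-cong-≗ (λ c → cong (⟨ active π m c ⟩_) (trans (/-split (lookup s c) 1) (ℚ.*-comm (ι (lookup s c)) ½))))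
         (trans (∑⟨⟩-* (active π m) ½ (ι ∘ lookup s)) (cong (½ *ᵣ_) (sym (trans (cong ι (total-∑ (active π m) s)) (∑⟨⟩-ι (active π m) (lookup s))))))) ⟩
  inv m *ᵣ (½ *ᵣ ι (total (active π m) s))
    ≡⟨ reorder (inv m) ½ (ι (total (active π m) s)) ⟩
  ½ *ᵣ inv m *ᵣ ι (total (active π m) s) ∎
  where
  open ≡-Reasoning
  f : Fin n → ℚ
  f x = fill s (π ⟨$⟩ʳ x)
  reorder : ∀ a b c → a *ᵣ (b *ᵣ c) ≡ b *ᵣ a *ᵣ c
  reorder a b c = solve (a ∷ b ∷ c ∷ []) ℚ-ring

module Averages {n : ℕ} (e : ScoreBasedEmptier n) (L : ℕ) where

  open Game e
  open Moves e
  open Phase e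
  open Drop e L

  activeTotal : ℕ → Permutation′ n × State n → ℚ
  activeTotal k (π , s) = ι (total (active π k) s)

  -- Expected totals of the cups active in the k-cup phase: `X k` at its beginning, `Y k` at its
  -- end, before the next cup is dropped.
  X Y : ℕ → ℚ
  X k = EPlay (n ∸ k) (activeTotal k)
  Y k = EPlay (suc (n ∸ k)) (activeTotal k)

  -- α k is the expected average number of half units when the k-cup phase begins.
  α : ℕ → ℚ
  α k = inv k *ᵣ X k

  EPlay-phase : ∀ {k} → k ≤ n → ∀ F → EPlay (suc (n ∸ k)) F ≡
                EPlay (n ∸ k) (λ (π , s) → runE (active π k) L (λ s′ → F (π , s′)) s)
  EPlay-phase {k} k≤n F = cong (λ j → EΠ n (λ π → playE π L (n ∸ k) (runE (active π j) L (λ s → F (π , s)))))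
    (ℕ.m∸[m∸n]≡n k≤n)

  n∸k : ∀ {k} → k < n → n ∸ k ≡ suc (n ∸ suc k)
  n∸k {k} k<n = trans (sym (ℕ.suc-pred (n ∸ k) {{ℕ.>-nonZero (ℕ.m<n⇒0<n∸m k<n)}})) (cong suc (ℕ.pred[m∸n]≡m∸[1+n] n k))

  mean : ∀ k → IsMean (EPlay (n ∸ k))
  mean k = EPlay-isMean (ℕ.m∸n≤m n k)

  X≤Y : ∀ {k} → 1 ≤ k → k ≤ n → X k ≤ᵣ Y k
  X≤Y {k} 1≤k k≤n = subst (X k ≤ᵣ_) (sym (EPlay-phase k≤n (activeTotal k)))
    (mono (mean k) (λ (π , s) → runE-total-≥ (active π k) (subst (1 ≤_) (sym (∣active∣ π k≤n)) 1≤k) L s))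

  X-drop : ∀ {k} → k < n → X k ≡ inv (suc k) *ᵣ ι k *ᵣ Y (suc k)
  X-drop {k} k<n = begin
    EPlay (n ∸ k) (activeTotal k)
      ≡⟨ drop-uniform k<n ℕ.≤-refl (λ A s → ι (total A s)) (λ A≗B s → cong ι (total-mask-cong A≗B s)) ⟩
    EPlay (n ∸ k) (λ (π , s) → μ (active π (suc k)) (λ d → ι (total (active π (suc k) ∖ d) s)))
      ≡⟨ E-cong (mean k) (λ (π , s) → μ-total-∖ (active π (suc k)) (∣active∣ π k<n) s) ⟩
    EPlay (n ∸ k) (λ ω → inv (suc k) *ᵣ ι k *ᵣ activeTotal (suc k) ω)
      ≡⟨ *-homo (mean k) (inv (suc k) *ᵣ ι k) (activeTotal (suc k)) ⟩
    inv (suc k) *ᵣ ι k *ᵣ EPlay (n ∸ k) (activeTotal (suc k))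
      ≡⟨ cong (λ i → inv (suc k) *ᵣ ι k *ᵣ EPlay i (activeTotal (suc k))) (n∸k k<n) ⟩
    inv (suc k) *ᵣ ι k *ᵣ Y (suc k) ∎
    where open ≡-Reasoning

  X≡α : ∀ {k} → 1 ≤ k → X k ≡ ι k *ᵣ α k
  X≡α {k} 1≤k = sym (trans (sym (ℚ.*-assoc (ι k) (inv k) (X k)))
    (trans (cong (_*ᵣ X k) (trans (ℚ.*-comm (ι k) (inv k)) (inv-cancel 1≤k))) (ℚ.*-identityˡ (X k))))

  -- A uniform drop preserves the expected average, so the average at the end of the (k + 1)-cup
  -- phase is already α k. With `X≡α`, the growth in each phase becomes a difference of consecutive
  -- averages.
  Y≡α : ∀ {k} → 1 ≤ k → k < n → Y (suc k) ≡ ι (suc k) *ᵣ α k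
  Y≡α {k} 1≤k k<n = sym (trans (cong (λ x → ι (suc k) *ᵣ (inv k *ᵣ x)) (X-drop k<n))
    (go (ι (suc k)) (inv (suc k)) (inv k) (ι k) (Y (suc k)) (ι-inv k) (inv-cancel 1≤k)))
    where
    go : ∀ k′ v′ v k y → k′ *ᵣ v′ ≡ 1ℚ → v *ᵣ k ≡ 1ℚ → k′ *ᵣ (v *ᵣ (v′ *ᵣ k *ᵣ y)) ≡ y
    go k′ v′ v k y h h′ = trans {j = k′ *ᵣ v′ *ᵣ (v *ᵣ k) *ᵣ y} (solve (k′ ∷ v′ ∷ v ∷ k ∷ y ∷ []) ℚ-ring)
      (trans (cong₂ (λ a b → a *ᵣ b *ᵣ y) h h′) (trans (cong (_*ᵣ y) (ℚ.*-identityˡ 1ℚ)) (ℚ.*-identityˡ y)))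

  α-≥0 : ∀ k → 0ℚ ≤ᵣ α k
  α-≥0 k = 0≤inv k ⊛ subst (_≤ᵣ X k) (E-const (mean k) 0ℚ) (mono (mean k) (λ (π , s) → 0≤ι (total (active π k) s)))

  α-step : ∀ {k} → 1 ≤ k → k < n → α (suc k) ≤ᵣ α k
  α-step {k} 1≤k k<n = cancel-ι k (subst₂ _≤ᵣ_ (X≡α {suc k} (s≤s z≤n)) (Y≡α 1≤k k<n) (X≤Y (s≤s z≤n) k<n))

  α-mono : ∀ j {k} → 1 ≤ k → j + k ≤ n → α (j + k) ≤ᵣ α k
  α-mono zero    1≤k _ = ℚ.≤-refl
  α-mono (suc j) {k} 1≤k h = ℚ.≤-trans (α-step (ℕ.≤-trans 1≤k (ℕ.m≤n+m k j)) h) (α-mono j 1≤k (ℕ.<⇒≤ h))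

  expected≡α : ∀ {m} → m ≤ n → expectedAverageFill e L m ≡ ½ *ᵣ α m
  expected≡α {m} m≤n = begin
    expectedAverageFill e L m
      ≡⟨ trans (𝔼≡expect (uniform (permutations n) >>= trial)) (expect->>= (uniform (permutations n)) trial id) ⟩
    EΠ n (λ π → expect (trial π) id)
      ≡⟨ expect-cong (uniform (permutations n)) (λ π → trans (expect->>= (afterPhases e π L (n ∸ m)) (report π) id)
           (trans (expect-afterPhases π L (n ∸ m) _) (playE-cong π L (n ∸ m) (λ s → trans (expect-return (avg π s) id) (average-labels π m≤n s))))) ⟩
    EPlay (n ∸ m) (λ ω → ½ *ᵣ inv m *ᵣ activeTotal m ω)
      ≡⟨ *-homo (mean m) (½ *ᵣ inv m) (activeTotal m) ⟩
    ½ *ᵣ inv m *ᵣ X m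
      ≡⟨ ℚ.*-assoc ½ (inv m) (X m) ⟩
    ½ *ᵣ α m ∎
    where
    open ≡-Reasoning
    avg : Permutation′ n → State n → ℚ
    avg π s = average (map (λ x → fill s (π ⟨$⟩ʳ x)) (labels n m))
    report : Permutation′ n → State n → Dist ℚ
    report π s = return (avg π s)
    trial : Permutation′ n → Dist ℚ
    trial π = afterPhases e π L (n ∸ m) >>= report π

  module _ (B : ℕ) (2≤n : 2 ≤ n) (1≤B : 1 ≤ B) (long : 2 * (B * (n * n * n) ^ suc B) ≤ L)
           (levels : ∀ A t → 1 ≤ ∣ A ∣ᴬ → t ≤ suc B → ∃[ a ] (∑⟦ A ⟧ a ≡ t × Level A a)) where

    -- The expectation of `phase-gain` over the history before the (k + 1)-cup phase. By
    -- `drop-uniform`, the mean over hypothetical drops in `D` is the growth of the actual k-cup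
    -- phase.
    phase-gain-drop : ∀ {k} → 7 ≤ k → k < n →
      1ℚ ≤ᵣ + 64 / 1 *ᵣ (Y k -ᵣ X k) +ᵣ + 8 / 1 *ᵣ (Y (suc k) -ᵣ X (suc k)) +ᵣ + 8 / 1 *ᵣ (X (suc k) *ᵣ inv B)
    phase-gain-drop {k} 7≤k k<n = subst (1ℚ ≤ᵣ_) linear (subst (_≤ᵣ M gainΩ) (1-homo m) (mono m pointwise))
      where
      M = EPlay (n ∸ suc k)
      m = mean (suc k)
      A : Permutation′ n → Fin n → Bool
      A π = active π (suc k)
      dropsΩ growΩ totalΩ gainΩ : Permutation′ n × State n → ℚ
      dropsΩ (π , s) = runE (A π) L (λ x → μ (A π) (λ d → dropGrowth L (A π ∖ d) x)) s
      growΩ (π , s) = runE (A π) L (ι ∘ total (A π)) s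
      totalΩ = activeTotal (suc k)
      gainΩ ω = + 64 / 1 *ᵣ dropsΩ ω +ᵣ + 8 / 1 *ᵣ (growΩ ω -ᵣ totalΩ ω) +ᵣ + 8 / 1 *ᵣ (totalΩ ω *ᵣ inv B)
      pointwise : ∀ ω → 1ℚ ≤ᵣ gainΩ ω
      pointwise (π , s) = phase-gain L B 2≤n 1≤B long levels (A π) (subst (8 ≤_) (sym (∣active∣ π k<n)) (s≤s 7≤k)) s
      M-drops : M dropsΩ ≡ Y k -ᵣ X k
      M-drops = begin
        M dropsΩ
          ≡⟨ EPlay-phase k<n (λ (π , s) → μ (A π) (λ d → dropGrowth L (A π ∖ d) s)) ⟨
        EPlay (suc (n ∸ suc k)) (λ (π , s) → μ (A π) (λ d → dropGrowth L (A π ∖ d) s))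
          ≡⟨ cong (λ i → EPlay i (λ (π , s) → μ (A π) (λ d → dropGrowth L (A π ∖ d) s))) (n∸k k<n) ⟨
        EPlay (n ∸ k) (λ (π , s) → μ (A π) (λ d → dropGrowth L (A π ∖ d) s))
          ≡⟨ drop-uniform k<n ℕ.≤-refl (dropGrowth L) (dropGrowth-cong L) ⟨
        EPlay (n ∸ k) (λ (π , s) → dropGrowth L (active π k) s)
          ≡⟨ difference (mean k) _ (activeTotal k) ⟩
        EPlay (n ∸ k) (λ (π , s) → runE (active π k) L (ι ∘ total (active π k)) s) -ᵣ X k
          ≡⟨ cong (_-ᵣ X k) (EPlay-phase (ℕ.<⇒≤ k<n) (activeTotal k)) ⟨
        Y k -ᵣ X k ∎
        where
        open ≡-Reasoning
        difference : ∀ {S : Set} {E : (S → ℚ) → ℚ} → IsMean E → ∀ F G → E (λ ω → F ω -ᵣ G ω) ≡ E F -ᵣ E G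
        difference {E = E} i F G = trans (E-cong i (λ ω → cong (F ω +ᵣ_) (neg (G ω))))
          (trans (+-homo i F (λ ω → - 1ℚ *ᵣ G ω)) (cong (E F +ᵣ_) (trans (*-homo i (- 1ℚ) G) (sym (neg (E G))))))
          where
          neg : ∀ x → - x ≡ - 1ℚ *ᵣ x
          neg x = solve (x ∷ []) ℚ-ring
      rewritten : ∀ ω → gainΩ ω ≡ + 64 / 1 *ᵣ dropsΩ ω +ᵣ (+ 8 / 1 *ᵣ growΩ ω +ᵣ (+ 8 / 1 *ᵣ inv B -ᵣ + 8 / 1) *ᵣ totalΩ ω)
      rewritten ω = regroup (dropsΩ ω) (growΩ ω) (totalΩ ω) (inv B)
        where
        regroup : ∀ d g t v → + 64 / 1 *ᵣ d +ᵣ + 8 / 1 *ᵣ (g -ᵣ t) +ᵣ + 8 / 1 *ᵣ (t *ᵣ v) ≡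
                  + 64 / 1 *ᵣ d +ᵣ (+ 8 / 1 *ᵣ g +ᵣ (+ 8 / 1 *ᵣ v -ᵣ + 8 / 1) *ᵣ t)
        regroup d g t v = solve (d ∷ g ∷ t ∷ v ∷ []) ℚ-ring
      linear : M gainΩ ≡ + 64 / 1 *ᵣ (Y k -ᵣ X k) +ᵣ + 8 / 1 *ᵣ (Y (suc k) -ᵣ X (suc k)) +ᵣ + 8 / 1 *ᵣ (X (suc k) *ᵣ inv B)
      linear = begin
        M gainΩ
          ≡⟨ E-cong m rewritten ⟩
        M (λ ω → + 64 / 1 *ᵣ dropsΩ ω +ᵣ (+ 8 / 1 *ᵣ growΩ ω +ᵣ (+ 8 / 1 *ᵣ inv B -ᵣ + 8 / 1) *ᵣ totalΩ ω))
          ≡⟨ trans (+-homo m (λ ω → + 64 / 1 *ᵣ dropsΩ ω) _) (cong₂ _+ᵣ_ (*-homo m (+ 64 / 1) dropsΩ)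
               (trans (+-homo m (λ ω → + 8 / 1 *ᵣ growΩ ω) _) (cong₂ _+ᵣ_ (*-homo m (+ 8 / 1) growΩ) (*-homo m (+ 8 / 1 *ᵣ inv B -ᵣ + 8 / 1) totalΩ)))) ⟩
        + 64 / 1 *ᵣ M dropsΩ +ᵣ (+ 8 / 1 *ᵣ M growΩ +ᵣ (+ 8 / 1 *ᵣ inv B -ᵣ + 8 / 1) *ᵣ X (suc k))
          ≡⟨ cong₂ (λ d g → + 64 / 1 *ᵣ d +ᵣ (+ 8 / 1 *ᵣ g +ᵣ (+ 8 / 1 *ᵣ inv B -ᵣ + 8 / 1) *ᵣ X (suc k)))
               M-drops (sym (EPlay-phase k<n (activeTotal (suc k)))) ⟩
        + 64 / 1 *ᵣ (Y k -ᵣ X k) +ᵣ (+ 8 / 1 *ᵣ Y (suc k) +ᵣ (+ 8 / 1 *ᵣ inv B -ᵣ + 8 / 1) *ᵣ X (suc k))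
          ≡⟨ regroup (Y k -ᵣ X k) (Y (suc k)) (X (suc k)) (inv B) ⟩
        + 64 / 1 *ᵣ (Y k -ᵣ X k) +ᵣ + 8 / 1 *ᵣ (Y (suc k) -ᵣ X (suc k)) +ᵣ + 8 / 1 *ᵣ (X (suc k) *ᵣ inv B) ∎
        where
        open ≡-Reasoning
        regroup : ∀ d g t v → + 64 / 1 *ᵣ d +ᵣ (+ 8 / 1 *ᵣ g +ᵣ (+ 8 / 1 *ᵣ v -ᵣ + 8 / 1) *ᵣ t) ≡
                  + 64 / 1 *ᵣ d +ᵣ + 8 / 1 *ᵣ (g -ᵣ t) +ᵣ + 8 / 1 *ᵣ (t *ᵣ v)
        regroup d g t v = solve (d ∷ g ∷ t ∷ v ∷ []) ℚ-ring

    -- Within the budget the last term of `phase-gain-drop` is at most 1/2; doubling the rest turns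
    -- 64 into 128. Monotonicity of the averages lets the larger of the two weights and of the two
    -- cup numbers serve for both phases.
    α-gain : ∀ {j} → 8 ≤ j → 2 + j ≤ n → + 16 / 1 *ᵣ X (2 + j) ≤ᵣ ι B →
             1ℚ ≤ᵣ + 128 / 1 *ᵣ ι (2 + j) *ᵣ (α j -ᵣ α (2 + j))
    α-gain {j} 8≤j j+2≤n small = go (ι (suc j)) (ι (2 + j)) (α j) (α (suc j)) (α (2 + j)) (X (2 + j)) (inv B) (ι B)
      (0≤ι (suc j)) (ι-mono (ℕ.n≤1+n (suc j)))
      (α-step 1≤j (ℕ.<⇒≤ j+2≤n)) (α-step {suc j} (s≤s z≤n) j+2≤n)
      (0≤inv B) (inv-cancel 1≤B) small
      (subst₂ (λ a b → 1ℚ ≤ᵣ + 64 / 1 *ᵣ a +ᵣ + 8 / 1 *ᵣ b +ᵣ + 8 / 1 *ᵣ (X (2 + j) *ᵣ inv B))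
        (trans (cong₂ _-ᵣ_ (Y≡α 1≤j (ℕ.<⇒≤ j+2≤n)) (X≡α {suc j} (s≤s z≤n))) (factor (ι (suc j)) (α j) (α (suc j))))
        (trans (cong₂ _-ᵣ_ (Y≡α {suc j} (s≤s z≤n) j+2≤n) (X≡α {2 + j} (s≤s z≤n))) (factor (ι (2 + j)) (α (suc j)) (α (2 + j))))
        (phase-gain-drop (ℕ.≤-trans (ℕ.n≤1+n 7) (ℕ.m≤n⇒m≤1+n 8≤j)) j+2≤n))
      where
      1≤j : 1 ≤ j
      1≤j = ℕ.≤-trans (s≤s z≤n) 8≤j
      factor : ∀ k a b → k *ᵣ a -ᵣ k *ᵣ b ≡ k *ᵣ (a -ᵣ b)
      factor k a b = solve (k ∷ a ∷ b ∷ []) ℚ-ring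
      go : ∀ k K a b c x v B → 0ℚ ≤ᵣ k → k ≤ᵣ K → b ≤ᵣ a → c ≤ᵣ b → 0ℚ ≤ᵣ v → v *ᵣ B ≡ 1ℚ → + 16 / 1 *ᵣ x ≤ᵣ B →
           1ℚ ≤ᵣ + 64 / 1 *ᵣ (k *ᵣ (a -ᵣ b)) +ᵣ + 8 / 1 *ᵣ (K *ᵣ (b -ᵣ c)) +ᵣ + 8 / 1 *ᵣ (x *ᵣ v) →
           1ℚ ≤ᵣ + 128 / 1 *ᵣ K *ᵣ (a -ᵣ c)
      go k K a b c x v B 0≤k k≤K b≤a c≤b 0≤v vB h₁ h₂ = ℚ.≤-trans
        (subst (λ o → 1ℚ ≤ᵣ + 128 / 1 *ᵣ (k *ᵣ (a -ᵣ b)) +ᵣ + 16 / 1 *ᵣ (K *ᵣ (b -ᵣ c)) +ᵣ o -ᵣ 1ℚ) vB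
          (≤-by (const (+ 2 / 1) ⊛ gap h₂ ⊕ 0≤v ⊛ gap h₁) (solve (k ∷ K ∷ a ∷ b ∷ c ∷ x ∷ v ∷ B ∷ []) ℚ-ring)))
        (≤-by (const (+ 128 / 1) ⊛ (gap k≤K ⊛ gap b≤a) ⊕ const (+ 112 / 1) ⊛ ((0≤k ⊕ gap k≤K) ⊛ gap c≤b))
          (solve (k ∷ K ∷ a ∷ b ∷ c ∷ []) ℚ-ring))

    -- Summing α-gain over h steps of two multiplies the number of cups by three.
    α-triple : ∀ {h} → 8 ≤ h → 3 * h ≤ n → (∀ {k} → h ≤ k → k ≤ n → + 16 / 1 *ᵣ X k ≤ᵣ ι B) →
               1ℚ ≤ᵣ + 512 / 1 *ᵣ (α h -ᵣ α (3 * h))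
    α-triple {h} 8≤h 3h≤n small = conclude (ι h) (inv h) (α h) (α (3 * h)) (inv-cancel 1≤h) (0≤inv h) (subst (λ k → ι h ≤ᵣ + 512 / 1 *ᵣ ι h *ᵣ (α h -ᵣ α k)) (cong (h ℕ.+_) (ℕ.*-comm h 2)) (steps h ℕ.≤-refl))
      where
      1≤h : 1 ≤ h
      1≤h = ℕ.≤-trans (s≤s z≤n) 8≤h
      conclude : ∀ h v a b → v *ᵣ h ≡ 1ℚ → 0ℚ ≤ᵣ v → h ≤ᵣ + 512 / 1 *ᵣ h *ᵣ (a -ᵣ b) → 1ℚ ≤ᵣ + 512 / 1 *ᵣ (a -ᵣ b)
      conclude h v a b vh 0≤v le = subst₂ _≤ᵣ_ vh (trans (cong (_*ᵣ (+ 512 / 1 *ᵣ (a -ᵣ b))) vh) (ℚ.*-identityˡ _))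
        (≤-by (0≤v ⊛ gap le) (solve (h ∷ v ∷ a ∷ b ∷ []) ℚ-ring))
      -- All cup numbers involved are at most 4 h, so each step of two contributes 1 / (128 · 4 h) =
      -- 1 / (512 h).
      steps : ∀ i → i ≤ h → ι i ≤ᵣ + 512 / 1 *ᵣ ι h *ᵣ (α h -ᵣ α (h + i * 2))
      steps zero    _   = ℚ.≤-reflexive (trans (ι-/ 0) (trans (sym (zero-diff (ι h) (α h)))
        (cong (λ k → + 512 / 1 *ᵣ ι h *ᵣ (α h -ᵣ α k)) (sym (ℕ.+-identityʳ h)))))
        where
        zero-diff : ∀ h a → + 512 / 1 *ᵣ h *ᵣ (a -ᵣ a) ≡ 0ℚ
        zero-diff h a = solve (h ∷ a ∷ []) ℚ-ring
      steps (suc i) i<h = subst₂ (λ x k → x ≤ᵣ + 512 / 1 *ᵣ ι h *ᵣ (α h -ᵣ α k))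
        (trans (cong (_+ᵣ ι i) (sym (ι-/ 1))) (sym (ι-+ 1 i))) (sym index)
        (go (ι i) (ι h) (ι (2 + j)) (α h) (α j) (α (2 + j)) (steps i (ℕ.<⇒≤ i<h))
          (α-gain (ℕ.≤-trans 8≤h h≤j) 2+j≤n (small (ℕ.≤-trans h≤j (ℕ.m≤n+m j 2)) 2+j≤n))
          (subst (ι (2 + j) ≤ᵣ_) (trans (ι-* 4 h) (cong (_*ᵣ ι h) (ι-/ 4))) (ι-mono 2+j≤4h))
          (α-mono 2 (ℕ.≤-trans 1≤h h≤j) 2+j≤n))
        where
        j = h + i * 2
        index : h + suc i * 2 ≡ 2 + j
        index = trans (ℕ.+-suc h (suc (i * 2))) (cong suc (ℕ.+-suc h (i * 2)))
        h≤j : h ≤ j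
        h≤j = ℕ.m≤m+n h (i * 2)
        2+j≤3h : 2 + j ≤ 3 * h
        2+j≤3h = ℕ.≤-trans (ℕ.≤-reflexive (sym index)) (ℕ.+-monoʳ-≤ h (ℕ.≤-trans (ℕ.*-monoˡ-≤ 2 i<h) (ℕ.≤-reflexive (ℕ.*-comm h 2))))
        2+j≤n : 2 + j ≤ n
        2+j≤n = ℕ.≤-trans 2+j≤3h 3h≤n
        2+j≤4h : 2 + j ≤ 4 * h
        2+j≤4h = ℕ.≤-trans 2+j≤3h (ℕ.*-monoˡ-≤ h (ℕ.n≤1+n 3))
        go : ∀ i h K a b c → i ≤ᵣ + 512 / 1 *ᵣ h *ᵣ (a -ᵣ b) → 1ℚ ≤ᵣ + 128 / 1 *ᵣ K *ᵣ (b -ᵣ c) → K ≤ᵣ + 4 / 1 *ᵣ h →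
             c ≤ᵣ b → 1ℚ +ᵣ i ≤ᵣ + 512 / 1 *ᵣ h *ᵣ (a -ᵣ c)
        go i h K a b c h₁ h₂ h₃ h₄ = ≤-by (gap h₁ ⊕ gap h₂ ⊕ const (+ 128 / 1) ⊛ (gap h₃ ⊛ gap h₄))
          (solve (i ∷ h ∷ K ∷ a ∷ b ∷ c ∷ []) ℚ-ring)

    -- Telescoping along h, 3 h, 9 h and so on: each tripling is worth the same 1/512, so the gain
    -- is logarithmic in the ratio of cup numbers.
    α-iterate : ∀ r {h} → 8 ≤ h → 3 ^ r * h ≤ n → (∀ {k} → h ≤ k → k ≤ n → + 16 / 1 *ᵣ X k ≤ᵣ ι B) →
                ι r ≤ᵣ + 512 / 1 *ᵣ α h
    α-iterate zero    {h} _   _ _ = subst (_≤ᵣ + 512 / 1 *ᵣ α h) (sym (ι-/ 0)) (const (+ 512 / 1) ⊛ α-≥0 h)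
    α-iterate (suc r) {h} 8≤h 3ʳ⁺¹h≤n small = subst (_≤ᵣ + 512 / 1 *ᵣ α h)
      (trans (cong (_+ᵣ ι r) (sym (ι-/ 1))) (sym (ι-+ 1 r)))
      (go (ι r) (α h) (α (3 * h))
        (α-iterate r (ℕ.≤-trans 8≤h h≤3h) 3ʳ3h≤n (λ 3h≤k → small (ℕ.≤-trans h≤3h 3h≤k)))
        (α-triple 8≤h (ℕ.≤-trans (ℕ.m≤n*m (3 * h) (3 ^ r) {{ℕ.m^n≢0 3 r}}) 3ʳ3h≤n) small))
      where
      h≤3h : h ≤ 3 * h
      h≤3h = ℕ.m≤m+n h _
      3ʳ3h≤n : 3 ^ r * (3 * h) ≤ n
      3ʳ3h≤n = ℕ.≤-trans (ℕ.≤-reflexive (trans (sym (ℕ.*-assoc (3 ^ r) 3 h)) (cong (_* h) (ℕ.*-comm (3 ^ r) 3)))) 3ʳ⁺¹h≤n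
      go : ∀ r a b → r ≤ᵣ + 512 / 1 *ᵣ b → 1ℚ ≤ᵣ + 512 / 1 *ᵣ (a -ᵣ b) → 1ℚ +ᵣ r ≤ᵣ + 512 / 1 *ᵣ a
      go r a b h₁ h₂ = ≤-by (gap h₁ ⊕ gap h₂) (solve (r ∷ a ∷ b ∷ []) ℚ-ring)

-- Logarithms and powers

log-lower : ∀ e {n} → 2 ^ e ≤ n → e ≤ ⌊log₂ n ⌋
log-lower e {n} h = subst (_≤ ⌊log₂ n ⌋) (⌊log₂[2^n]⌋≡n e) (⌊log₂⌋-mono-≤ h)

log-upper : ∀ e {n} → n ≤ 2 ^ e → ⌊log₂ n ⌋ ≤ e
log-upper e {n} h = subst (⌊log₂ n ⌋ ≤_) (⌊log₂[2^n]⌋≡n e) (⌊log₂⌋-mono-≤ h)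

2^log≤ : ∀ n .{{_ : NonZero n}} → 2 ^ ⌊log₂ n ⌋ ≤ n
2^log≤ n = below ⌊log₂ n ⌋ n ℕ.≤-refl
  where
  below : ∀ e n .{{_ : NonZero n}} → e ≤ ⌊log₂ n ⌋ → 2 ^ e ≤ n
  below zero    (suc n)         _   = s≤s z≤n
  below (suc e) (suc (suc n)) e<l = ℕ.≤-trans
    (ℕ.*-monoʳ-≤ 2 (below e (suc ℕ.⌊ n /2⌋)
      (subst (e ≤_) (sym (⌊log₂⌊n/2⌋⌋≡⌊log₂n⌋∸1 (suc (suc n)))) (ℕ.∸-monoˡ-≤ 1 e<l))))
    (ℕ.≤-trans (ℕ.≤-reflexive (cong (ℕ.⌊ suc (suc n) /2⌋ ℕ.+_) (ℕ.+-identityʳ _)))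
      (ℕ.≤-trans (ℕ.+-monoʳ-≤ ℕ.⌊ suc (suc n) /2⌋ (ℕ.⌊n/2⌋≤⌈n/2⌉ (suc (suc n)))) (ℕ.≤-reflexive (ℕ.⌊n/2⌋+⌈n/2⌉≡n (suc (suc n))))))

<2^log : ∀ n → n < 2 ^ suc ⌊log₂ n ⌋
<2^log n = ℕ.≰⇒> (λ h → ℕ.1+n≰n (log-lower (suc ⌊log₂ n ⌋) h))

^-cancelˡ-≤ : ∀ k {a b} → a ^ suc k ≤ b ^ suc k → a ≤ b
^-cancelˡ-≤ k h = ℕ.≮⇒≥ (λ b<a → ℕ.<⇒≱ (ℕ.^-monoˡ-< (suc k) b<a) h)

^-cancelˡ-< : ∀ k {a b} → a ^ k < b ^ k → a < b
^-cancelˡ-< k h = ℕ.≰⇒> (λ b≤a → ℕ.<⇒≱ h (ℕ.^-monoˡ-≤ k b≤a))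

^-exchange : ∀ a b c → (a ^ b) ^ c ≡ (a ^ c) ^ b
^-exchange a b c = trans (ℕ.^-*-assoc a b c) (trans (cong (a ^_) (ℕ.*-comm b c)) (sym (ℕ.^-*-assoc a c b)))

fraction-≤ : ∀ a b c d → (∀ k → + a / suc b ≤ᵣ + c / suc d +ᵣ + 2 / 1 *ᵣ inv (suc k)) → a * suc d ≤ c * suc b
fraction-≤ a b c d h = ι-cancel (subst₂ _≤ᵣ_ (sym (ι-* a (suc d))) (sym (ι-* c (suc b)))
  (go (ι a) (ι (suc b)) (inv (suc b)) (ι c) (ι (suc d)) (inv (suc d)) (ι-inv b) (ι-inv d) (0≤ι (suc b)) (0≤ι (suc d))
    (archimedean λ k → ℚ.≤-trans (subst₂ (λ x y → x ≤ᵣ y +ᵣ + 2 / 1 *ᵣ inv (suc k)) (/-split a b) (/-split c d) (h k))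
      (≤-by (const (+ 4 / 1) ⊛ 0≤inv (suc k)) (widen (ι c *ᵣ inv (suc d)) (inv (suc k)))))))
  where
  widen : ∀ x w → x +ᵣ + 6 / 1 *ᵣ w ≡ x +ᵣ + 2 / 1 *ᵣ w +ᵣ + 4 / 1 *ᵣ w
  widen x w = solve (x ∷ w ∷ []) ℚ-ring
  go : ∀ a b v c d w → b *ᵣ v ≡ 1ℚ → d *ᵣ w ≡ 1ℚ → 0ℚ ≤ᵣ b → 0ℚ ≤ᵣ d → a *ᵣ v ≤ᵣ c *ᵣ w → a *ᵣ d ≤ᵣ c *ᵣ b
  go a b v c d w bv dw 0≤b 0≤d h = subst₂ _≤ᵣ_
    (trans (cong (a *ᵣ d *ᵣ_) bv) (ℚ.*-identityʳ (a *ᵣ d))) (trans (cong (c *ᵣ b *ᵣ_) dw) (ℚ.*-identityʳ (c *ᵣ b))) scaled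
    where
    scaled : a *ᵣ d *ᵣ (b *ᵣ v) ≤ᵣ c *ᵣ b *ᵣ (d *ᵣ w)
    scaled = ≤-by (0≤b ⊛ 0≤d ⊛ gap h) (solve (a ∷ b ∷ v ∷ c ∷ d ∷ w ∷ []) ℚ-ring)

-- The definition compares through some rational a / b on the correct side of the exponent. Raising
-- to a common power eliminates it and leaves an inequality between integers.
power-below : ∀ {m n p q} .{{_ : NonZero n}} → m <Power[ n , fromℚ (+ p / suc q) ] → m ^ suc q < n ^ p
power-below {m} {n} {p} {q} (a , b , a/b≤ , m^b<n^a) = ^-cancelˡ-< (suc b) (begin-strict
  (m ^ suc q) ^ suc b  ≡⟨ ^-exchange m (suc q) (suc b) ⟩
  (m ^ suc b) ^ suc q  <⟨ ℕ.^-monoˡ-< (suc q) m^b<n^a ⟩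
  (n ^ a) ^ suc q      ≡⟨ ℕ.^-*-assoc n a (suc q) ⟩
  n ^ (a * suc q)      ≤⟨ ℕ.^-monoʳ-≤ n (fraction-≤ a b p q (≤ℝ⇒seq {fromℚ (+ a / suc b)} {fromℚ (+ p / suc q)} a/b≤)) ⟩
  n ^ (p * suc b)      ≡⟨ ℕ.^-*-assoc n p (suc b) ⟨
  (n ^ p) ^ suc b      ∎)
  where open ℕ.≤-Reasoning

power-above : ∀ {m n p q} .{{_ : NonZero n}} → Power[ n , fromℚ (+ p / suc q) ]< m → n ^ p < m ^ suc q
power-above {m} {n} {p} {q} (a , b , ≤a/b , n^a<m^b) = ^-cancelˡ-< (suc b) (begin-strict
  (n ^ p) ^ suc b      ≡⟨ ℕ.^-*-assoc n p (suc b) ⟩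
  n ^ (p * suc b)      ≤⟨ ℕ.^-monoʳ-≤ n (fraction-≤ p q a b (≤ℝ⇒seq {fromℚ (+ p / suc q)} {fromℚ (+ a / suc b)} ≤a/b)) ⟩
  n ^ (a * suc q)      ≡⟨ ℕ.^-*-assoc n a (suc q) ⟨
  (n ^ a) ^ suc q      <⟨ ℕ.^-monoˡ-< (suc q) n^a<m^b ⟩
  (m ^ suc b) ^ suc q  ≡⟨ ^-exchange m (suc b) (suc q) ⟩
  (m ^ suc q) ^ suc b  ∎)
  where open ℕ.≤-Reasoning

log₂-seq-≥ : ∀ n .{{_ : NonZero n}} i → ι ⌊log₂ n ⌋ ≤ᵣ seq (log₂ n) i
log₂-seq-≥ n i = subst₂ _≤ᵣ_ (cancel (ι l) (ι (suc i)) (inv (suc i)) (ι-inv i)) (sym (/-split _ i))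
  (ℚ.*-monoʳ-≤-nonNeg (inv (suc i)) {{ℚ.nonNegative (0≤inv (suc i))}} (subst (_≤ᵣ ι ⌊log₂ n ^ suc i ⌋) (ι-* l (suc i))
    (ι-mono (log-lower (l * suc i) (subst (_≤ n ^ suc i) (ℕ.^-*-assoc 2 l (suc i)) (ℕ.^-monoˡ-≤ (suc i) (2^log≤ n)))))))
  where
  l = ⌊log₂ n ⌋
  cancel : ∀ l k v → k *ᵣ v ≡ 1ℚ → l *ᵣ k *ᵣ v ≡ l
  cancel l k v h = trans (ℚ.*-assoc l k v) (trans (cong (l *ᵣ_) h) (ℚ.*-identityʳ l))

log₂-seq-≤ : ∀ n i → seq (log₂ n) i ≤ᵣ ι (suc ⌊log₂ n ⌋)
log₂-seq-≤ n i = subst₂ _≤ᵣ_ (sym (/-split _ i)) (cancel (ι l′) (ι (suc i)) (inv (suc i)) (ι-inv i))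
  (ℚ.*-monoʳ-≤-nonNeg (inv (suc i)) {{ℚ.nonNegative (0≤inv (suc i))}} (subst (ι ⌊log₂ n ^ suc i ⌋ ≤ᵣ_) (ι-* l′ (suc i))
    (ι-mono (log-upper (l′ * suc i) (subst (n ^ suc i ≤_) (ℕ.^-*-assoc 2 l′ (suc i)) (ℕ.^-monoˡ-≤ (suc i) (ℕ.<⇒≤ (<2^log n))))))))
  where
  l′ = suc ⌊log₂ n ⌋
  cancel : ∀ l k v → k *ᵣ v ≡ 1ℚ → l *ᵣ k *ᵣ v ≡ l
  cancel l k v h = trans (ℚ.*-assoc l k v) (trans (cong (l *ᵣ_) h) (ℚ.*-identityʳ l))

-- The approximations of `log₂ n` never fall below its floor, so the rational bounding the logarithm
-- from above bounds the floor as well.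
power-log-above : ∀ {N n m} .{{_ : NonZero n}} .{{_ : NonZero N}} → Power[ N , log₂ n ]< m → N ^ ⌊log₂ n ⌋ < m
power-log-above {N} {n} {m} (a , b , ≤a/b , N^a<m^b) = ^-cancelˡ-< (suc b) (begin-strict
  (N ^ l) ^ suc b  ≡⟨ ℕ.^-*-assoc N l (suc b) ⟩
  N ^ (l * suc b)  ≤⟨ ℕ.^-monoʳ-≤ N (ℕ.≤-trans (fraction-≤ l 0 a b seq-bound) (ℕ.≤-reflexive (ℕ.*-identityʳ a))) ⟩
  N ^ a            <⟨ N^a<m^b ⟩
  m ^ suc b        ∎)
  where
  open ℕ.≤-Reasoning
  l = ⌊log₂ n ⌋
  seq-bound : ∀ k → + l / 1 ≤ᵣ + a / suc b +ᵣ + 2 / 1 *ᵣ inv (suc k)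
  seq-bound k = ℚ.≤-trans (subst (_≤ᵣ seq (log₂ n) k) (ι-/ l) (log₂-seq-≥ n k)) (≤ℝ⇒seq {log₂ n} {fromℚ (+ a / suc b)} ≤a/b k)

log₂≤ : ∀ n {q} → ι (suc ⌊log₂ n ⌋) ≤ᵣ q → log₂ n ≤ℝ fromℚ q
log₂≤ n {q} l≤q (i , q<log) = ℚ.<-irrefl refl (ℚ.<-≤-trans q<log (ℚ.≤-trans (log₂-seq-≤ n i) (ℚ.≤-trans l≤q
  (≤-by (0≤ι 2 ⊛ 0≤inv (suc i)) (cong (q +ᵣ_) (/-split 2 i))))))

-- Everything is bounded by a power of `n`: the factors 2 and B contribute exponents 1 and B, and
-- the cubes 3 (B + 1). Together this is 4 B + 4, at most 8 B, which is where `c` has to be at least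
-- 8.
phase-long : ∀ n c l → 2 ≤ n → 1 ≤ l → 8 ≤ c → 2 * (n * l * (n * n * n) ^ suc (n * l)) ≤ (n ^ (c * n)) ^ l
phase-long n c l 2≤n 1≤l 8≤c = begin
  2 * (B * (n * n * n) ^ suc B)        ≡⟨ cong (λ x → 2 * (B * x ^ suc B)) (cube n) ⟩
  2 * (B * (n ^ 3) ^ suc B)            ≡⟨ cong (λ x → 2 * (B * x)) (ℕ.^-*-assoc n 3 (suc B)) ⟩
  2 * (B * n ^ (3 * suc B))            ≤⟨ ℕ.*-mono-≤ 2≤n (ℕ.*-monoˡ-≤ (n ^ (3 * suc B)) B≤n^B) ⟩
  n * (n ^ B * n ^ (3 * suc B))        ≡⟨ cong (n *_) (ℕ.^-distribˡ-+-* n B (3 * suc B)) ⟨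
  n ^ suc (B + 3 * suc B)              ≤⟨ ℕ.^-monoʳ-≤ n exponent ⟩
  n ^ (c * n * l)                      ≡⟨ ℕ.^-*-assoc n (c * n) l ⟨
  (n ^ (c * n)) ^ l                    ∎
  where
  open ℕ.≤-Reasoning
  B = n * l
  instance
    n≢0 : NonZero n
    n≢0 = ℕ.>-nonZero (ℕ.≤-trans (s≤s z≤n) 2≤n)
  cube : ∀ n → n * n * n ≡ n ^ 3
  cube n = trans (ℕ.*-assoc n n n) (cong (λ x → n * (n * x)) (sym (ℕ.*-identityʳ n)))
  n<2^n : ∀ k → suc k ≤ 2 ^ k
  n<2^n zero    = s≤s z≤n
  n<2^n (suc k) = ℕ.+-mono-≤ (ℕ.m^n>0 2 k) (ℕ.≤-trans (n<2^n k) (ℕ.≤-reflexive (sym (ℕ.+-identityʳ _))))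
  B≤n^B : B ≤ n ^ B
  B≤n^B = ℕ.≤-trans (ℕ.≤-trans (ℕ.n≤1+n B) (n<2^n B)) (ℕ.^-monoˡ-≤ B 2≤n)
  1≤B : 1 ≤ B
  1≤B = ℕ.*-mono-≤ (ℕ.≤-trans (s≤s z≤n) 2≤n) 1≤l
  exponent : suc (B + 3 * suc B) ≤ c * n * l
  exponent = ℕ.≤-trans (ℕ.≤-reflexive (reorder₁ B)) (ℕ.≤-trans (ℕ.+-monoʳ-≤ (4 * B) (ℕ.*-monoʳ-≤ 4 1≤B))
    (ℕ.≤-trans (ℕ.≤-reflexive (reorder₂ n l)) (ℕ.*-monoˡ-≤ l (ℕ.*-monoˡ-≤ n 8≤c))))
    where
    reorder₁ : ∀ B → suc (B + 3 * suc B) ≡ 4 * B + 4 * 1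
    reorder₁ B = ℕSolver.solve (B ∷ [])
    reorder₂ : ∀ n l → 4 * (n * l) + 4 * (n * l) ≡ 8 * n * l
    reorder₂ n l = ℕSolver.solve (n ∷ l ∷ [])

-- 512 is the cube of 8: with fewer than 8 cups left, the cube of m + 1 would be at most 512, hence
-- at most the square of n.
cups-left-≥ : ∀ {n m} → 512 ≤ n → n ^ 2 < suc m ^ 3 → 8 ≤ m
cups-left-≥ {n} {m} 512≤n n²<m³ = ℕ.≮⇒≥ (λ m<8 → ℕ.<⇒≱ n²<m³ (ℕ.≤-trans (ℕ.^-monoˡ-≤ 3 m<8)
  (ℕ.≤-trans 512≤n (ℕ.≤-trans (ℕ.m≤m*n n n {{ℕ.>-nonZero (ℕ.≤-trans (s≤s z≤n) 512≤n)}})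
    (ℕ.≤-reflexive (cong (n *_) (sym (ℕ.*-identityʳ n))))))))

-- After cubing, and with 3 replaced by 4 and m by twice m - 1, the factors besides the cube of m -
-- 1 form the power of two `2 ^ (6 * r + 3)`, bounded by the one factor of n that separates its
-- square from its cube.
cups-left-≤ : ∀ {n m r} → 8 ≤ m → 2 ^ (6 * r + 3) ≤ n → (m ∸ 1) ^ 3 < n ^ 2 → 3 ^ r * m ≤ n
cups-left-≤ {n} {suc m} {r} (s≤s 7≤m) 2^≤n m³<n² = ^-cancelˡ-≤ 2 (begin
  (3 ^ r * suc m) ^ 3            ≤⟨ ℕ.^-monoˡ-≤ 3 (ℕ.*-mono-≤ (ℕ.^-monoˡ-≤ r (ℕ.n≤1+n 3)) m≤2m) ⟩
  (4 ^ r * (2 * m)) ^ 3          ≡⟨ reorder (4 ^ r) m ⟩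
  (4 ^ r) ^ 3 * 8 * m ^ 3        ≡⟨ cong (λ x → x * 8 * m ^ 3) (trans (cong (_^ 3) (ℕ.^-*-assoc 2 2 r)) (trans (ℕ.^-*-assoc 2 (2 * r) 3) (cong (2 ^_) (six r)))) ⟩
  2 ^ (6 * r) * 2 ^ 3 * m ^ 3    ≡⟨ cong (_* m ^ 3) (ℕ.^-distribˡ-+-* 2 (6 * r) 3) ⟨
  2 ^ (6 * r + 3) * m ^ 3        ≤⟨ ℕ.*-mono-≤ 2^≤n (ℕ.<⇒≤ m³<n²) ⟩
  n * n ^ 2                      ∎)
  where
  open ℕ.≤-Reasoning
  m≤2m : suc m ≤ 2 * m
  m≤2m = ℕ.≤-trans (ℕ.+-monoˡ-≤ m (ℕ.≤-trans (s≤s z≤n) 7≤m)) (ℕ.≤-reflexive (cong (m ℕ.+_) (sym (ℕ.+-identityʳ m))))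
  reorder : ∀ x m → x * (2 * m) * (x * (2 * m) * (x * (2 * m) * 1)) ≡ x * (x * (x * 1)) * 8 * (m * (m * (m * 1)))
  reorder x m = ℕSolver.solve (x ∷ m ∷ [])
  six : ∀ r → 2 * r * 3 ≡ 6 * r
  six r = ℕSolver.solve (r ∷ [])

-- The bound on the average, within and beyond the budget

large-average : ∀ n v l a {l′} → v *ᵣ n ≡ 1ℚ → 0ℚ ≤ᵣ v → 0ℚ ≤ᵣ a → n *ᵣ l ≤ᵣ + 16 / 1 *ᵣ (n *ᵣ a) →
                -- Here a is at least l / 16, so l′ is at most 32 a, while the target is 24 · 512 =
                -- 12288 times a; 12256 is the difference.
                l′ ≤ᵣ + 2 / 1 *ᵣ l → l′ ≤ᵣ + 24 / 1 *ᵣ (+ 512 / 1 *ᵣ a)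
large-average n v l a vn 0≤v 0≤a h h′ = ℚ.≤-trans h′ (≤-by
    (const (+ 2 / 1) ⊛ gap l≤ ⊕ const (+ 12256 / 1) ⊛ 0≤a) (solve (l ∷ a ∷ []) ℚ-ring))
  where
  scaled : v *ᵣ n *ᵣ l ≤ᵣ v *ᵣ n *ᵣ (+ 16 / 1 *ᵣ a)
  scaled = ≤-by (0≤v ⊛ gap h) (solve (n ∷ v ∷ l ∷ a ∷ []) ℚ-ring)
  l≤ : l ≤ᵣ + 16 / 1 *ᵣ a
  l≤ = subst₂ _≤ᵣ_ (trans (cong (_*ᵣ l) vn) (ℚ.*-identityˡ l)) (trans (cong (_*ᵣ (+ 16 / 1 *ᵣ a)) vn) (ℚ.*-identityˡ (+ 16 / 1 *ᵣ a))) scaled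

module _ (c : ℕ) (8≤c : 8 ≤ c) (n : ℕ) (2²³≤n : 2 ^ 23 ≤ n) (e : ScoreBasedEmptier n) (L m : ℕ)
         (L-rounds : L RoundsPower[ n ^ (c * n) , log₂ n ]) (m-rounds : m RoundsPower[ n , fromℚ (+ 2 / 3) ]) where

  private
    l = ⌊log₂ n ⌋
    B = n * l
    -- The number of triplings: small enough for `6 * r + 3 ≤ l`, as `cups-left-≤` requires, and
    -- large enough for `suc l ≤ 24 * r`.
    r = l ℕ./ 12

    23≤l : 23 ≤ l
    23≤l = log-lower 23 2²³≤n

    2^9≤n : 2 ^ 9 ≤ n
    2^9≤n = ℕ.≤-trans (ℕ.^-monoʳ-≤ 2 (ℕ.m≤m+n 9 14)) 2²³≤n

    2≤n : 2 ≤ n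
    2≤n = ℕ.≤-trans (ℕ.^-monoʳ-≤ 2 (ℕ.m≤m+n 1 8)) 2^9≤n

    1≤n : 1 ≤ n
    1≤n = ℕ.≤-trans (s≤s z≤n) 2≤n

    1≤l : 1 ≤ l
    1≤l = ℕ.≤-trans (s≤s z≤n) 23≤l

    instance
      n≢0 : NonZero n
      n≢0 = ℕ.>-nonZero 1≤n

    8≤m : 8 ≤ m
    8≤m = cups-left-≥ 2^9≤n (power-above {suc m} {n} {2} {2} (proj₂ m-rounds))

    r*12≤l : r * 12 ≤ l
    r*12≤l = ℕ.m/n*n≤m l 12

    l<r*12+12 : l < r * 12 + 12
    l<r*12+12 = subst (_< r * 12 + 12) (trans (ℕ.+-comm (r * 12) (l ℕ.% 12)) (sym (ℕ.m≡m%n+[m/n]*n l 12))) (ℕ.+-monoʳ-< (r * 12) (ℕ.m%n<n l 12))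

    1≤r : 1 ≤ r
    1≤r = ℕ.≮⇒≥ (λ r<1 → ℕ.<⇒≱ (ℕ.<-≤-trans l<r*12+12 (ℕ.+-monoˡ-≤ 12 (ℕ.*-monoˡ-≤ 12 (ℕ.s≤s⁻¹ r<1)))) (ℕ.≤-trans (ℕ.m≤m+n 12 11) 23≤l))

    l+1≤24r : suc l ≤ 24 * r
    l+1≤24r = ℕ.≤-trans l<r*12+12 (ℕ.≤-trans (ℕ.+-monoʳ-≤ (r * 12) (ℕ.*-monoˡ-≤ 12 1≤r)) (ℕ.≤-reflexive (reorder r)))
      where
      reorder : ∀ r → r * 12 + r * 12 ≡ 24 * r
      reorder r = ℕSolver.solve (r ∷ [])

    6r+3≤l : 6 * r + 3 ≤ l
    6r+3≤l = ℕ.*-cancelˡ-≤ 2 (ℕ.≤-trans (ℕ.≤-reflexive (reorder r)) (ℕ.≤-trans (ℕ.+-mono-≤ r*12≤l (ℕ.≤-trans (ℕ.m≤m+n 6 17) 23≤l))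
      (ℕ.≤-reflexive (cong (l ℕ.+_) (sym (ℕ.+-identityʳ l))))))
      where
      reorder : ∀ r → 2 * (6 * r + 3) ≡ r * 12 + 6
      reorder r = ℕSolver.solve (r ∷ [])

    3ʳm≤n : 3 ^ r * m ≤ n
    3ʳm≤n = cups-left-≤ {r = r} 8≤m (ℕ.≤-trans (ℕ.^-monoʳ-≤ 2 6r+3≤l) (2^log≤ n)) (power-below {m ∸ 1} {n} {2} {2} (proj₁ m-rounds))

    m≤n : m ≤ n
    m≤n = ℕ.≤-trans (ℕ.m≤n*m m (3 ^ r) {{ℕ.m^n≢0 3 r}}) 3ʳm≤n

    long : 2 * (B * (n * n * n) ^ suc B) ≤ L
    long = ℕ.≤-trans (phase-long n c l 2≤n 1≤l 8≤c)
      (ℕ.s≤s⁻¹ (power-log-above {n ^ (c * n)} {n} {{n≢0}} {{ℕ.m^n≢0 n (c * n)}} (proj₂ L-rounds)))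

  open Averages e L
  open Scores e using (Comparable; levels)

  -- Averages only increase as cups are dropped, so if n times the last average is within the
  -- budget, then so is every earlier total, and all triplings pay off.
  small-case : Comparable (suc B) → + 16 / 1 *ᵣ (ι n *ᵣ α m) ≤ᵣ ι B → ι (suc l) ≤ᵣ + 24 / 1 *ᵣ (+ 512 / 1 *ᵣ α m)
  small-case cmp small = ℚ.≤-trans (subst (ι (suc l) ≤ᵣ_) (trans (ι-* 24 r) (cong (_*ᵣ ι r) (ι-/ 24))) (ι-mono l+1≤24r))
      (*-monoˡ (const (+ 24 / 1)) (α-iterate B 2≤n (ℕ.*-mono-≤ 1≤n 1≤l) long (levels cmp) r 8≤m 3ʳm≤n later-small))
    where
    1≤m : 1 ≤ m
    1≤m = ℕ.≤-trans (s≤s z≤n) 8≤m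
    α≤ : ∀ {k} → m ≤ k → k ≤ n → α k ≤ᵣ α m
    α≤ {k} m≤k k≤n = subst (λ j → α j ≤ᵣ α m) (ℕ.m∸n+n≡m m≤k) (α-mono (k ∸ m) 1≤m (ℕ.≤-trans (ℕ.≤-reflexive (ℕ.m∸n+n≡m m≤k)) k≤n))
    later-small : ∀ {k} → m ≤ k → k ≤ n → + 16 / 1 *ᵣ X k ≤ᵣ ι B
    later-small {k} m≤k k≤n = ℚ.≤-trans (*-monoˡ (const (+ 16 / 1)) (ℚ.≤-trans (ℚ.≤-reflexive (X≡α (ℕ.≤-trans 1≤m m≤k)))
      (ℚ.≤-trans (*-monoˡ (0≤ι k) (α≤ m≤k k≤n)) (ℚ.*-monoʳ-≤-nonNeg (α m) {{ℚ.nonNegative (α-≥0 m)}} (ι-mono k≤n))))) small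

  -- Dividing by n, an average beyond the budget is already at least a sixteenth of the floor of the
  -- logarithm.
  large-case : ι B ≤ᵣ + 16 / 1 *ᵣ (ι n *ᵣ α m) → ι (suc l) ≤ᵣ + 24 / 1 *ᵣ (+ 512 / 1 *ᵣ α m)
  large-case large = large-average (ι n) (inv n) (ι l) (α m) (inv-cancel 1≤n) (0≤inv n) (α-≥0 m)
      (subst (_≤ᵣ + 16 / 1 *ᵣ (ι n *ᵣ α m)) (ι-* n l) large)
      (subst (ι (suc l) ≤ᵣ_) (trans (ι-* 2 l) (cong (_*ᵣ ι l) (ι-/ 2)))
        (ι-mono (ℕ.≤-trans (ℕ.+-monoˡ-≤ l 1≤l) (ℕ.≤-reflexive (cong (l ℕ.+_) (sym (ℕ.+-identityʳ l)))))))

  average-bound : Comparable (suc B) → ι (suc l) ≤ᵣ + 24 / 1 *ᵣ (+ 512 / 1 *ᵣ α m)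
  average-bound cmp = [ small-case cmp , large-case ]′ (ℚ.≤-total (+ 16 / 1 *ᵣ (ι n *ᵣ α m)) (ι B))

  -- The claim is a negation, so the finitely many scores may be assumed comparable.
  log≤average : log₂ n ≤ℝ fromℚ (+ 24576 / 1 *ᵣ expectedAverageFill e L m)
  log≤average lt = Scores.¬¬-Comparable e (suc B) λ cmp →
    log₂≤ n (subst (ι (suc l) ≤ᵣ_) (trans (halve (α m)) (cong (+ 24576 / 1 *ᵣ_) (sym (expected≡α m≤n)))) (average-bound cmp)) lt
    where
    halve : ∀ a → + 24 / 1 *ᵣ (+ 512 / 1 *ᵣ a) ≡ + 24576 / 1 *ᵣ (½ *ᵣ a)
    halve a = trans (double (+ 24 / 1) (+ 512 / 1) a) (cong (_*ᵣ (½ *ᵣ a)) (begin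
      + 24 / 1 *ᵣ (+ 512 / 1 *ᵣ (+ 2 / 1))  ≡⟨ cong₂ _*ᵣ_ (sym (ι-/ 24)) (cong₂ _*ᵣ_ (sym (ι-/ 512)) (sym (ι-/ 2))) ⟩
      ι 24 *ᵣ (ι 512 *ᵣ ι 2)              ≡⟨ cong (ι 24 *ᵣ_) (ι-* 512 2) ⟨
      ι 24 *ᵣ ι (512 * 2)                 ≡⟨ ι-* 24 (512 * 2) ⟨
      ι (24 * (512 * 2))                  ≡⟨ ι-/ (24 * (512 * 2)) ⟩
      + (24 * (512 * 2)) / 1              ∎))
      where
      open ≡-Reasoning
      double : ∀ x y a → x *ᵣ (y *ᵣ a) ≡ x *ᵣ (y *ᵣ (+ 2 / 1)) *ᵣ (½ *ᵣ a)
      double x y a = solve (x ∷ y ∷ a ∷ []) ℚ-ring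

theorem6p6 : ∃[ c₀ ] (∀ c → c₀ ≤ c →
    ∃[ C ] ∃[ n₀ ] (∀ n → n₀ ≤ n →
    (e : ScoreBasedEmptier n) →
    ∀ L m →
    L RoundsPower[ n ^ (c * n) , log₂ n ] →
    m RoundsPower[ n , fromℚ (+ 2 / 3) ] →
    log₂ n ≤ℝ fromℚ (+ C / 1 ℚ.* expectedAverageFill e L m)))
-- The constant 24576 is 24 · 512 · 2: the first factor compares the logarithm with the number of
-- triplings, the second is the cost of a tripling, and the last converts half units to units. With
-- `2 ^ 23` the floor of the logarithm is at least 23, so there is at least one tripling.
theorem6p6 = 8 , λ c 8≤c → 24576 , 2 ^ 23 , log≤average c 8≤c
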